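{- There is an absolute constant $c>0$ such that the following holds for every class $\mathcal{G}$ of Boolean functions on $n$ bits, every integer $s\geq 2$ and every $0<\varepsilon<1$. Let $t=c\sqrt{s}\log(1/\varepsilon)$ and $\delta=2^{ -c\sqrt{s}\log(s)\log(1/\varepsilon)}$. If a distribution $\mathcal{D}$ over $\{0,1\}^n$ $\delta$-fools every function that is the parity (XOR) of at most $t$ functions from $\mathcal{G}$, then $\mathcal{D}$ $\varepsilon$-fools ${\sf FORMULA}[s]\circ\mathcal{G}$. The same conclusion holds if instead $\mathcal{D}$ $\delta$-fools every function that is the conjunction (AND) of at most $t$ functions from $\mathcal{G}$.
   Context: A de Morgan formula is a rooted tree whose internal gates are AND, OR (fan-in 2) and NOT (fan-in 1) and whose leaves are labelled by inputs; its size is the number of leaves. For a class $\mathcal{G}$ of Boolean functions on $n$ bits, ${\sf FORMULA}[s]\circ\mathcal{G}$ is the class of functions $F(g_1(x),\dots,g_s(x))$ where $F$ is a de Morgan formula of size at most $s$ and each $g_i\in\mathcal{G}$. A distribution $\mathcal{D}$ over $\{0,1\}^n$ $\varepsilon$-fools a class $\mathfrak{C}$ of Boolean functions if $|\Pr_{x\sim\mathcal{D}}[h(x)=1]-\Pr_{x\sim U_n}[h(x)=1]|\le\varepsilon$ for all $h\in\mathfrak{C}$, where $U_n$ is uniform on $\{0,1\}^n$.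
   Formalization: In t and δ, log(1/ε) is replaced by max(1, log₂(1/ε)), which changes nothing for ε ≤ 1/2; with the bare logarithm the claim fails for every c as ε → 1, because then t < 1 and only constants need be fooled. -}

module Defs where

open import Level using (0ℓ)
open import Data.Bool using (Bool; true; false; if_then_else_; not; _∧_; _∨_; _xor_)
open import Data.Fin using (Fin)
open import Data.Integer using (ℤ; +_; -[1+_])
open import Data.List using (List; length; map; foldr)
open import Data.List.Relation.Unary.All using (All)
open import Data.Nat as ℕ using (ℕ; zero; suc)
import Data.Nat.Properties as ℕ
open import Data.Product using (Σ-syntax; ∃-syntax; _×_; _,_)
open import Data.Rational as ℚ using (ℚ; 0ℚ; 1ℚ; ½)
import Data.Rational.Properties as ℚ
open import Data.Rational.Solver using (module +-*-Solver)
open import Data.Sum using (inj₁; inj₂)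
open import Data.Vec using (Vec; []; _∷_)
open import Relation.Binary.PropositionalEquality
  using (_≡_; _≗_; refl; sym; trans; cong; cong₂; subst)
open import Relation.Unary using (Pred; _∈_)
open import Algebra.Definitions.RawSemiring ℚ.+-*-rawSemiring using () renaming (_^_ to _^ℚ_)

------------------------------------------------------------------------
-- Real numbers: Cauchy sequences of rationals with a modulus of
-- convergence.  Equality of reals is _≃_ , not _≡_ .

IsCauchy : (ℕ → ℚ) → Set
IsCauchy f = ∀ e → 0ℚ ℚ.< e →
  ∃[ N ] ∀ m n → N ℕ.≤ m → N ℕ.≤ n → ℚ.∣ f m ℚ.- f n ∣ ℚ.≤ e

record ℝ : Set where
  constructor mkℝ
  field
    seq    : ℕ → ℚ
    cauchy : IsCauchy seq

open ℝ public

infix 4 _≤_ _<_ _≃_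

_≤_ : ℝ → ℝ → Set
x ≤ y = ∀ e → 0ℚ ℚ.< e → ∃[ N ] ∀ n → N ℕ.≤ n → seq x n ℚ.≤ seq y n ℚ.+ e

_<_ : ℝ → ℝ → Set
x < y = ∃[ e ] 0ℚ ℚ.< e × ∃[ N ] ∀ n → N ℕ.≤ n → seq x n ℚ.+ e ℚ.≤ seq y n

_≃_ : ℝ → ℝ → Set
x ≃ y = x ≤ y × y ≤ x

module _ where
  open ℚ.≤-Reasoning
  open +-*-Solver

  half-pos : ∀ e → 0ℚ ℚ.< e → 0ℚ ℚ.< ½ ℚ.* e
  half-pos e e>0 = subst (ℚ._< ½ ℚ.* e) (ℚ.*-zeroʳ ½) (ℚ.*-monoʳ-<-pos ½ e>0)

  halves : ∀ e → ½ ℚ.* e ℚ.+ ½ ℚ.* e ≡ e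
  halves e = trans (sym (ℚ.*-distribʳ-+ e ½ ½)) (ℚ.*-identityˡ e)

  ∣∣-flip : ∀ p q → ℚ.∣ p ℚ.- q ∣ ≡ ℚ.∣ q ℚ.- p ∣
  ∣∣-flip p q = trans (sym (ℚ.∣-p∣≡∣p∣ (p ℚ.- q)))
    (cong ℚ.∣_∣ (solve 2 (λ a b → :- (a :- b) := b :- a) refl p q))

  p≤∣p∣ : ∀ p → p ℚ.≤ ℚ.∣ p ∣
  p≤∣p∣ p with ℚ.≤-total 0ℚ p
  ... | inj₁ 0≤p = ℚ.≤-reflexive (sym (ℚ.0≤p⇒∣p∣≡p 0≤p))
  ... | inj₂ p≤0 = ℚ.≤-trans p≤0 (ℚ.0≤∣p∣ p)

  p≤q+∣p-q∣ : ∀ p q → p ℚ.≤ q ℚ.+ ℚ.∣ p ℚ.- q ∣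
  p≤q+∣p-q∣ p q = begin
    p                         ≡⟨ solve 2 (λ a b → a := b :+ (a :- b)) refl p q ⟩
    q ℚ.+ (p ℚ.- q)           ≤⟨ ℚ.+-monoʳ-≤ q (p≤∣p∣ (p ℚ.- q)) ⟩
    q ℚ.+ ℚ.∣ p ℚ.- q ∣       ∎

  within : ∀ {p q r} → p ℚ.≤ q ℚ.+ r → q ℚ.≤ p ℚ.+ r → ℚ.∣ p ℚ.- q ∣ ℚ.≤ r
  within {p} {q} {r} p≤ q≤ with ℚ.∣p∣≡p∨∣p∣≡-p (p ℚ.- q)
  ... | inj₁ eq = begin
    ℚ.∣ p ℚ.- q ∣     ≡⟨ eq ⟩
    p ℚ.- q           ≤⟨ ℚ.+-monoˡ-≤ (ℚ.- q) p≤ ⟩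
    q ℚ.+ r ℚ.- q     ≡⟨ solve 2 (λ a b → a :+ b :- a := b) refl q r ⟩
    r                 ∎
  ... | inj₂ eq = begin
    ℚ.∣ p ℚ.- q ∣     ≡⟨ eq ⟩
    ℚ.- (p ℚ.- q)     ≡⟨ solve 2 (λ a b → :- (a :- b) := b :- a) refl p q ⟩
    q ℚ.- p           ≤⟨ ℚ.+-monoˡ-≤ (ℚ.- p) q≤ ⟩
    p ℚ.+ r ℚ.- p     ≡⟨ solve 2 (λ a b → a :+ b :- a := b) refl p r ⟩
    r                 ∎

  ∣∣-lip : ∀ a b → ℚ.∣ ℚ.∣ a ∣ ℚ.- ℚ.∣ b ∣ ∣ ℚ.≤ ℚ.∣ a ℚ.- b ∣
  ∣∣-lip a b = within (half a b) (subst (λ z → ℚ.∣ b ∣ ℚ.≤ ℚ.∣ a ∣ ℚ.+ z) (∣∣-flip b a) (half b a))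
    where
    half : ∀ a b → ℚ.∣ a ∣ ℚ.≤ ℚ.∣ b ∣ ℚ.+ ℚ.∣ a ℚ.- b ∣
    half a b = begin
      ℚ.∣ a ∣                         ≡⟨ cong ℚ.∣_∣ (solve 2 (λ a b → a := b :+ (a :- b)) refl a b) ⟩
      ℚ.∣ b ℚ.+ (a ℚ.- b) ∣           ≤⟨ ℚ.∣p+q∣≤∣p∣+∣q∣ b (a ℚ.- b) ⟩
      ℚ.∣ b ∣ ℚ.+ ℚ.∣ a ℚ.- b ∣       ∎

  +-lip : ∀ a b a′ b′ →
    ℚ.∣ (a ℚ.+ b) ℚ.- (a′ ℚ.+ b′) ∣ ℚ.≤ ℚ.∣ a ℚ.- a′ ∣ ℚ.+ ℚ.∣ b ℚ.- b′ ∣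
  +-lip a b a′ b′ = begin
    ℚ.∣ (a ℚ.+ b) ℚ.- (a′ ℚ.+ b′) ∣
      ≡⟨ cong ℚ.∣_∣ (solve 4 (λ a b a′ b′ → (a :+ b) :- (a′ :+ b′) := (a :- a′) :+ (b :- b′)) refl a b a′ b′) ⟩
    ℚ.∣ (a ℚ.- a′) ℚ.+ (b ℚ.- b′) ∣
      ≤⟨ ℚ.∣p+q∣≤∣p∣+∣q∣ (a ℚ.- a′) (b ℚ.- b′) ⟩
    ℚ.∣ a ℚ.- a′ ∣ ℚ.+ ℚ.∣ b ℚ.- b′ ∣ ∎

  ⊔-lip : ∀ a b a′ b′ →
    ℚ.∣ (a ℚ.⊔ b) ℚ.- (a′ ℚ.⊔ b′) ∣ ℚ.≤ ℚ.∣ a ℚ.- a′ ∣ ℚ.+ ℚ.∣ b ℚ.- b′ ∣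
  ⊔-lip a b a′ b′ = within (side a b a′ b′)
    (subst (λ z → a′ ℚ.⊔ b′ ℚ.≤ (a ℚ.⊔ b) ℚ.+ z)
           (cong₂ ℚ._+_ (∣∣-flip a′ a) (∣∣-flip b′ b)) (side a′ b′ a b))
    where
    side : ∀ a b a′ b′ →
      a ℚ.⊔ b ℚ.≤ (a′ ℚ.⊔ b′) ℚ.+ (ℚ.∣ a ℚ.- a′ ∣ ℚ.+ ℚ.∣ b ℚ.- b′ ∣)
    side a b a′ b′ = ℚ.⊔-lub
      (begin
        a                                 ≤⟨ p≤q+∣p-q∣ a a′ ⟩
        a′ ℚ.+ u                          ≡⟨ cong (a′ ℚ.+_) (sym (ℚ.+-identityʳ u)) ⟩
        a′ ℚ.+ (u ℚ.+ 0ℚ)                 ≤⟨ ℚ.+-mono-≤ (ℚ.p≤p⊔q a′ b′) (ℚ.+-monoʳ-≤ u (ℚ.0≤∣p∣ (b ℚ.- b′))) ⟩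
        (a′ ℚ.⊔ b′) ℚ.+ (u ℚ.+ v)         ∎)
      (begin
        b                                 ≤⟨ p≤q+∣p-q∣ b b′ ⟩
        b′ ℚ.+ v                          ≡⟨ cong (b′ ℚ.+_) (sym (ℚ.+-identityˡ v)) ⟩
        b′ ℚ.+ (0ℚ ℚ.+ v)                 ≤⟨ ℚ.+-mono-≤ (ℚ.p≤q⊔p a′ b′) (ℚ.+-monoˡ-≤ v (ℚ.0≤∣p∣ (a ℚ.- a′))) ⟩
        (a′ ℚ.⊔ b′) ℚ.+ (u ℚ.+ v)         ∎)
      where u = ℚ.∣ a ℚ.- a′ ∣ ; v = ℚ.∣ b ℚ.- b′ ∣

  *-lip : ∀ a b a′ b′ →
    ℚ.∣ (a ℚ.* b) ℚ.- (a′ ℚ.* b′) ∣ ℚ.≤ ℚ.∣ a ∣ ℚ.* ℚ.∣ b ℚ.- b′ ∣ ℚ.+ ℚ.∣ b′ ∣ ℚ.* ℚ.∣ a ℚ.- a′ ∣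
  *-lip a b a′ b′ = begin
    ℚ.∣ (a ℚ.* b) ℚ.- (a′ ℚ.* b′) ∣
      ≡⟨ cong ℚ.∣_∣ (solve 4 (λ a b a′ b′ → (a :* b) :- (a′ :* b′) := a :* (b :- b′) :+ b′ :* (a :- a′)) refl a b a′ b′) ⟩
    ℚ.∣ a ℚ.* (b ℚ.- b′) ℚ.+ b′ ℚ.* (a ℚ.- a′) ∣
      ≤⟨ ℚ.∣p+q∣≤∣p∣+∣q∣ (a ℚ.* (b ℚ.- b′)) (b′ ℚ.* (a ℚ.- a′)) ⟩
    ℚ.∣ a ℚ.* (b ℚ.- b′) ∣ ℚ.+ ℚ.∣ b′ ℚ.* (a ℚ.- a′) ∣
      ≡⟨ cong₂ ℚ._+_ (ℚ.∣p*q∣≡∣p∣*∣q∣ a (b ℚ.- b′)) (ℚ.∣p*q∣≡∣p∣*∣q∣ b′ (a ℚ.- a′)) ⟩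
    ℚ.∣ a ∣ ℚ.* ℚ.∣ b ℚ.- b′ ∣ ℚ.+ ℚ.∣ b′ ∣ ℚ.* ℚ.∣ a ℚ.- a′ ∣ ∎

  lift₁-cauchy : (f : ℚ → ℚ) → (∀ a b → ℚ.∣ f a ℚ.- f b ∣ ℚ.≤ ℚ.∣ a ℚ.- b ∣) →
    (x : ℝ) → IsCauchy (λ n → f (seq x n))
  lift₁-cauchy f lip x e e>0 with cauchy x e e>0
  ... | N , close = N , λ m n N≤m N≤n → ℚ.≤-trans (lip _ _) (close m n N≤m N≤n)

  lift₂-cauchy : (f : ℚ → ℚ → ℚ) →
    (∀ a b a′ b′ → ℚ.∣ f a b ℚ.- f a′ b′ ∣ ℚ.≤ ℚ.∣ a ℚ.- a′ ∣ ℚ.+ ℚ.∣ b ℚ.- b′ ∣) →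
    (x y : ℝ) → IsCauchy (λ n → f (seq x n) (seq y n))
  lift₂-cauchy f lip x y e e>0
    with cauchy x (½ ℚ.* e) (half-pos e e>0) | cauchy y (½ ℚ.* e) (half-pos e e>0)
  ... | M , closeˣ | N , closeʸ = M ℕ.⊔ N , λ m n ≤m ≤n → begin
    ℚ.∣ f (seq x m) (seq y m) ℚ.- f (seq x n) (seq y n) ∣
      ≤⟨ lip (seq x m) (seq y m) (seq x n) (seq y n) ⟩
    ℚ.∣ seq x m ℚ.- seq x n ∣ ℚ.+ ℚ.∣ seq y m ℚ.- seq y n ∣
      ≤⟨ ℚ.+-mono-≤
           (closeˣ m n (ℕ.m⊔n≤o⇒m≤o M N ≤m) (ℕ.m⊔n≤o⇒m≤o M N ≤n))
           (closeʸ m n (ℕ.m⊔n≤o⇒n≤o M N ≤m) (ℕ.m⊔n≤o⇒n≤o M N ≤n)) ⟩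
    ½ ℚ.* e ℚ.+ ½ ℚ.* e
      ≡⟨ halves e ⟩
    e ∎

  -- An eventual bound on a real.
  bound : (x : ℝ) → ∃[ K ] 0ℚ ℚ.< K × ∃[ N ] ∀ n → N ℕ.≤ n → ℚ.∣ seq x n ∣ ℚ.≤ K
  bound x with cauchy x 1ℚ (ℚ.positive⁻¹ 1ℚ)
  ... | N , close = ℚ.∣ seq x N ∣ ℚ.+ 1ℚ
      , ℚ.<-≤-trans (ℚ.positive⁻¹ 1ℚ)
          (subst (ℚ._≤ ℚ.∣ seq x N ∣ ℚ.+ 1ℚ) (ℚ.+-identityˡ 1ℚ) (ℚ.+-monoˡ-≤ 1ℚ (ℚ.0≤∣p∣ (seq x N))))
      , N , λ n N≤n → begin
    ℚ.∣ seq x n ∣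
      ≤⟨ p≤q+∣p-q∣ ℚ.∣ seq x n ∣ ℚ.∣ seq x N ∣ ⟩
    ℚ.∣ seq x N ∣ ℚ.+ ℚ.∣ ℚ.∣ seq x n ∣ ℚ.- ℚ.∣ seq x N ∣ ∣
      ≤⟨ ℚ.+-monoʳ-≤ ℚ.∣ seq x N ∣ (∣∣-lip (seq x n) (seq x N)) ⟩
    ℚ.∣ seq x N ∣ ℚ.+ ℚ.∣ seq x n ℚ.- seq x N ∣
      ≤⟨ ℚ.+-monoʳ-≤ ℚ.∣ seq x N ∣ (close n N N≤n ℕ.≤-refl) ⟩
    ℚ.∣ seq x N ∣ ℚ.+ 1ℚ ∎

  -- For K, e > 0 some d > 0 has K d ≤ e.
  shrink : ∀ K e → 0ℚ ℚ.< K → 0ℚ ℚ.< e → ∃[ d ] 0ℚ ℚ.< d × K ℚ.* d ≡ e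
  shrink K e K>0 e>0 = ℚ.1/ K ℚ.* e
    , ℚ.positive⁻¹ (ℚ.1/ K ℚ.* e)
        {{ℚ.pos*pos⇒pos (ℚ.1/ K) {{ℚ.1/pos⇒pos K}} e {{ℚ.positive e>0}}}}
    , trans (sym (ℚ.*-assoc K (ℚ.1/ K) e))
        (trans (cong (ℚ._* e) (ℚ.*-inverseʳ K)) (ℚ.*-identityˡ e))
    where
    instance
      K-pos : ℚ.Positive K
      K-pos = ℚ.positive K>0
      K-nonZero : ℚ.NonZero K
      K-nonZero = ℚ.pos⇒nonZero K

  *-bounds : ∀ {a b K d} → ℚ.∣ a ∣ ℚ.≤ K → ℚ.∣ b ∣ ℚ.≤ d → ℚ.∣ a ∣ ℚ.* ℚ.∣ b ∣ ℚ.≤ K ℚ.* d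
  *-bounds {a} {b} {K} {d} a≤ b≤ = begin
    ℚ.∣ a ∣ ℚ.* ℚ.∣ b ∣  ≤⟨ ℚ.*-monoʳ-≤-nonNeg ℚ.∣ b ∣ {{ℚ.∣-∣-nonNeg b}} a≤ ⟩
    K ℚ.* ℚ.∣ b ∣        ≤⟨ ℚ.*-monoˡ-≤-nonNeg K {{ℚ.nonNegative (ℚ.≤-trans (ℚ.0≤∣p∣ a) a≤)}} b≤ ⟩
    K ℚ.* d              ∎

  *-estimate : ∀ a b a′ b′ K L dˣ dʸ e →
    ℚ.∣ a ∣ ℚ.≤ K → ℚ.∣ b′ ∣ ℚ.≤ L → ℚ.∣ a ℚ.- a′ ∣ ℚ.≤ dˣ → ℚ.∣ b ℚ.- b′ ∣ ℚ.≤ dʸ →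
    K ℚ.* dʸ ≡ ½ ℚ.* e → L ℚ.* dˣ ≡ ½ ℚ.* e →
    ℚ.∣ a ℚ.* b ℚ.- a′ ℚ.* b′ ∣ ℚ.≤ e
  *-estimate a b a′ b′ K L dˣ dʸ e a≤ b′≤ a-a′≤ b-b′≤ Kdʸ Ldˣ = begin
    ℚ.∣ a ℚ.* b ℚ.- a′ ℚ.* b′ ∣
      ≤⟨ *-lip a b a′ b′ ⟩
    ℚ.∣ a ∣ ℚ.* ℚ.∣ b ℚ.- b′ ∣ ℚ.+ ℚ.∣ b′ ∣ ℚ.* ℚ.∣ a ℚ.- a′ ∣
      ≤⟨ ℚ.+-mono-≤ (*-bounds {a} {b ℚ.- b′} a≤ b-b′≤) (*-bounds {b′} {a ℚ.- a′} b′≤ a-a′≤) ⟩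
    K ℚ.* dʸ ℚ.+ L ℚ.* dˣ
      ≡⟨ cong₂ ℚ._+_ Kdʸ Ldˣ ⟩
    ½ ℚ.* e ℚ.+ ½ ℚ.* e
      ≡⟨ halves e ⟩
    e ∎

  *-cauchy : (x y : ℝ) → IsCauchy (λ n → seq x n ℚ.* seq y n)
  *-cauchy x y e e>0 =
    let K , K>0 , Nˣ , bdˣ = bound x
        L , L>0 , Nʸ , bdʸ = bound y
        dʸ , dʸ>0 , Kdʸ    = shrink K (½ ℚ.* e) K>0 (half-pos e e>0)
        dˣ , dˣ>0 , Ldˣ    = shrink L (½ ℚ.* e) L>0 (half-pos e e>0)
        Mˣ , closeˣ        = cauchy x dˣ dˣ>0
        Mʸ , closeʸ        = cauchy y dʸ dʸ>0
        A = Nˣ ℕ.⊔ Mˣ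
        B = Nʸ ℕ.⊔ Mʸ
    in A ℕ.⊔ B , λ m n ≤m ≤n →
      *-estimate (seq x m) (seq y m) (seq x n) (seq y n) K L dˣ dʸ e
        (bdˣ m (ℕ.m⊔n≤o⇒m≤o Nˣ Mˣ (ℕ.m⊔n≤o⇒m≤o A B ≤m)))
        (bdʸ n (ℕ.m⊔n≤o⇒m≤o Nʸ Mʸ (ℕ.m⊔n≤o⇒n≤o A B ≤n)))
        (closeˣ m n (ℕ.m⊔n≤o⇒n≤o Nˣ Mˣ (ℕ.m⊔n≤o⇒m≤o A B ≤m)) (ℕ.m⊔n≤o⇒n≤o Nˣ Mˣ (ℕ.m⊔n≤o⇒m≤o A B ≤n)))
        (closeʸ m n (ℕ.m⊔n≤o⇒n≤o Nʸ Mʸ (ℕ.m⊔n≤o⇒n≤o A B ≤m)) (ℕ.m⊔n≤o⇒n≤o Nʸ Mʸ (ℕ.m⊔n≤o⇒n≤o A B ≤n)))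
        Kdʸ Ldˣ

  neg-lip : ∀ a b → ℚ.∣ (ℚ.- a) ℚ.- (ℚ.- b) ∣ ℚ.≤ ℚ.∣ a ℚ.- b ∣
  neg-lip a b = ℚ.≤-reflexive (trans
    (cong ℚ.∣_∣ (solve 2 (λ a b → (:- a) :- (:- b) := b :- a) refl a b)) (∣∣-flip b a))

infix  8 -_
infixr 8 _^_
infixl 7 _*_
infixl 6 _+_ _-_ _⊔_

fromℚ : ℚ → ℝ
fromℚ q = mkℝ (λ _ → q) λ e e>0 → 0 , λ _ _ _ _ →
  subst (λ z → ℚ.∣ z ∣ ℚ.≤ e) (sym (ℚ.+-inverseʳ q)) (ℚ.<⇒≤ e>0)

fromℕ : ℕ → ℝ
fromℕ k = fromℚ (+ k ℚ./ 1)

0ℝ 1ℝ : ℝ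
0ℝ = fromℚ 0ℚ
1ℝ = fromℚ 1ℚ

_+_ _*_ _⊔_ : ℝ → ℝ → ℝ
x + y = mkℝ (λ n → seq x n ℚ.+ seq y n) (lift₂-cauchy ℚ._+_ +-lip x y)
x * y = mkℝ (λ n → seq x n ℚ.* seq y n) (*-cauchy x y)
x ⊔ y = mkℝ (λ n → seq x n ℚ.⊔ seq y n) (lift₂-cauchy ℚ._⊔_ ⊔-lip x y)

-_ ∣_∣ : ℝ → ℝ
- x   = mkℝ (λ n → ℚ.- seq x n) (lift₁-cauchy ℚ.-_ neg-lip x)
∣ x ∣ = mkℝ (λ n → ℚ.∣ seq x n ∣) (lift₁-cauchy ℚ.∣_∣ ∣∣-lip x)

_-_ : ℝ → ℝ → ℝ
x - y = x + (- y)

_^_ : ℝ → ℕ → ℝ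
x ^ zero  = 1ℝ
x ^ suc k = x * x ^ k

_IsSqrtOf_ : ℝ → ℝ → Set
y IsSqrtOf x = 0ℝ ≤ y × y * y ≃ x

2^ℤ : ℤ → ℚ
2^ℤ (+ k)    = (+ 2 ℚ./ 1) ^ℚ k
2^ℤ -[1+ k ] = ½ ^ℚ suc k

-- x ≃2^ y says x = 2^y for real y, i.e. y = log₂ x.  It is the usual
-- definition of real powers by comparison with the rational ones: for every
-- rational p / q, 2^(p/q) ≤ x if p / q ≤ y, and x ≤ 2^(p/q) if y ≤ p / q, where
-- 2^(p/q) is compared with the positive x by raising both to the power q.
infix 4 _≃2^_

_≃2^_ : ℝ → ℝ → Set
x ≃2^ y = 0ℝ < x × (∀ (p : ℤ) (q : ℕ) .{{_ : ℕ.NonZero q}} →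
  (fromℚ (p ℚ./ q) ≤ y → fromℚ (2^ℤ p) ≤ x ^ q) ×
  (y ≤ fromℚ (p ℚ./ q) → x ^ q ≤ fromℚ (2^ℤ p)))

------------------------------------------------------------------------
-- Boolean functions and formulas

BoolFun : ℕ → Set
BoolFun n = Vec Bool n → Bool

Class : ℕ → Set₁
Class n = Pred (BoolFun n) 0ℓ

data Formula (s : ℕ) : Set where
  leaf     : Fin s → Formula s
  NOT      : Formula s → Formula s
  AND OR   : Formula s → Formula s → Formula s

size : ∀ {s} → Formula s → ℕ
size (leaf _)  = 1
size (NOT F)   = size F
size (AND F G) = size F ℕ.+ size G
size (OR F G)  = size F ℕ.+ size G

eval : ∀ {s} → Formula s → (Fin s → Bool) → Bool
eval (leaf i)  z = z i
eval (NOT F)   z = not (eval F z)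
eval (AND F G) z = eval F z ∧ eval G z
eval (OR F G)  z = eval F z ∨ eval G z

FORMULA[_]∘_ : ∀ {n} → ℕ → Class n → Class n
(FORMULA[_]∘_) {n} s 𝒢 h =
  Σ[ F ∈ Formula s ] size F ℕ.≤ s ×
  Σ[ g ∈ (Fin s → BoolFun n) ] (∀ i → g i ∈ 𝒢) × h ≗ (λ x → eval F (λ i → g i x))

-- The number t of functions allowed is a real; repetitions and the empty
-- list (a constant function) are allowed, and fooling a constant is automatic.
XOR≤[_]∘_ AND≤[_]∘_ : ∀ {n} → ℝ → Class n → Class n
(XOR≤[_]∘_) {n} t 𝒢 h = Σ[ gs ∈ List (BoolFun n) ] All 𝒢 gs × fromℕ (length gs) ≤ t ×
  h ≗ (λ x → foldr _xor_ false (map (λ g → g x) gs))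
(AND≤[_]∘_) {n} t 𝒢 h = Σ[ gs ∈ List (BoolFun n) ] All 𝒢 gs × fromℕ (length gs) ≤ t ×
  h ≗ (λ x → foldr _∧_ true (map (λ g → g x) gs))

------------------------------------------------------------------------
-- Distributions on {0,1}ⁿ and fooling

∑ : ∀ n → (Vec Bool n → ℝ) → ℝ
∑ zero    f = f []
∑ (suc n) f = ∑ n (λ x → f (false ∷ x)) + ∑ n (λ x → f (true ∷ x))

record Distribution (n : ℕ) : Set where
  field
    pmf    : Vec Bool n → ℝ
    nonNeg : ∀ x → 0ℝ ≤ pmf x
    total  : ∑ n pmf ≃ 1ℝ

open Distribution public

Pr : ∀ {n} → Distribution n → BoolFun n → ℝ
Pr {n} D h = ∑ n (λ x → if h x then pmf D x else 0ℝ)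

≤-pointwise : ∀ {x y} → (∀ n → seq x n ℚ.≤ seq y n) → x ≤ y
≤-pointwise {x} {y} le e e>0 = 0 , λ n _ → ℚ.≤-trans (le n)
  (subst (ℚ._≤ seq y n ℚ.+ e) (ℚ.+-identityʳ (seq y n)) (ℚ.+-monoʳ-≤ (seq y n) (ℚ.<⇒≤ e>0)))

½^-nonNeg : ∀ n → ℚ.NonNegative (½ ^ℚ n)
½^-nonNeg zero    = _
½^-nonNeg (suc n) = ℚ.nonNeg*nonNeg⇒nonNeg ½ (½ ^ℚ n) {{½^-nonNeg n}}

-- Σ over {0,1}ⁿ of ½ⁿ q is q.
∑-uniform : ∀ n q k → seq (∑ n (λ _ → fromℚ (½ ^ℚ n ℚ.* q))) k ≡ q
∑-uniform zero    q k = ℚ.*-identityˡ q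
∑-uniform (suc n) q k = trans (cong₂ ℚ._+_ step step) (halves q)
  where
  open +-*-Solver
  step : seq (∑ n (λ _ → fromℚ ((½ ℚ.* ½ ^ℚ n) ℚ.* q))) k ≡ ½ ℚ.* q
  step = trans
    (cong (λ z → seq (∑ n (λ _ → fromℚ z)) k)
      (solve 3 (λ a b c → (a :* b) :* c := b :* (a :* c)) refl ½ (½ ^ℚ n) q))
    (∑-uniform n (½ ℚ.* q) k)

uniform : ∀ n → Distribution n
uniform n = record
  { pmf    = λ _ → fromℚ (½ ^ℚ n)
  ; nonNeg = λ _ → ≤-pointwise {0ℝ} {fromℚ (½ ^ℚ n)}
               (λ _ → ℚ.nonNegative⁻¹ (½ ^ℚ n) {{½^-nonNeg n}})
  ; total  = ≤-pointwise {S} {1ℝ} (λ k → ℚ.≤-reflexive (sum k))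
           , ≤-pointwise {1ℝ} {S} (λ k → ℚ.≤-reflexive (sym (sum k)))
  }
  where
  S = ∑ n (λ _ → fromℚ (½ ^ℚ n))
  sum : ∀ k → seq S k ≡ 1ℚ
  sum k = subst (λ z → seq (∑ n (λ _ → fromℚ z)) k ≡ 1ℚ)
    (ℚ.*-identityʳ (½ ^ℚ n)) (∑-uniform n 1ℚ k)

_Fools[_]_ : ∀ {n} → Distribution n → ℝ → Class n → Set
_Fools[_]_ {n} D ε 𝒞 = ∀ h → h ∈ 𝒞 → ∣ Pr D h - Pr (uniform n) h ∣ ≤ ε

-- log(1/ε) is read as max(1, log₂(1/ε)), which is log₂(1/ε) itself
-- when ε ≤ 1/2.  With the bare logarithm no absolute constant c can work as
-- ε → 1: then c √s log₂(1/ε) < 1, so fooling parities or conjunctions of at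
-- most that many functions is fooling a constant.
log⁺ : ℝ → ℝ
log⁺ ℓ = 1ℝ ⊔ ℓ

{-# OPTIONS --safe #-}
module Submission where

-- A de Morgan formula of size n is a series-parallel network on n edges, an
-- edge being present when its literal is true, and the formula holds iff the
-- terminals are connected.  With suitable resistances R a connected network
-- carries a unit flow of energy at most R and a disconnected one has a unit
-- potential drop, supported on the absent edges, of energy at most n / R.
--
-- Close the circuit by an edge e and alternate the reflection through the flows
-- with the sign flip of the absent edges.  The average of M steps of this walk
-- started at e has norm about 1 if a flow exists, since the flow is fixed by
-- the walk; otherwise e is a coboundary of the walk, the sum telescopes, and
-- the norm is O(√n / M).  For M = O(√n) the squared norm is thus a polynomial of
-- degree O(√n) in the inputs that approximates the formula, and a majority vote
-- of O(log (1/ε)) copies brings the error down to ε.  Both the parities and the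
-- conjunctions span these polynomials, with s^O(degree) terms of bounded
-- coefficient, so that fooling each monomial fools the formula.

open import Data.Bool using (Bool; true; false; if_then_else_; not; _∧_; _∨_; _xor_)
open import Data.Bool.Properties using (not-involutive; not-injective)
open import Data.Empty using (⊥-elim)
open import Data.Fin using (Fin)
import Data.Integer as ℤ
import Data.Integer.Properties as ℤ
open import Data.List using (List; []; _∷_; _++_; length; foldr; map)
import Data.List.Properties as List
open import Data.List.Relation.Unary.All using (All; []; _∷_)
open import Data.Nat as ℕ using (ℕ; zero; suc; z≤n; s≤s) renaming (_≤_ to _≤ℕ_)
import Data.Nat.Properties as ℕ
import Data.Nat.Solver
open import Data.Product using (∃-syntax; _×_; _,_; proj₁; proj₂)
open import Data.Rational as ℚ using (ℚ; 0ℚ; 1ℚ; ½; nonNegative)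
import Data.Rational.Properties as ℚ
open import Data.Rational.Solver using (module +-*-Solver)
import Data.Rational.Unnormalised as ℚᵘ
import Data.Rational.Unnormalised.Properties as ℚᵘ
open import Data.Sum using (_⊎_; inj₁; inj₂; [_,_])
open import Data.Unit using (⊤; tt)
open import Data.Vec using (Vec; []; _∷_)
open import Function using (_∘_)
open import Relation.Binary.PropositionalEquality
  using (_≡_; _≗_; refl; sym; trans; cong; cong₂; subst; subst₂; module ≡-Reasoning)
open import Relation.Nullary using (¬_; yes; no)
open import Relation.Nullary.Decidable using (from-yes)
open import Algebra.Definitions.RawSemiring ℚ.+-*-rawSemiring using () renaming (_^_ to _^ℚ_)
open +-*-Solver
open Data.Nat.Solver.+-*-Solver using ()
  renaming (solve to solveℕ; con to conℕ; _:*_ to _⊗_; _:+_ to _⊕_; _:=_ to _⊜_)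

-- No graph is ever built: series composition, duality and rescaling act directly on the reflection,
-- on the vector `u` that measures the value of a flow, and on the witnesses `flow` and `cut`. NOT
-- is duality, which exchanges the energy bounds of flows and of cuts; a rescaling then brings the
-- cut bound back to 1. Series composition adds the flow bounds and keeps a common cut bound. A
-- formula of any shape therefore has flow energy at most its size, and no balancing of the tree is
-- involved.
--
-- The coefficients stay bounded because neither the reflections nor the monomial parts of the sign
-- flip lengthen a vector: the partial sums of the walk expand into vectors of the unit ball, and
-- Cauchy-Schwarz turns these into scalars of absolute value at most 1.
--
-- All of this is exact algebra over ℚ, as only squared norms and inverses of positive rationals
-- occur. Reals enter with √s, the logarithms and the probabilities, where it suffices to bound them
-- by integers or simple fractions; the slack of these roundings is paid for by the constant.

module Approximation where
  open import Data.Rational using (_+_; _*_; -_; _-_; _≤_; _<_; ∣_∣; positive; toℚᵘ)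
  open import Data.Rational.Properties
  open import Defs using (Formula; leaf; NOT; AND; OR; size; eval)

  -- Order and squares in ℚ.

  2ℚ : ℚ
  2ℚ = 1ℚ + 1ℚ

  *-nonNeg : ∀ {p q} → 0ℚ ≤ p → 0ℚ ≤ q → 0ℚ ≤ p * q
  *-nonNeg {p} {q} 0≤p 0≤q = subst (_≤ p * q) (*-zeroʳ p) (*-monoˡ-≤-nonNeg p {{nonNegative 0≤p}} 0≤q)

  *-pos : ∀ {p q} → 0ℚ < p → 0ℚ < q → 0ℚ < p * q
  *-pos {p} {q} 0<p 0<q = subst (_< p * q) (*-zeroʳ p) (*-monoʳ-<-pos p {{positive 0<p}} 0<q)

  +-pos : ∀ {p q} → 0ℚ < p → 0ℚ < q → 0ℚ < p + q
  +-pos {p} {q} = +-mono-< {0ℚ} {p} {0ℚ} {q}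

  +-nonNeg : ∀ {p q} → 0ℚ ≤ p → 0ℚ ≤ q → 0ℚ ≤ p + q
  +-nonNeg {p} {q} = +-mono-≤ {0ℚ} {p} {0ℚ} {q}

  *-monoˡ : ∀ {p q r} → 0ℚ ≤ r → p ≤ q → r * p ≤ r * q
  *-monoˡ {r = r} 0≤r = *-monoˡ-≤-nonNeg r {{nonNegative 0≤r}}

  sub-nonNeg : ∀ {p q} → p ≤ q → 0ℚ ≤ q - p
  sub-nonNeg {p} {q} p≤q = subst (_≤ q - p) (+-inverseʳ p) (+-monoˡ-≤ (- p) p≤q)

  sub-nonNeg⁻¹ : ∀ {p q} → 0ℚ ≤ q - p → p ≤ q
  sub-nonNeg⁻¹ {p} {q} h = subst₂ _≤_ (+-identityˡ p) (solve 2 (λ p q → q :- p :+ p := q) refl p q) (+-monoˡ-≤ p h)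

  square-nonNeg : ∀ p → 0ℚ ≤ p * p
  square-nonNeg p with ≤-total 0ℚ p
  ... | inj₁ 0≤p = *-nonNeg 0≤p 0≤p
  ... | inj₂ p≤0 = subst (0ℚ ≤_) (solve 1 (λ p → :- p :* :- p := p :* p) refl p)
                     (*-nonNeg (neg-antimono-≤ p≤0) (neg-antimono-≤ p≤0))

  recip : ∀ p → 0ℚ < p → ∃[ q ] 0ℚ < q × p * q ≡ 1ℚ
  recip p 0<p = shrink p 1ℚ 0<p (positive⁻¹ 1ℚ)
    where open import Defs using (shrink)

  -- Linear maps and inner products over ℚ.

  Vector : Set → Set
  Vector I = I → ℚ

  lc : ∀ {I} → ℚ → Vector I → ℚ → Vector I → Vector I
  lc a v b w i = a * v i + b * w i

  -- Vectors are functions compared pointwise, so compatibility with pointwise equality is a field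
  -- of its own.
  record Linear {I J : Set} (L : Vector I → Vector J) : Set where
    field
      resp : ∀ {v w} → v ≗ w → L v ≗ L w
      comb : ∀ a v b w → L (lc a v b w) ≗ lc a (L v) b (L w)

    add : ∀ v w → L (λ i → v i + w i) ≗ λ j → L v j + L w j
    add v w j = begin
      L (λ i → v i + w i) j   ≡⟨ resp (λ i → sym (cong₂ _+_ (*-identityˡ (v i)) (*-identityˡ (w i)))) j ⟩
      L (lc 1ℚ v 1ℚ w) j      ≡⟨ comb 1ℚ v 1ℚ w j ⟩
      lc 1ℚ (L v) 1ℚ (L w) j  ≡⟨ cong₂ _+_ (*-identityˡ (L v j)) (*-identityˡ (L w j)) ⟩
      L v j + L w j           ∎
      where open ≡-Reasoning

    scale : ∀ a v → L (λ i → a * v i) ≗ λ j → a * L v j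
    scale a v j = begin
      L (λ i → a * v i) j     ≡⟨ resp (λ i → solve 2 (λ a x → a :* x := a :* x :+ con 0ℚ :* x) refl a (v i)) j ⟩
      L (lc a v 0ℚ v) j       ≡⟨ comb a v 0ℚ v j ⟩
      lc a (L v) 0ℚ (L v) j   ≡⟨ solve 2 (λ a x → a :* x :+ con 0ℚ :* x := a :* x) refl a (L v j) ⟩
      a * L v j               ∎
      where open ≡-Reasoning

  -- Cauchy-Schwarz is always applied as `ip-pos` of a suitable combination of two vectors, which
  -- keeps square roots out of ℚ.
  record InnerProduct (I : Set) : Set where
    field
      ⟪_,_⟫   : Vector I → Vector I → ℚ
      ip-resp : ∀ {v v′ w w′} → v ≗ v′ → w ≗ w′ → ⟪ v , w ⟫ ≡ ⟪ v′ , w′ ⟫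
      ip-comb : ∀ a v b w x → ⟪ lc a v b w , x ⟫ ≡ a * ⟪ v , x ⟫ + b * ⟪ w , x ⟫
      ip-sym  : ∀ v w → ⟪ v , w ⟫ ≡ ⟪ w , v ⟫
      ip-pos  : ∀ v → 0ℚ ≤ ⟪ v , v ⟫

    ip-combʳ : ∀ x a v b w → ⟪ x , lc a v b w ⟫ ≡ a * ⟪ x , v ⟫ + b * ⟪ x , w ⟫
    ip-combʳ x a v b w = begin
      ⟪ x , lc a v b w ⟫             ≡⟨ ip-sym x (lc a v b w) ⟩
      ⟪ lc a v b w , x ⟫             ≡⟨ ip-comb a v b w x ⟩
      a * ⟪ v , x ⟫ + b * ⟪ w , x ⟫  ≡⟨ cong₂ (λ p q → a * p + b * q) (ip-sym v x) (ip-sym w x) ⟩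
      a * ⟪ x , v ⟫ + b * ⟪ x , w ⟫  ∎
      where open ≡-Reasoning

    ip-comb₂ : ∀ a v b w a′ v′ b′ w′ → ⟪ lc a v b w , lc a′ v′ b′ w′ ⟫ ≡
      a * (a′ * ⟪ v , v′ ⟫ + b′ * ⟪ v , w′ ⟫) + b * (a′ * ⟪ w , v′ ⟫ + b′ * ⟪ w , w′ ⟫)
    ip-comb₂ a v b w a′ v′ b′ w′ = trans (ip-comb a v b w (lc a′ v′ b′ w′))
      (cong₂ (λ p q → a * p + b * q) (ip-combʳ v a′ v′ b′ w′) (ip-combʳ w a′ v′ b′ w′))

    norm-comb : ∀ a v b w → ⟪ lc a v b w , lc a v b w ⟫ ≡
      a * a * ⟪ v , v ⟫ + (a + a) * b * ⟪ v , w ⟫ + b * b * ⟪ w , w ⟫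
    norm-comb a v b w = begin
      ⟪ lc a v b w , lc a v b w ⟫
        ≡⟨ ip-comb₂ a v b w a v b w ⟩
      a * (a * ⟪ v , v ⟫ + b * ⟪ v , w ⟫) + b * (a * ⟪ w , v ⟫ + b * ⟪ w , w ⟫)
        ≡⟨ cong (λ z → a * (a * ⟪ v , v ⟫ + b * ⟪ v , w ⟫) + b * (a * z + b * ⟪ w , w ⟫)) (ip-sym w v) ⟩
      a * (a * ⟪ v , v ⟫ + b * ⟪ v , w ⟫) + b * (a * ⟪ v , w ⟫ + b * ⟪ w , w ⟫)
        ≡⟨ solve 5 (λ a b x y z → a :* (a :* x :+ b :* y) :+ b :* (a :* y :+ b :* z)
             := a :* a :* x :+ (a :+ a) :* b :* y :+ b :* b :* z) refl a b ⟪ v , v ⟫ ⟪ v , w ⟫ ⟪ w , w ⟫ ⟩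
      a * a * ⟪ v , v ⟫ + (a + a) * b * ⟪ v , w ⟫ + b * b * ⟪ w , w ⟫ ∎
      where open ≡-Reasoning

    ip-scaleʳ : ∀ a v w → ⟪ v , (λ i → a * w i) ⟫ ≡ a * ⟪ v , w ⟫
    ip-scaleʳ a v w = begin
      ⟪ v , (λ i → a * w i) ⟫          ≡⟨ ip-resp (λ _ → refl) (λ i → solve 2 (λ a x → a :* x := a :* x :+ con 0ℚ :* x) refl a (w i)) ⟩
      ⟪ v , lc a w 0ℚ w ⟫              ≡⟨ ip-combʳ v a w 0ℚ w ⟩
      a * ⟪ v , w ⟫ + 0ℚ * ⟪ v , w ⟫   ≡⟨ solve 2 (λ a x → a :* x :+ con 0ℚ :* x := a :* x) refl a ⟪ v , w ⟫ ⟩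
      a * ⟪ v , w ⟫                    ∎
      where open ≡-Reasoning

    ip-scaleˡ : ∀ a v w → ⟪ (λ i → a * v i) , w ⟫ ≡ a * ⟪ v , w ⟫
    ip-scaleˡ a v w = trans (ip-sym _ w) (trans (ip-scaleʳ a w v) (cong (a *_) (ip-sym w v)))

    ip-zeroʳ : ∀ v → ⟪ v , (λ _ → 0ℚ) ⟫ ≡ 0ℚ
    ip-zeroʳ v = begin
      ⟪ v , (λ _ → 0ℚ) ⟫        ≡⟨ ip-resp (λ _ → refl) (λ i → sym (*-zeroˡ (v i))) ⟩
      ⟪ v , (λ i → 0ℚ * v i) ⟫  ≡⟨ ip-scaleʳ 0ℚ v v ⟩
      0ℚ * ⟪ v , v ⟫            ≡⟨ *-zeroˡ ⟪ v , v ⟫ ⟩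
      0ℚ                        ∎
      where open ≡-Reasoning

  -- Vector-valued polynomials on the cube, counted by degree and number of terms.

  module Polynomials {s : ℕ} (χ : Bool → ℚ) where

    Cube : Set
    Cube = Fin s → Bool

    -- With `χ` = `parity-sign` these are the Fourier characters, with `χ` = `indicator` the
    -- conjunctions. Repeated indices are kept, so a product of monomials is a concatenation in
    -- either basis.
    mono : List (Fin s) → Cube → ℚ
    mono []      z = 1ℚ
    mono (i ∷ S) z = χ (z i) * mono S z

    mono-++ : ∀ S T z → mono (S ++ T) z ≡ mono S z * mono T z
    mono-++ []      T z = sym (*-identityˡ (mono T z))
    mono-++ (i ∷ S) T z = trans (cong (χ (z i) *_) (mono-++ S T z)) (sym (*-assoc (χ (z i)) (mono S z) (mono T z)))

    -- ψ is a sum of between 1 and k terms  z ↦ mono S z · v  with |S| ≤ d and v ∈ P.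
    data Terms {I : Set} (P : Vector I → Set) (d : ℕ) : ℕ → (Cube → Vector I) → Set where
      term : ∀ {k ψ} S v → length S ℕ.≤ d → P v → (∀ z i → ψ z i ≡ mono S z * v i) → Terms P d (suc k) ψ
      sum  : ∀ {j k l ψ ψ₁ ψ₂} → Terms P d j ψ₁ → Terms P d k ψ₂ → j ℕ.+ k ℕ.≤ l →
             (∀ z i → ψ z i ≡ ψ₁ z i + ψ₂ z i) → Terms P d l ψ

    private variable
      I J : Set
      P Q : Vector I → Set
      d d′ k l : ℕ

    weaken : ∀ {ψ} → d ℕ.≤ d′ → k ℕ.≤ l → Terms P d k ψ → Terms P d′ l ψ
    weaken d≤ (s≤s k≤) (term S v S≤ Pv eq) = term S v (ℕ.≤-trans S≤ d≤) Pv eq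
    weaken d≤ k≤ (sum ts us le eq) = sum (weaken d≤ ℕ.≤-refl ts) (weaken d≤ ℕ.≤-refl us) (ℕ.≤-trans le k≤) eq

    terms-resp : ∀ {ψ ψ′} → (∀ z i → ψ z i ≡ ψ′ z i) → Terms P d k ψ → Terms P d k ψ′
    terms-resp h (term S v S≤ Pv eq) = term S v S≤ Pv (λ z i → trans (sym (h z i)) (eq z i))
    terms-resp h (sum ts us le eq) = sum ts us le (λ z i → trans (sym (h z i)) (eq z i))

    map-terms : ∀ {L : Vector I → Vector J} {ψ} → Linear L → (∀ v → P v → Q (L v)) →
      Terms P d k ψ → Terms Q d k (λ z → L (ψ z))
    map-terms {L = L} lin PQ (term S v S≤ Pv eq) = term S (L v) S≤ (PQ v Pv)
      (λ z j → trans (Linear.resp lin (eq z) j) (Linear.scale lin (mono S z) v j))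
    map-terms lin PQ (sum ts us le eq) = sum (map-terms lin PQ ts) (map-terms lin PQ us) le
      (λ z j → trans (Linear.resp lin (eq z) j) (Linear.add lin _ _ j))

    shift : ∀ {ψ} S → Terms P d k ψ → Terms P (length S ℕ.+ d) k (λ z i → mono S z * ψ z i)
    shift S (term T v T≤ Pv eq) = term (S ++ T) v
      (ℕ.≤-trans (ℕ.≤-reflexive (List.length-++ S)) (ℕ.+-monoʳ-≤ (length S) T≤)) Pv
      (λ z i → trans (cong (mono S z *_) (eq z i))
        (trans (sym (*-assoc (mono S z) (mono T z) (v i))) (cong (_* v i) (sym (mono-++ S T z)))))
    shift S (sum ts us le eq) = sum (shift S ts) (shift S us) le
      (λ z i → trans (cong (mono S z *_) (eq z i)) (*-distribˡ-+ (mono S z) _ _))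

    -- Substitution: linearity at each `z` lets `mono S z` pass through `L z`, so a term of `ψ`
    -- becomes the expansion of `L` at its coefficient vector, shifted by `S`. Degrees add and
    -- numbers of terms multiply.
    bind : ∀ {L : Cube → Vector I → Vector J} {ψ} → (∀ z → Linear (L z)) →
      (∀ v → P v → Terms Q d′ l (λ z → L z v)) →
      Terms P d k ψ → Terms Q (d ℕ.+ d′) (k ℕ.* l) (λ z → L z (ψ z))
    bind {d′ = d′} {l = l} {L = L} lin PQ (term {k} S v S≤ Pv eq) =
      weaken (ℕ.+-monoˡ-≤ d′ S≤) (ℕ.m≤m+n l (k ℕ.* l))
        (terms-resp (λ z j → sym (trans (Linear.resp (lin z) (eq z) j) (Linear.scale (lin z) (mono S z) v j)))
          (shift S (PQ v Pv)))
    bind {l = l} lin PQ (sum {j} {k} ts us le eq) = sum (bind lin PQ ts) (bind lin PQ us)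
      (ℕ.≤-trans (ℕ.≤-reflexive (sym (ℕ.*-distribʳ-+ l j k))) (ℕ.*-monoˡ-≤ l le))
      (λ z j → trans (Linear.resp (lin z) (eq z) j) (Linear.add (lin z) _ _ j))

    -- Scalar polynomials are vectors indexed by the unit type.
    Small : Vector ⊤ → Set
    Small v = ∣ v tt ∣ ≤ 1ℚ

    Poly : ℕ → ℕ → (Cube → ℚ) → Set
    Poly d k f = Terms Small d k (λ z _ → f z)

  -1ℚ : ℚ
  -1ℚ = - 1ℚ

  infixr 8 _⊙_
  _⊙_ : ∀ {I} → Vector I → Vector I → Vector I
  (v ⊙ w) i = v i * w i

  ⊙-linear : ∀ {I} (v : Vector I) → Linear (v ⊙_)
  ⊙-linear v = record
    { resp = λ eq i → cong (v i *_) (eq i)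
    ; comb = λ a w b x i → solve 5 (λ v a w b x → v :* (a :* w :+ b :* x) := a :* (v :* w) :+ b :* (v :* x))
               refl (v i) a (w i) b (x i)
    }

  ∣p∣≤1⇒p²≤1 : ∀ {p} → ∣ p ∣ ≤ 1ℚ → p * p ≤ 1ℚ
  ∣p∣≤1⇒p²≤1 {p} h = begin
    p * p          ≡⟨ sym (0≤p⇒∣p∣≡p (square-nonNeg p)) ⟩
    ∣ p * p ∣      ≡⟨ ∣p*q∣≡∣p∣*∣q∣ p p ⟩
    ∣ p ∣ * ∣ p ∣  ≤⟨ *-monoˡ (0≤∣p∣ p) h ⟩
    ∣ p ∣ * 1ℚ     ≡⟨ *-identityʳ ∣ p ∣ ⟩
    ∣ p ∣          ≤⟨ h ⟩
    1ℚ             ∎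
    where open ≤-Reasoning

  -- Networks and their composition.

  module Networks {s : ℕ} (χ : Bool → ℚ) where
    open Polynomials {s} χ public

    sign : Bool → ℚ
    sign true  = 1ℚ
    sign false = -1ℚ

    sign² : ∀ b → sign b * sign b ≡ 1ℚ
    sign² true  = refl
    sign² false = refl

    -- ref is the reflection through the space of flows and ⟪ u , v ⟫ the value of a flow v;
    -- flip z is 1 on the edges present at z and -1 on the absent ones.  A potential φ of
    -- unit drop satisfies ⟪ φ , v ⟫ = ⟪ u , v ⟫ for all flows v, that is, ref (φ - u) = u - φ,
    -- which is IsCut φ.  R and C bound the energies of unit flows and of cuts.
    record Network (f : Cube → Bool) (R C : ℚ) (T : ℕ) : Set₁ where
      field
        Edge          : Set
        innerProduct  : InnerProduct Edge
      open InnerProduct innerProduct public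
      field
        flip          : Cube → Vector Edge
        flip-isometry : ∀ z v w → ⟪ flip z ⊙ v , flip z ⊙ w ⟫ ≡ ⟪ v , w ⟫
        -- `T` counts the monomial parts of the flip. The bound `B` passes unchanged to each part,
        -- so iterating the walk never makes the coefficient vectors longer.
        flip-terms    : ∀ B v → ⟪ v , v ⟫ ≤ B → Terms (λ w → ⟪ w , w ⟫ ≤ B) 1 T (λ z → flip z ⊙ v)
        ref           : Vector Edge → Vector Edge
        ref-linear    : Linear ref
        ref-isometry  : ∀ v w → ⟪ ref v , ref w ⟫ ≡ ⟪ v , w ⟫
        u             : Vector Edge
        ref-u         : ref u ≗ u
        u-pos         : 0ℚ < ⟪ u , u ⟫

      IsCut : Vector Edge → Set
      IsCut φ = ref φ ≗ lc 2ℚ u -1ℚ φ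

      field
        flow : ∀ {z} → f z ≡ true → ∃[ w ] ref w ≗ w × flip z ⊙ w ≗ w × ⟪ u , w ⟫ ≡ 1ℚ × ⟪ w , w ⟫ ≤ R
        cut  : ∀ {z} → f z ≡ false → ∃[ φ ] IsCut φ × flip z ⊙ φ ≗ (λ i → - φ i) × ⟪ φ , φ ⟫ ≤ C

      module R = Linear ref-linear

      ref-u-ip : ∀ v → ⟪ u , ref v ⟫ ≡ ⟪ u , v ⟫
      ref-u-ip v = trans (ip-resp (λ i → sym (ref-u i)) (λ _ → refl)) (ref-isometry u v)

      -- Since `ref` is an isometry that fixes `w`, ⟪φ, w⟫ = ⟪ref φ, w⟫ = 2⟪u, w⟫ - ⟪φ, w⟫.
      cut-flow : ∀ {φ w} → IsCut φ → ref w ≗ w → ⟪ φ , w ⟫ ≡ ⟪ u , w ⟫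
      cut-flow {φ} {w} cφ fw = begin
        x                               ≡⟨ sym (halves x) ⟩
        ½ * x + ½ * x                   ≡⟨ cong (λ p → ½ * x + ½ * p) eq ⟩
        ½ * x + ½ * (2ℚ * y + -1ℚ * x)  ≡⟨ solve 2 (λ x y → con ½ :* x :+ con ½ :* (con 2ℚ :* y :+ con -1ℚ :* x) := y) refl x y ⟩
        y                               ∎
        where
        open ≡-Reasoning
        open import Defs using (halves)
        x = ⟪ φ , w ⟫
        y = ⟪ u , w ⟫
        eq : x ≡ 2ℚ * y + -1ℚ * x
        eq = trans (sym (ref-isometry φ w)) (trans (ip-resp cφ fw) (ip-comb 2ℚ u -1ℚ φ w))

      cut-voltage : ∀ {φ} → IsCut φ → ⟪ u , φ ⟫ ≡ ⟪ u , u ⟫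
      cut-voltage {φ} cφ = trans (ip-sym u φ) (cut-flow cφ ref-u)

      ref-zero : ref (λ _ → 0ℚ) ≗ λ _ → 0ℚ
      ref-zero i = trans (R.scale 0ℚ (λ _ → 0ℚ) i) (*-zeroˡ (ref (λ _ → 0ℚ) i))

    relax : ∀ {f f′ R R′ C C′ T T′} → f ≗ f′ → R ≤ R′ → C ≤ C′ → T ℕ.≤ T′ → Network f R C T → Network f′ R′ C′ T′
    relax f≗ R≤ C≤ T≤ N = record
      { Edge          = Edge
      ; innerProduct  = innerProduct
      ; flip          = flip
      ; flip-isometry = flip-isometry
      ; flip-terms    = λ B v vB → weaken ℕ.≤-refl T≤ (flip-terms B v vB)
      ; ref           = ref
      ; ref-linear    = ref-linear
      ; ref-isometry  = ref-isometry
      ; u             = u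
      ; ref-u         = ref-u
      ; u-pos         = u-pos
      ; flow          = λ {z} fz → let w , a , b , c , d = flow (trans (f≗ z) fz) in w , a , b , c , ≤-trans d R≤
      ; cut           = λ {z} fz → let φ , a , b , c = cut (trans (f≗ z) fz) in φ , a , b , ≤-trans c C≤
      }
      where open Network N

    -- On a single edge every vector is a flow, and the same vector 1 serves as the unit flow when
    -- the edge is present and as the unit drop when it is absent.
    edge : ∀ a {T} → Poly 1 T (λ z → sign (a z)) → Network a 1ℚ 1ℚ T
    edge a sgn-poly = record
      { Edge          = ⊤
      ; innerProduct  = record
        { ⟪_,_⟫   = λ v w → v tt * w tt
        ; ip-resp = λ v≗ w≗ → cong₂ _*_ (v≗ tt) (w≗ tt)
        ; ip-comb = λ a v b w x → solve 5 (λ a v b w x → (a :* v :+ b :* w) :* x := a :* (v :* x) :+ b :* (w :* x))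
                      refl a (v tt) b (w tt) (x tt)
        ; ip-sym  = λ v w → *-comm (v tt) (w tt)
        ; ip-pos  = λ v → square-nonNeg (v tt)
        }
      ; flip          = λ z _ → sign (a z)
      ; flip-isometry = λ z v w → begin
          sign (a z) * v tt * (sign (a z) * w tt)
            ≡⟨ solve 3 (λ c v w → c :* v :* (c :* w) := c :* c :* (v :* w)) refl (sign (a z)) (v tt) (w tt) ⟩
          sign (a z) * sign (a z) * (v tt * w tt)
            ≡⟨ cong (_* (v tt * w tt)) (sign² (a z)) ⟩
          1ℚ * (v tt * w tt)
            ≡⟨ *-identityˡ (v tt * w tt) ⟩
          v tt * w tt ∎
      ; flip-terms    = λ B v v²≤B → terms-resp (λ z _ → *-comm (v tt) (sign (a z)))
          (map-terms (⊙-linear v) (λ c c≤1 → ≤-trans (bound (c tt) (v tt) c≤1) v²≤B) sgn-poly)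
      ; ref           = λ v → v
      ; ref-linear    = record { resp = λ v≗ → v≗ ; comb = λ _ _ _ _ _ → refl }
      ; ref-isometry  = λ _ _ → refl
      ; u             = λ _ → 1ℚ
      ; ref-u         = λ _ → refl
      ; u-pos         = positive⁻¹ 1ℚ
      ; flow          = λ az → (λ _ → 1ℚ) , (λ _ → refl) , (λ _ → cong (λ b → sign b * 1ℚ) az) , refl , ≤-refl
      ; cut           = λ az → (λ _ → 1ℚ) , (λ _ → refl) , (λ _ → cong (λ b → sign b * 1ℚ) az) , ≤-refl
      }
      where
      open ≡-Reasoning
      bound : ∀ c v → ∣ c ∣ ≤ 1ℚ → v * c * (v * c) ≤ v * v
      bound c v c≤1 = subst₂ _≤_
        (solve 2 (λ c v → v :* v :* (c :* c) := v :* c :* (v :* c)) refl c v) (*-identityʳ (v * v))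
        (*-monoˡ (square-nonNeg v) (∣p∣≤1⇒p²≤1 c≤1))

    -- All resistances are multiplied by `λ₀`. Flows keep their values only if `u`, and with it
    -- every potential, is multiplied by `κ` = 1/`λ₀`; cut energies then change by `λ₀` `κ`² = `κ`.
    rescale : ∀ {f R C T λ₀ κ} → 0ℚ < λ₀ → 0ℚ < κ → λ₀ * κ ≡ 1ℚ →
      Network f R C T → Network f (λ₀ * R) (κ * C) T
    rescale {R = R} {C} {λ₀ = λ₀} {κ} λ₀>0 κ>0 λκ≡1 N = record
      { Edge          = Edge
      ; innerProduct  = record
        { ⟪_,_⟫   = λ v w → λ₀ * ⟪ v , w ⟫
        ; ip-resp = λ v≗ w≗ → cong (λ₀ *_) (ip-resp v≗ w≗)
        ; ip-comb = λ a v b w x → trans (cong (λ₀ *_) (ip-comb a v b w x))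
            (solve 5 (λ l a p b q → l :* (a :* p :+ b :* q) := a :* (l :* p) :+ b :* (l :* q))
              refl λ₀ a ⟪ v , x ⟫ b ⟪ w , x ⟫)
        ; ip-sym  = λ v w → cong (λ₀ *_) (ip-sym v w)
        ; ip-pos  = λ v → *-nonNeg (<⇒≤ λ₀>0) (ip-pos v)
        }
      ; flip          = flip
      ; flip-isometry = λ z v w → cong (λ₀ *_) (flip-isometry z v w)
      ; flip-terms    = λ B v λv≤B → terms-resp (λ _ _ → refl) (map-terms id-linear (λ w → from B w)
                          (flip-terms (κ * B) v (to B v λv≤B)))
      ; ref           = ref
      ; ref-linear    = ref-linear
      ; ref-isometry  = λ v w → cong (λ₀ *_) (ref-isometry v w)
      ; u             = λ i → κ * u i
      ; ref-u         = λ i → trans (R.scale κ u i) (cong (κ *_) (ref-u i))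
      ; u-pos         = *-pos λ₀>0 (subst (0ℚ <_) (sym (trans (ip-scaleˡ κ u (λ i → κ * u i))
                          (cong (κ *_) (ip-scaleʳ κ u u)))) (*-pos κ>0 (*-pos κ>0 u-pos)))
      ; flow          = λ fz → let w , ref-w , flip-w , uw , ww = flow fz in
          w , ref-w , flip-w
          , trans (cong (λ₀ *_) (ip-scaleˡ κ u w)) (trans (sym (*-assoc λ₀ κ _)) (cong₂ _*_ λκ≡1 uw))
          , *-monoˡ (<⇒≤ λ₀>0) ww
      ; cut           = λ fz → let φ , ref-φ , flip-φ , φφ = cut fz in
          (λ i → κ * φ i)
          , (λ i → trans (R.scale κ φ i) (trans (cong (κ *_) (ref-φ i))
              (solve 3 (λ k u p → k :* (con 2ℚ :* u :+ con -1ℚ :* p) := con 2ℚ :* (k :* u) :+ con -1ℚ :* (k :* p))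
                refl κ (u i) (φ i))))
          , (λ i → trans (solve 3 (λ a k p → a :* (k :* p) := k :* (a :* p)) refl (flip _ i) κ (φ i))
              (trans (cong (κ *_) (flip-φ i)) (sym (neg-distribʳ-* κ (φ i)))))
          , subst (_≤ κ * C) (sym (trans (cong (λ₀ *_) (trans (ip-scaleˡ κ φ _) (cong (κ *_) (ip-scaleʳ κ φ φ))))
              (cancel (κ * ⟪ φ , φ ⟫)))) (*-monoˡ (<⇒≤ κ>0) φφ)
      }
      where
      open Network N
      id-linear : Linear {Edge} {Edge} (λ v → v)
      id-linear = record { resp = λ v≗ → v≗ ; comb = λ _ _ _ _ _ → refl }
      cancel : ∀ p → λ₀ * (κ * p) ≡ p
      cancel p = trans (sym (*-assoc λ₀ κ p)) (trans (cong (_* p) λκ≡1) (*-identityˡ p))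
      cancel′ : ∀ p → κ * (λ₀ * p) ≡ p
      cancel′ p = trans (solve 3 (λ k l p → k :* (l :* p) := l :* (k :* p)) refl κ λ₀ p) (cancel p)
      to : ∀ B v → λ₀ * ⟪ v , v ⟫ ≤ B → ⟪ v , v ⟫ ≤ κ * B
      to B v h = subst (_≤ κ * B) (cancel′ ⟪ v , v ⟫) (*-monoˡ (<⇒≤ κ>0) h)
      from : ∀ B v → ⟪ v , v ⟫ ≤ κ * B → λ₀ * ⟪ v , v ⟫ ≤ B
      from B v h = subst (λ₀ * ⟪ v , v ⟫ ≤_) (cancel B) (*-monoˡ (<⇒≤ λ₀>0) h)

    -- Planar duality: flows and potentials, resistance and capacity change roles.
    dual : ∀ {f R C T} → Network f R C T → Network (λ z → not (f z)) C R T
    dual N = record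
      { Edge          = Edge
      ; innerProduct  = innerProduct
      ; flip          = λ z i → -1ℚ * flip z i
      ; flip-isometry = λ z v w → begin
          ⟪ (λ i → -1ℚ * flip z i) ⊙ v , (λ i → -1ℚ * flip z i) ⊙ w ⟫
            ≡⟨ ip-resp (λ i → *-assoc -1ℚ (flip z i) (v i)) (λ i → *-assoc -1ℚ (flip z i) (w i)) ⟩
          ⟪ (λ i → -1ℚ * (flip z ⊙ v) i) , (λ i → -1ℚ * (flip z ⊙ w) i) ⟫
            ≡⟨ trans (ip-scaleˡ -1ℚ _ _) (cong (-1ℚ *_) (ip-scaleʳ -1ℚ _ _)) ⟩
          -1ℚ * (-1ℚ * ⟪ flip z ⊙ v , flip z ⊙ w ⟫)
            ≡⟨ solve 1 (λ p → con -1ℚ :* (con -1ℚ :* p) := p) refl _ ⟩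
          ⟪ flip z ⊙ v , flip z ⊙ w ⟫
            ≡⟨ flip-isometry z v w ⟩
          ⟪ v , w ⟫ ∎
      ; flip-terms    = λ B v v²≤B → terms-resp
          (λ z i → sym (*-assoc -1ℚ (flip z i) (v i)))
          (map-terms (⊙-linear (λ _ → -1ℚ))
            (λ w → subst (_≤ B) (sym (trans (ip-scaleˡ -1ℚ _ _) (trans (cong (-1ℚ *_) (ip-scaleʳ -1ℚ _ _))
              (solve 1 (λ p → con -1ℚ :* (con -1ℚ :* p) := p) refl _)))))
            (flip-terms B v v²≤B))
      ; ref           = ref*
      ; ref-linear    = record
        { resp = λ {v} {w} v≗ i → cong₂ (λ p q → p * u i + -1ℚ * q) (cong (λ q → 2ℚ * g * q) (ip-resp (λ _ → refl) v≗)) (R.resp v≗ i)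
        ; comb = λ a v b w i → trans
            (cong₂ (λ p q → p * u i + -1ℚ * q) (cong (λ q → 2ℚ * g * q) (ip-combʳ u a v b w)) (R.comb a v b w i))
            (solve 8 (λ g a x b y u p q → con 2ℚ :* g :* (a :* x :+ b :* y) :* u :+ con -1ℚ :* (a :* p :+ b :* q)
               := a :* (con 2ℚ :* g :* x :* u :+ con -1ℚ :* p) :+ b :* (con 2ℚ :* g :* y :* u :+ con -1ℚ :* q))
               refl g a ⟪ u , v ⟫ b ⟪ u , w ⟫ (u i) (ref v i) (ref w i))
        }
      ; ref-isometry  = λ v w → begin
          ⟪ ref* v , ref* w ⟫
            ≡⟨ ip-comb₂ (c v) u -1ℚ (ref v) (c w) u -1ℚ (ref w) ⟩
          c v * (c w * γ + -1ℚ * ⟪ u , ref w ⟫) + -1ℚ * (c w * ⟪ ref v , u ⟫ + -1ℚ * ⟪ ref v , ref w ⟫)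
            ≡⟨ cong₂ (λ p q → c v * (c w * γ + -1ℚ * p) + -1ℚ * (c w * q + -1ℚ * ⟪ ref v , ref w ⟫))
                 (ref-u-ip w) (trans (ip-sym (ref v) u) (ref-u-ip v)) ⟩
          c v * (c w * γ + -1ℚ * ⟪ u , w ⟫) + -1ℚ * (c w * ⟪ u , v ⟫ + -1ℚ * ⟪ ref v , ref w ⟫)
            ≡⟨ cong (λ p → c v * (c w * γ + -1ℚ * ⟪ u , w ⟫) + -1ℚ * (c w * ⟪ u , v ⟫ + -1ℚ * p)) (ref-isometry v w) ⟩
          c v * (c w * γ + -1ℚ * ⟪ u , w ⟫) + -1ℚ * (c w * ⟪ u , v ⟫ + -1ℚ * ⟪ v , w ⟫)
            ≡⟨ solve 5 (λ g γ x y p →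
                 (con 2ℚ :* g :* x) :* ((con 2ℚ :* g :* y) :* γ :+ con -1ℚ :* y) :+ con -1ℚ :* ((con 2ℚ :* g :* y) :* x :+ con -1ℚ :* p)
                 := p :+ (γ :* g :- con 1ℚ) :* (con (2ℚ * 2ℚ) :* g :* x :* y)) refl g γ ⟪ u , v ⟫ ⟪ u , w ⟫ ⟪ v , w ⟫ ⟩
          ⟪ v , w ⟫ + (γ * g - 1ℚ) * (2ℚ * 2ℚ * g * ⟪ u , v ⟫ * ⟪ u , w ⟫)
            ≡⟨ cong (λ p → ⟪ v , w ⟫ + (p - 1ℚ) * (2ℚ * 2ℚ * g * ⟪ u , v ⟫ * ⟪ u , w ⟫)) γg≡1 ⟩
          ⟪ v , w ⟫ + 0ℚ * (2ℚ * 2ℚ * g * ⟪ u , v ⟫ * ⟪ u , w ⟫)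
            ≡⟨ solve 2 (λ p q → p :+ con 0ℚ :* q := p) refl ⟪ v , w ⟫ (2ℚ * 2ℚ * g * ⟪ u , v ⟫ * ⟪ u , w ⟫) ⟩
          ⟪ v , w ⟫ ∎
      ; u             = u*
      ; ref-u         = λ i → begin
          c u* * u i + -1ℚ * ref u* i
            ≡⟨ cong₂ (λ p q → p * u i + -1ℚ * q) (cong (2ℚ * g *_) (ip-scaleʳ g u u)) (trans (R.scale g u i) (cong (g *_) (ref-u i))) ⟩
          2ℚ * g * (g * γ) * u i + -1ℚ * (g * u i)
            ≡⟨ solve 3 (λ g γ u → con 2ℚ :* g :* (g :* γ) :* u :+ con -1ℚ :* (g :* u)
                 := con 2ℚ :* (γ :* g) :* g :* u :+ con -1ℚ :* (g :* u)) refl g γ (u i) ⟩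
          2ℚ * (γ * g) * g * u i + -1ℚ * (g * u i)
            ≡⟨ cong (λ p → 2ℚ * p * g * u i + -1ℚ * (g * u i)) γg≡1 ⟩
          2ℚ * 1ℚ * g * u i + -1ℚ * (g * u i)
            ≡⟨ solve 2 (λ g u → con 2ℚ :* con 1ℚ :* g :* u :+ con -1ℚ :* (g :* u) := g :* u) refl g (u i) ⟩
          g * u i ∎
      ; u-pos         = subst (0ℚ <_) (sym (trans (ip-scaleˡ g u _) (cong (g *_) (ip-scaleʳ g u u)))) (*-pos g>0 (*-pos g>0 u-pos))
      ; flow          = λ {z} fz → let φ , ref-φ , flip-φ , φφ = cut (not-injective fz) in
          φ
          , (λ i → trans (cong₂ (λ p q → 2ℚ * g * p * u i + -1ℚ * q) (cut-voltage ref-φ) (ref-φ i))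
              (trans (solve 4 (λ g γ u p → con 2ℚ :* g :* γ :* u :+ con -1ℚ :* (con 2ℚ :* u :+ con -1ℚ :* p)
                  := p :+ (γ :* g :- con 1ℚ) :* (con 2ℚ :* u)) refl g γ (u i) (φ i))
                (trans (cong (λ p → φ i + (p - 1ℚ) * (2ℚ * u i)) γg≡1)
                  (solve 2 (λ p q → p :+ (con 1ℚ :- con 1ℚ) :* q := p) refl (φ i) (2ℚ * u i)))))
          , (λ i → trans (*-assoc -1ℚ (flip z i) (φ i)) (trans (cong (-1ℚ *_) (flip-φ i))
              (solve 1 (λ p → con -1ℚ :* (:- p) := p) refl (φ i))))
          , trans (ip-scaleˡ g u φ) (trans (cong (g *_) (cut-voltage ref-φ)) (trans (*-comm g γ) γg≡1))
          , φφ
      ; cut           = λ {z} fz → let w , ref-w , flip-w , uw , ww = flow (not-injective fz) in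
          w
          , (λ i → trans (cong₂ (λ p q → 2ℚ * g * p * u i + -1ℚ * q) uw (ref-w i))
              (solve 3 (λ g u w → con 2ℚ :* g :* con 1ℚ :* u :+ con -1ℚ :* w := con 2ℚ :* (g :* u) :+ con -1ℚ :* w)
                refl g (u i) (w i)))
          , (λ i → trans (*-assoc -1ℚ (flip z i) (w i)) (trans (cong (-1ℚ *_) (flip-w i))
              (solve 1 (λ p → con -1ℚ :* p := :- p) refl (w i))))
          , ww
      }
      where
      open Network N
      open ≡-Reasoning
      γ = ⟪ u , u ⟫
      g = proj₁ (recip γ u-pos)
      g>0 = proj₁ (proj₂ (recip γ u-pos))
      γg≡1 = proj₂ (proj₂ (recip γ u-pos))
      c : Vector Edge → ℚ
      c v = 2ℚ * g * ⟪ u , v ⟫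
      -- The dual flows are the potentials, that is, the orthogonal complement of the flows together
      -- with the line of `u`. The map - `ref` is the reflection through the complement alone; the
      -- multiple of `u` corrects it to fix `u` as well.
      ref* : Vector Edge → Vector Edge
      ref* v = lc (c v) u -1ℚ (ref v)
      u* : Vector Edge
      u* i = g * u i

    module Series {f₁ f₂ R₁ R₂ C T₁ T₂} (N₁ : Network f₁ R₁ C T₁) (N₂ : Network f₂ R₂ C T₂) where
      module N₁ = Network N₁
      module N₂ = Network N₂

      γ₁ = N₁.⟪ N₁.u , N₁.u ⟫
      γ₂ = N₂.⟪ N₂.u , N₂.u ⟫
      γ-pos : 0ℚ < γ₁ + γ₂
      γ-pos = +-pos N₁.u-pos N₂.u-pos
      r = proj₁ (recip (γ₁ + γ₂) γ-pos)
      r>0 = proj₁ (proj₂ (recip (γ₁ + γ₂) γ-pos))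
      γr≡1 : (γ₁ + γ₂) * r ≡ 1ℚ
      γr≡1 = proj₂ (proj₂ (recip (γ₁ + γ₂) γ-pos))

      V : Set
      V = Vector (N₁.Edge ⊎ N₂.Edge)

      -- The ring solver cannot use the relation (`γ₁` + `γ₂`) `r` = 1, so identities are solved
      -- with an explicit multiple of its defect, which is removed here.
      modulo-γr : ∀ p q → p + ((γ₁ + γ₂) * r - 1ℚ) * q ≡ p
      modulo-γr p q = trans (cong (λ t → p + (t - 1ℚ) * q) γr≡1)
        (solve 2 (λ p q → p :+ (con 1ℚ :- con 1ℚ) :* q := p) refl p q)

      innerProduct : InnerProduct (N₁.Edge ⊎ N₂.Edge)
      innerProduct = record
        { ⟪_,_⟫   = λ v w → N₁.⟪ v ∘ inj₁ , w ∘ inj₁ ⟫ + N₂.⟪ v ∘ inj₂ , w ∘ inj₂ ⟫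
        ; ip-resp = λ v≗ w≗ → cong₂ _+_ (N₁.ip-resp (v≗ ∘ inj₁) (w≗ ∘ inj₁)) (N₂.ip-resp (v≗ ∘ inj₂) (w≗ ∘ inj₂))
        ; ip-comb = λ a v b w x → trans
            (cong₂ _+_ (N₁.ip-comb a (v ∘ inj₁) b (w ∘ inj₁) (x ∘ inj₁)) (N₂.ip-comb a (v ∘ inj₂) b (w ∘ inj₂) (x ∘ inj₂)))
            (solve 6 (λ a b p q r s → a :* p :+ b :* q :+ (a :* r :+ b :* s) := a :* (p :+ r) :+ b :* (q :+ s))
              refl a b _ _ _ _)
        ; ip-sym  = λ v w → cong₂ _+_ (N₁.ip-sym _ _) (N₂.ip-sym _ _)
        ; ip-pos  = λ v → +-nonNeg (N₁.ip-pos (v ∘ inj₁)) (N₂.ip-pos (v ∘ inj₂))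
        }
      open InnerProduct innerProduct

      inˡ : Vector N₁.Edge → V
      inˡ v = [ v , (λ _ → 0ℚ) ]
      inʳ : Vector N₂.Edge → V
      inʳ v = [ (λ _ → 0ℚ) , v ]

      inˡ-linear : Linear inˡ
      inˡ-linear = record
        { resp = λ v≗ → λ { (inj₁ i) → v≗ i ; (inj₂ _) → refl }
        ; comb = λ a v b w → λ { (inj₁ _) → refl ; (inj₂ _) → solve 2 (λ a b → con 0ℚ := a :* con 0ℚ :+ b :* con 0ℚ) refl a b }
        }
      inʳ-linear : Linear inʳ
      inʳ-linear = record
        { resp = λ v≗ → λ { (inj₁ _) → refl ; (inj₂ i) → v≗ i }
        ; comb = λ a v b w → λ { (inj₂ _) → refl ; (inj₁ _) → solve 2 (λ a b → con 0ℚ := a :* con 0ℚ :+ b :* con 0ℚ) refl a b }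
        }

      norm-inˡ : ∀ v → ⟪ inˡ v , inˡ v ⟫ ≡ N₁.⟪ v , v ⟫
      norm-inˡ v = trans (cong (N₁.⟪ v , v ⟫ +_) (N₂.ip-zeroʳ _)) (+-identityʳ _)
      norm-inʳ : ∀ v → ⟪ inʳ v , inʳ v ⟫ ≡ N₂.⟪ v , v ⟫
      norm-inʳ v = trans (cong (_+ N₂.⟪ v , v ⟫) (N₁.ip-zeroʳ _)) (+-identityˡ _)

      flip : Cube → V
      flip z = [ N₁.flip z , N₂.flip z ]

      -- The flows of the series network are the pairs of flows of equal value. Among all pairs of
      -- flows they form the hyperplane orthogonal to (`N₁.u`, -`N₂.u`), a vector of squared norm
      -- `γ₁` + `γ₂`; `mismatch` is the coefficient in the reflection through this hyperplane, with
      -- which `ref` corrects the two component reflections.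
      mismatch : V → ℚ
      mismatch v = 2ℚ * r * (N₁.⟪ N₁.u , v ∘ inj₁ ⟫ - N₂.⟪ N₂.u , v ∘ inj₂ ⟫)

      ref : V → V
      ref v = [ lc (- mismatch v) N₁.u 1ℚ (N₁.ref (v ∘ inj₁)) , lc (mismatch v) N₂.u 1ℚ (N₂.ref (v ∘ inj₂)) ]

      -- The orthogonal projection of (`N₁.u`, 0), and equally of (0, `N₂.u`), to that hyperplane:
      -- on matched flows all three measure the common value.
      u : V
      u = [ (λ i → r * γ₂ * N₁.u i) , (λ i → r * γ₁ * N₂.u i) ]

      mismatch-u : mismatch u ≡ 0ℚ
      mismatch-u = trans (cong₂ (λ p q → 2ℚ * r * (p - q)) (N₁.ip-scaleʳ (r * γ₂) N₁.u N₁.u) (N₂.ip-scaleʳ (r * γ₁) N₂.u N₂.u))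
        (solve 3 (λ r γ₁ γ₂ → con 2ℚ :* r :* (r :* γ₂ :* γ₁ :- r :* γ₁ :* γ₂) := con 0ℚ) refl r γ₁ γ₂)

      ref-matched : ∀ {v v₁ v₂} → mismatch v ≡ 0ℚ → N₁.ref (v ∘ inj₁) ≗ v₁ → N₂.ref (v ∘ inj₂) ≗ v₂ → ref v ≗ [ v₁ , v₂ ]
      ref-matched m₀ h₁ h₂ (inj₁ i) = trans (cong₂ (λ m p → - m * N₁.u i + 1ℚ * p) m₀ (h₁ i))
        (solve 2 (λ u p → :- con 0ℚ :* u :+ con 1ℚ :* p := p) refl (N₁.u i) _)
      ref-matched m₀ h₁ h₂ (inj₂ i) = trans (cong₂ (λ m p → m * N₂.u i + 1ℚ * p) m₀ (h₂ i))
        (solve 2 (λ u p → con 0ℚ :* u :+ con 1ℚ :* p := p) refl (N₂.u i) _)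

      IsCut : V → Set
      IsCut φ = ref φ ≗ lc 2ℚ u -1ℚ φ

      -- A potential that drops by 1 across one component and is constant on the other drops by 1 in
      -- total. The mirror image `cutˡ` also makes the closing edge of the circuit a cut, as the
      -- walk requires of its starting vector.
      cutʳ : ∀ {φ} → N₂.IsCut φ → IsCut (inʳ φ)
      cutʳ {φ} cφ = λ where
          (inj₁ i) → trans (cong₂ (λ m p → - m * N₁.u i + 1ℚ * p) m≡ (N₁.ref-zero i))
            (solve 3 (λ r g u → :- (con 2ℚ :* r :* (con 0ℚ :- g)) :* u :+ con 1ℚ :* con 0ℚ
                := con 2ℚ :* (r :* g :* u) :+ con -1ℚ :* con 0ℚ) refl r γ₂ (N₁.u i))
          (inj₂ i) → trans (cong₂ (λ m p → m * N₂.u i + 1ℚ * p) m≡ (cφ i))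
            (trans (solve 5 (λ r γ₁ γ₂ u p → con 2ℚ :* r :* (con 0ℚ :- γ₂) :* u :+ con 1ℚ :* (con 2ℚ :* u :+ con -1ℚ :* p)
                := con 2ℚ :* (r :* γ₁ :* u) :+ con -1ℚ :* p :+ ((γ₁ :+ γ₂) :* r :- con 1ℚ) :* (con -1ℚ :* con 2ℚ :* u))
                refl r γ₁ γ₂ (N₂.u i) (φ i))
              (modulo-γr _ _))
        where
        m≡ : mismatch (inʳ φ) ≡ 2ℚ * r * (0ℚ - γ₂)
        m≡ = cong₂ (λ p q → 2ℚ * r * (p - q)) (N₁.ip-zeroʳ N₁.u) (N₂.cut-voltage cφ)

      cutˡ : ∀ {φ} → N₁.IsCut φ → IsCut (inˡ φ)
      cutˡ {φ} cφ = λ where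
          (inj₂ i) → trans (cong₂ (λ m p → m * N₂.u i + 1ℚ * p) m≡ (N₂.ref-zero i))
            (solve 3 (λ r g u → con 2ℚ :* r :* (g :- con 0ℚ) :* u :+ con 1ℚ :* con 0ℚ
                := con 2ℚ :* (r :* g :* u) :+ con -1ℚ :* con 0ℚ) refl r γ₁ (N₂.u i))
          (inj₁ i) → trans (cong₂ (λ m p → - m * N₁.u i + 1ℚ * p) m≡ (cφ i))
            (trans (solve 5 (λ r γ₁ γ₂ u p → :- (con 2ℚ :* r :* (γ₁ :- con 0ℚ)) :* u :+ con 1ℚ :* (con 2ℚ :* u :+ con -1ℚ :* p)
                := con 2ℚ :* (r :* γ₂ :* u) :+ con -1ℚ :* p :+ ((γ₁ :+ γ₂) :* r :- con 1ℚ) :* (con -1ℚ :* con 2ℚ :* u))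
                refl r γ₁ γ₂ (N₁.u i) (φ i))
              (modulo-γr _ _))
        where
        m≡ : mismatch (inˡ φ) ≡ 2ℚ * r * (γ₁ - 0ℚ)
        m≡ = cong₂ (λ p q → 2ℚ * r * (p - q)) (N₁.cut-voltage cφ) (N₂.ip-zeroʳ N₂.u)

      -- A flow uses both components, so the flow energies add. A cut lives in one component, so a
      -- bound `C` common to both does not grow.
      series : Network (λ z → f₁ z ∧ f₂ z) (R₁ + R₂) C (T₁ ℕ.+ T₂)
      series = record
        { Edge          = N₁.Edge ⊎ N₂.Edge
        ; innerProduct  = innerProduct
        ; flip          = flip
        ; flip-isometry = λ z v w → cong₂ _+_ (N₁.flip-isometry z _ _) (N₂.flip-isometry z _ _)
        ; flip-terms    = λ B v v²≤B → sum
            (map-terms inˡ-linear (λ w → subst (_≤ B) (sym (norm-inˡ w))) (N₁.flip-terms B (v ∘ inj₁)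
              (≤-trans (subst (_≤ ⟪ v , v ⟫) (+-identityʳ _) (+-monoʳ-≤ N₁.⟪ v ∘ inj₁ , v ∘ inj₁ ⟫ (N₂.ip-pos (v ∘ inj₂)))) v²≤B)))
            (map-terms inʳ-linear (λ w → subst (_≤ B) (sym (norm-inʳ w))) (N₂.flip-terms B (v ∘ inj₂)
              (≤-trans (subst (_≤ ⟪ v , v ⟫) (+-identityˡ _) (+-monoˡ-≤ N₂.⟪ v ∘ inj₂ , v ∘ inj₂ ⟫ (N₁.ip-pos (v ∘ inj₁)))) v²≤B)))
            ℕ.≤-refl
            (λ { z (inj₁ i) → sym (+-identityʳ _) ; z (inj₂ i) → sym (+-identityˡ _) })
        ; ref           = ref
        ; ref-linear    = record { resp = ref-resp ; comb = ref-comb }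
        ; ref-isometry  = ref-isometry
        ; u             = u
        ; ref-u         = ref-u
        ; u-pos         = +-pos
            (subst (0ℚ <_) (sym (trans (N₁.ip-scaleˡ (r * γ₂) N₁.u (u ∘ inj₁)) (cong (r * γ₂ *_) (N₁.ip-scaleʳ (r * γ₂) N₁.u N₁.u))))
              (*-pos (*-pos r>0 N₂.u-pos) (*-pos (*-pos r>0 N₂.u-pos) N₁.u-pos)))
            (subst (0ℚ <_) (sym (trans (N₂.ip-scaleˡ (r * γ₁) N₂.u (u ∘ inj₂)) (cong (r * γ₁ *_) (N₂.ip-scaleʳ (r * γ₁) N₂.u N₂.u))))
              (*-pos (*-pos r>0 N₁.u-pos) (*-pos (*-pos r>0 N₁.u-pos) N₂.u-pos)))
        ; flow          = flow
        ; cut           = cut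
        }
        where
        open ≡-Reasoning

        mismatch-comb : ∀ a v b w → mismatch (lc a v b w) ≡ a * mismatch v + b * mismatch w
        mismatch-comb a v b w = trans
          (cong₂ (λ p q → 2ℚ * r * (p - q)) (N₁.ip-combʳ N₁.u a (v ∘ inj₁) b (w ∘ inj₁)) (N₂.ip-combʳ N₂.u a (v ∘ inj₂) b (w ∘ inj₂)))
          (solve 7 (λ r a b p q p′ q′ → con 2ℚ :* r :* ((a :* p :+ b :* q) :- (a :* p′ :+ b :* q′))
            := a :* (con 2ℚ :* r :* (p :- p′)) :+ b :* (con 2ℚ :* r :* (q :- q′))) refl r a b _ _ _ _)

        ref-resp : ∀ {v w} → v ≗ w → ref v ≗ ref w
        ref-resp {v} {w} v≗ = λ where
            (inj₁ i) → cong₂ (λ m p → - m * N₁.u i + 1ℚ * p) m≡ (N₁.R.resp (v≗ ∘ inj₁) i)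
            (inj₂ i) → cong₂ (λ m p → m * N₂.u i + 1ℚ * p) m≡ (N₂.R.resp (v≗ ∘ inj₂) i)
          where
          m≡ : mismatch v ≡ mismatch w
          m≡ = cong₂ (λ p q → 2ℚ * r * (p - q)) (N₁.ip-resp (λ _ → refl) (v≗ ∘ inj₁)) (N₂.ip-resp (λ _ → refl) (v≗ ∘ inj₂))

        ref-comb : ∀ a v b w → ref (lc a v b w) ≗ lc a (ref v) b (ref w)
        ref-comb a v b w = λ where
          (inj₁ i) → trans (cong₂ (λ m p → - m * N₁.u i + 1ℚ * p) (mismatch-comb a v b w) (N₁.R.comb a (v ∘ inj₁) b (w ∘ inj₁) i))
            (solve 7 (λ a b m n u p q → :- (a :* m :+ b :* n) :* u :+ con 1ℚ :* (a :* p :+ b :* q)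
              := a :* (:- m :* u :+ con 1ℚ :* p) :+ b :* (:- n :* u :+ con 1ℚ :* q)) refl a b (mismatch v) (mismatch w) (N₁.u i) _ _)
          (inj₂ i) → trans (cong₂ (λ m p → m * N₂.u i + 1ℚ * p) (mismatch-comb a v b w) (N₂.R.comb a (v ∘ inj₂) b (w ∘ inj₂) i))
            (solve 7 (λ a b m n u p q → (a :* m :+ b :* n) :* u :+ con 1ℚ :* (a :* p :+ b :* q)
              := a :* (m :* u :+ con 1ℚ :* p) :+ b :* (n :* u :+ con 1ℚ :* q)) refl a b (mismatch v) (mismatch w) (N₂.u i) _ _)

        ref-u : ref u ≗ u
        ref-u i = trans
          (ref-matched {u} {u ∘ inj₁} {u ∘ inj₂} mismatch-u
            (λ i → trans (N₁.R.scale (r * γ₂) N₁.u i) (cong (r * γ₂ *_) (N₁.ref-u i)))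
            (λ i → trans (N₂.R.scale (r * γ₁) N₂.u i) (cong (r * γ₁ *_) (N₂.ref-u i))) i)
          ([_,_] {C = λ i → [ u ∘ inj₁ , u ∘ inj₂ ] i ≡ u i} (λ _ → refl) (λ _ → refl) i)

        ref-isometry : ∀ v w → ⟪ ref v , ref w ⟫ ≡ ⟪ v , w ⟫
        ref-isometry v w = begin
          ⟪ ref v , ref w ⟫
            ≡⟨ cong₂ _+_ (N₁.ip-comb₂ (- m) N₁.u 1ℚ (N₁.ref v₁) (- n) N₁.u 1ℚ (N₁.ref w₁))
                         (N₂.ip-comb₂ m N₂.u 1ℚ (N₂.ref v₂) n N₂.u 1ℚ (N₂.ref w₂)) ⟩
          (- m * (- n * γ₁ + 1ℚ * N₁.⟪ N₁.u , N₁.ref w₁ ⟫) + 1ℚ * (- n * N₁.⟪ N₁.ref v₁ , N₁.u ⟫ + 1ℚ * N₁.⟪ N₁.ref v₁ , N₁.ref w₁ ⟫))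
          + (m * (n * γ₂ + 1ℚ * N₂.⟪ N₂.u , N₂.ref w₂ ⟫) + 1ℚ * (n * N₂.⟪ N₂.ref v₂ , N₂.u ⟫ + 1ℚ * N₂.⟪ N₂.ref v₂ , N₂.ref w₂ ⟫))
            ≡⟨ cong₂ _+_
                 (cong₂ _+_ (cong (λ p → - m * (- n * γ₁ + 1ℚ * p)) (N₁.ref-u-ip w₁))
                   (cong₂ (λ p q → 1ℚ * (- n * p + 1ℚ * q)) (trans (N₁.ip-sym _ _) (N₁.ref-u-ip v₁)) (N₁.ref-isometry v₁ w₁)))
                 (cong₂ _+_ (cong (λ p → m * (n * γ₂ + 1ℚ * p)) (N₂.ref-u-ip w₂))
                   (cong₂ (λ p q → 1ℚ * (n * p + 1ℚ * q)) (trans (N₂.ip-sym _ _) (N₂.ref-u-ip v₂)) (N₂.ref-isometry v₂ w₂))) ⟩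
          (- m * (- n * γ₁ + 1ℚ * y₁) + 1ℚ * (- n * x₁ + 1ℚ * p₁)) + (m * (n * γ₂ + 1ℚ * y₂) + 1ℚ * (n * x₂ + 1ℚ * p₂))
            ≡⟨ solve 9 (λ r γ₁ γ₂ x₁ x₂ y₁ y₂ p₁ p₂ →
                 let m = con 2ℚ :* r :* (x₁ :- x₂) ; n = con 2ℚ :* r :* (y₁ :- y₂) in
                 (:- m :* (:- n :* γ₁ :+ con 1ℚ :* y₁) :+ con 1ℚ :* (:- n :* x₁ :+ con 1ℚ :* p₁))
                 :+ (m :* (n :* γ₂ :+ con 1ℚ :* y₂) :+ con 1ℚ :* (n :* x₂ :+ con 1ℚ :* p₂))
                 := p₁ :+ p₂ :+ ((γ₁ :+ γ₂) :* r :- con 1ℚ) :* (con (2ℚ * 2ℚ) :* r :* (x₁ :- x₂) :* (y₁ :- y₂)))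
                 refl r γ₁ γ₂ x₁ x₂ y₁ y₂ p₁ p₂ ⟩
          p₁ + p₂ + ((γ₁ + γ₂) * r - 1ℚ) * (2ℚ * 2ℚ * r * (x₁ - x₂) * (y₁ - y₂))
            ≡⟨ modulo-γr (p₁ + p₂) _ ⟩
          p₁ + p₂ ∎
          where
          v₁ = v ∘ inj₁
          v₂ = v ∘ inj₂
          w₁ = w ∘ inj₁
          w₂ = w ∘ inj₂
          m = mismatch v
          n = mismatch w
          x₁ = N₁.⟪ N₁.u , v₁ ⟫
          x₂ = N₂.⟪ N₂.u , v₂ ⟫
          y₁ = N₁.⟪ N₁.u , w₁ ⟫
          y₂ = N₂.⟪ N₂.u , w₂ ⟫
          p₁ = N₁.⟪ v₁ , w₁ ⟫
          p₂ = N₂.⟪ v₂ , w₂ ⟫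

        flow : ∀ {z} → f₁ z ∧ f₂ z ≡ true → ∃[ w ] ref w ≗ w × flip z ⊙ w ≗ w × ⟪ u , w ⟫ ≡ 1ℚ × ⟪ w , w ⟫ ≤ R₁ + R₂
        flow {z} fz with f₁ z in eq₁ | f₂ z in eq₂
        ... | true | true =
          let w₁ , ref-w₁ , flip-w₁ , uw₁ , ww₁ = N₁.flow eq₁
              w₂ , ref-w₂ , flip-w₂ , uw₂ , ww₂ = N₂.flow eq₂
              w : V
              w = [ w₁ , w₂ ]
              matched : mismatch w ≡ 0ℚ
              matched = trans (cong₂ (λ p q → 2ℚ * r * (p - q)) uw₁ uw₂) (*-zeroʳ (2ℚ * r))
          in w
           , ref-matched {w} {w₁} {w₂} matched ref-w₁ ref-w₂
           , (λ { (inj₁ i) → flip-w₁ i ; (inj₂ i) → flip-w₂ i })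
           , trans (cong₂ _+_ (trans (N₁.ip-scaleˡ (r * γ₂) N₁.u w₁) (cong (r * γ₂ *_) uw₁))
                              (trans (N₂.ip-scaleˡ (r * γ₁) N₂.u w₂) (cong (r * γ₁ *_) uw₂)))
               (trans (solve 3 (λ r γ₁ γ₂ → r :* γ₂ :* con 1ℚ :+ r :* γ₁ :* con 1ℚ := (γ₁ :+ γ₂) :* r) refl r γ₁ γ₂) γr≡1)
           , +-mono-≤ ww₁ ww₂

        cut : ∀ {z} → f₁ z ∧ f₂ z ≡ false → ∃[ φ ] IsCut φ × flip z ⊙ φ ≗ (λ i → - φ i) × ⟪ φ , φ ⟫ ≤ C
        cut {z} fz with f₁ z in eq₁ | f₂ z in eq₂
        ... | false | _ =
          let φ , cut-φ , flip-φ , φφ = N₁.cut eq₁ in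
          inˡ φ , cutˡ cut-φ
          , (λ { (inj₁ i) → flip-φ i ; (inj₂ i) → *-zeroʳ (N₂.flip z i) })
          , subst (_≤ C) (sym (norm-inˡ φ)) φφ
        ... | true | false =
          let φ , cut-φ , flip-φ , φφ = N₂.cut eq₂ in
          inʳ φ , cutʳ cut-φ
          , (λ { (inj₁ i) → *-zeroʳ (N₁.flip z i) ; (inj₂ i) → flip-φ i })
          , subst (_≤ C) (sym (norm-inʳ φ)) φφ

  -- Natural numbers as rationals.

  ι : ℕ → ℚ
  ι k = ℤ.+ k ℚ./ 1

  1/8 7/8 1/7 8/7 : ℚ
  1/8 = ℤ.+ 1 ℚ./ 8
  7/8 = ℤ.+ 7 ℚ./ 8
  1/7 = ℤ.+ 1 ℚ./ 7
  8/7 = ℤ.+ 8 ℚ./ 7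

  toℚᵘ-ι : ∀ k → toℚᵘ (ι k) ℚᵘ.≃ ℚᵘ.mkℚᵘ (ℤ.+ k) 0
  toℚᵘ-ι k = toℚᵘ-fromℚᵘ (ℚᵘ.mkℚᵘ (ℤ.+ k) 0)

  ι-+ : ∀ m n → ι (m ℕ.+ n) ≡ ι m + ι n
  ι-+ m n = toℚᵘ-injective (begin
    toℚᵘ (ι (m ℕ.+ n))                            ≈⟨ toℚᵘ-ι (m ℕ.+ n) ⟩
    ℚᵘ.mkℚᵘ (ℤ.+ (m ℕ.+ n)) 0                       ≈⟨ ℚᵘ.*≡* (cong (ℤ._* ℤ.+ 1) (sym (cong₂ ℤ._+_ (ℤ.*-identityʳ (ℤ.+ m)) (ℤ.*-identityʳ (ℤ.+ n))))) ⟩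
    ℚᵘ.mkℚᵘ (ℤ.+ m) 0 ℚᵘ.+ ℚᵘ.mkℚᵘ (ℤ.+ n) 0          ≈⟨ ℚᵘ.+-cong (toℚᵘ-ι m) (toℚᵘ-ι n) ⟨
    toℚᵘ (ι m) ℚᵘ.+ toℚᵘ (ι n)                    ≈⟨ toℚᵘ-homo-+ (ι m) (ι n) ⟨
    toℚᵘ (ι m + ι n)                              ∎)
    where open ℚᵘ.≃-Reasoning

  ι-* : ∀ m n → ι (m ℕ.* n) ≡ ι m * ι n
  ι-* zero    n = sym (*-zeroˡ (ι n))
  ι-* (suc m) n = begin
    ι (n ℕ.+ m ℕ.* n)   ≡⟨ trans (ι-+ n (m ℕ.* n)) (cong (ι n +_) (ι-* m n)) ⟩
    ι n + ι m * ι n     ≡⟨ solve 2 (λ m n → n :+ m :* n := (con 1ℚ :+ m) :* n) refl (ι m) (ι n) ⟩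
    (1ℚ + ι m) * ι n    ≡⟨ cong (_* ι n) (sym (ι-+ 1 m)) ⟩
    ι (suc m) * ι n     ∎
    where open ≡-Reasoning

  ι-nonNeg : ∀ n → 0ℚ ≤ ι n
  ι-nonNeg zero    = ≤-refl
  ι-nonNeg (suc n) = subst (0ℚ ≤_) (sym (ι-+ 1 n)) (+-nonNeg (from-yes (0ℚ ≤? 1ℚ)) (ι-nonNeg n))

  ι-mono : ∀ {m n} → m ℕ.≤ n → ι m ≤ ι n
  ι-mono {m} {n} m≤n = begin
    ι m                  ≡⟨ sym (+-identityʳ (ι m)) ⟩
    ι m + 0ℚ             ≤⟨ +-monoʳ-≤ (ι m) (ι-nonNeg (n ℕ.∸ m)) ⟩
    ι m + ι (n ℕ.∸ m)    ≡⟨ sym (ι-+ m (n ℕ.∸ m)) ⟩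
    ι (m ℕ.+ (n ℕ.∸ m))  ≡⟨ cong ι (ℕ.m+[n∸m]≡n m≤n) ⟩
    ι n                  ∎
    where open ≤-Reasoning

  ι-pos : ∀ {n} → 0 ℕ.< n → 0ℚ < ι n
  ι-pos 0<n = <-≤-trans (positive⁻¹ 1ℚ) (ι-mono 0<n)

  recip≤1 : ∀ {p q} → 0ℚ < q → p * q ≡ 1ℚ → 1ℚ ≤ p → q ≤ 1ℚ
  recip≤1 {p} {q} q>0 pq≡1 1≤p = subst₂ _≤_ (*-identityʳ q) (trans (*-comm q p) pq≡1) (*-monoˡ (<⇒≤ q>0) 1≤p)

  ∣p∣≤ : ∀ {p r} → p ≤ r → - p ≤ r → ∣ p ∣ ≤ r
  ∣p∣≤ {p} {r} p≤r -p≤r with ∣p∣≡p∨∣p∣≡-p p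
  ... | inj₁ eq = subst (_≤ r) (sym eq) p≤r
  ... | inj₂ eq = subst (_≤ r) (sym eq) -p≤r

  size-pos : ∀ {s} (F : Formula s) → 0 ℕ.< size F
  size-pos (leaf _)  = s≤s z≤n
  size-pos (NOT F)   = size-pos F
  size-pos (AND F G) = ℕ.<-≤-trans (size-pos F) (ℕ.m≤m+n (size F) (size G))
  size-pos (OR F G)  = ℕ.<-≤-trans (size-pos F) (ℕ.m≤m+n (size F) (size G))

  -- The walk on a closed circuit and the crude approximation.

  module FormulaNetworks {s : ℕ} (χ : Bool → ℚ) where
    open Networks {s} χ

    module Walk {f R C T} (N : Network f R C T) (e : Vector (Network.Edge N))
      (cut-e : Network.IsCut N e) (flip-e : ∀ z → Network.flip N z ⊙ e ≗ e) (norm-e : Network.⟪_,_⟫ N e e ≡ 1ℚ) where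
      open Network N

      step : Cube → Vector Edge → Vector Edge
      step z v = flip z ⊙ ref v

      step-linear : ∀ z → Linear (step z)
      step-linear z = record
        { resp = λ v≗ i → cong (flip z i *_) (R.resp v≗ i)
        ; comb = λ a v b w i → trans (cong (flip z i *_) (R.comb a v b w i))
            (Linear.comb (⊙-linear (flip z)) a (ref v) b (ref w) i)
        }

      step-isometry : ∀ z v w → ⟪ step z v , step z w ⟫ ≡ ⟪ v , w ⟫
      step-isometry z v w = trans (flip-isometry z (ref v) (ref w)) (ref-isometry v w)

      -- Horner form of the sum of the first k + 1 iterates of `step z` at `e`: each further summand
      -- costs a single application of `bind`.
      ψ : ℕ → Cube → Vector Edge
      ψ zero    z = e
      ψ (suc k) z = lc 1ℚ e 1ℚ (step z (ψ k z))

      -- Each step applies the flip once, which raises the degree by 1 and multiplies the number of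
      -- terms by `T`; with the new term `e` the count is 1 + T (T + 1)^k, which is at most (T +
      -- 1)^(k + 1).
      ψ-terms : ∀ k → Terms (λ v → ⟪ v , v ⟫ ≤ 1ℚ) k (suc T ℕ.^ k) (ψ k)
      ψ-terms zero    = term [] e z≤n (≤-reflexive norm-e) (λ z i → sym (*-identityˡ (e i)))
      ψ-terms (suc k) = sum
        (term [] e z≤n (≤-reflexive norm-e) (λ z i → refl))
        (weaken (ℕ.≤-reflexive (ℕ.+-comm k 1)) ℕ.≤-refl
          (bind step-linear (λ v v²≤1 → flip-terms 1ℚ (ref v) (subst (_≤ 1ℚ) (sym (ref-isometry v v)) v²≤1)) (ψ-terms k)))
        (ℕ.+-mono-≤ (ℕ.m^n>0 (suc T) k) (ℕ.≤-reflexive (ℕ.*-comm (suc T ℕ.^ k) T)))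
        (λ z i → cong (1ℚ * e i +_) (*-identityˡ _))

      norm-step : ∀ z v → ⟪ step z v , step z v ⟫ ≡ ⟪ v , v ⟫
      norm-step z v = step-isometry z v v

      -- The triangle inequality for k + 1 unit vectors, in squared form.
      norm-≤ : ∀ k z → ⟪ ψ k z , ψ k z ⟫ ≤ ι (suc k) * ι (suc k)
      norm-≤ zero    z = ≤-reflexive norm-e
      norm-≤ (suc k) z = begin
        ⟪ ψ (suc k) z , ψ (suc k) z ⟫
          ≡⟨ norm-comb 1ℚ e 1ℚ v ⟩
        1ℚ * 1ℚ * ⟪ e , e ⟫ + (1ℚ + 1ℚ) * 1ℚ * ⟪ e , v ⟫ + 1ℚ * 1ℚ * ⟪ v , v ⟫
          ≤⟨ +-mono-≤ (+-mono-≤ (≤-reflexive (cong (1ℚ * 1ℚ *_) norm-e))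
               (*-monoˡ (from-yes (0ℚ ≤? (1ℚ + 1ℚ) * 1ℚ)) ev≤M)) (*-monoˡ (from-yes (0ℚ ≤? 1ℚ * 1ℚ)) v²≤M²) ⟩
        1ℚ * 1ℚ * 1ℚ + (1ℚ + 1ℚ) * 1ℚ * M + 1ℚ * 1ℚ * (M * M)
          ≡⟨ solve 1 (λ m → con (1ℚ * 1ℚ * 1ℚ) :+ con ((1ℚ + 1ℚ) * 1ℚ) :* m :+ con (1ℚ * 1ℚ) :* (m :* m)
               := (con 1ℚ :+ m) :* (con 1ℚ :+ m)) refl M ⟩
        (1ℚ + M) * (1ℚ + M)
          ≡⟨ cong₂ _*_ (sym (ι-+ 1 (suc k))) (sym (ι-+ 1 (suc k))) ⟩
        ι (suc (suc k)) * ι (suc (suc k)) ∎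
        where
        open ≤-Reasoning
        M = ι (suc k)
        v = step z (ψ k z)
        v²≤M² : ⟪ v , v ⟫ ≤ M * M
        v²≤M² = subst (_≤ M * M) (sym (norm-step z (ψ k z))) (norm-≤ k z)
        -- Cauchy-Schwarz as 0 ≤ ‖M e - v‖², with the factor 2M cancelled.
        ev≤M : ⟪ e , v ⟫ ≤ M
        ev≤M = *-cancelˡ-≤-pos (M + M) {{positive (+-pos (ι-pos {suc k} (s≤s z≤n)) (ι-pos {suc k} (s≤s z≤n)))}} (sub-nonNeg⁻¹ (begin
          0ℚ
            ≤⟨ ip-pos (lc M e -1ℚ v) ⟩
          ⟪ lc M e -1ℚ v , lc M e -1ℚ v ⟫
            ≡⟨ norm-comb M e -1ℚ v ⟩
          M * M * ⟪ e , e ⟫ + (M + M) * -1ℚ * ⟪ e , v ⟫ + -1ℚ * -1ℚ * ⟪ v , v ⟫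
            ≤⟨ +-mono-≤ (≤-reflexive (cong (λ p → M * M * p + (M + M) * -1ℚ * ⟪ e , v ⟫) norm-e))
                 (*-monoˡ (from-yes (0ℚ ≤? -1ℚ * -1ℚ)) v²≤M²) ⟩
          M * M * 1ℚ + (M + M) * -1ℚ * ⟪ e , v ⟫ + -1ℚ * -1ℚ * (M * M)
            ≡⟨ solve 2 (λ m x → m :* m :* con 1ℚ :+ (m :+ m) :* con -1ℚ :* x :+ con (-1ℚ * -1ℚ) :* (m :* m)
                 := (m :+ m) :* m :- (m :+ m) :* x) refl M ⟪ e , v ⟫ ⟩
          (M + M) * M - (M + M) * ⟪ e , v ⟫ ∎))

      module _ {z} (fz : f z ≡ true) where
        private
          w = proj₁ (flow fz)
          ref-w = proj₁ (proj₂ (flow fz))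
          flip-w = proj₁ (proj₂ (proj₂ (flow fz)))
          uw≡1 = proj₁ (proj₂ (proj₂ (proj₂ (flow fz))))
          w²≤R = proj₂ (proj₂ (proj₂ (proj₂ (flow fz))))

        -- The flow `w` is fixed by the isometry `step z`, so every iterate of `e` has the same
        -- inner product with `w` as `e` itself, namely 1.
        drift : ∀ k → ⟪ ψ k z , w ⟫ ≡ ι (suc k)
        drift zero    = trans (cut-flow cut-e ref-w) uw≡1
        drift (suc k) = begin
          ⟪ lc 1ℚ e 1ℚ (step z (ψ k z)) , w ⟫
            ≡⟨ ip-comb 1ℚ e 1ℚ (step z (ψ k z)) w ⟩
          1ℚ * ⟪ e , w ⟫ + 1ℚ * ⟪ step z (ψ k z) , w ⟫
            ≡⟨ cong₂ (λ p q → 1ℚ * p + 1ℚ * q) (trans (cut-flow cut-e ref-w) uw≡1)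
                 (ip-resp (λ _ → refl) (λ i → trans (sym (flip-w i)) (cong (flip z i *_) (sym (ref-w i))))) ⟩
          1ℚ * 1ℚ + 1ℚ * ⟪ step z (ψ k z) , step z w ⟫
            ≡⟨ cong (λ p → 1ℚ * 1ℚ + 1ℚ * p) (trans (step-isometry z (ψ k z) w) (drift k)) ⟩
          1ℚ * 1ℚ + 1ℚ * ι (suc k)
            ≡⟨ cong (1ℚ +_) (*-identityˡ (ι (suc k))) ⟩
          1ℚ + ι (suc k)
            ≡⟨ sym (ι-+ 1 (suc k)) ⟩
          ι (suc (suc k)) ∎
          where open ≡-Reasoning

        -- Cauchy–Schwarz against w, in the form 0 ≤ ‖ψ - (M/R)w‖².
        norm-≥ : ∀ {r} → R * r ≡ 1ℚ → ∀ k → r * (ι (suc k) * ι (suc k)) ≤ ⟪ ψ k z , ψ k z ⟫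
        norm-≥ {r} Rr≡1 k = sub-nonNeg⁻¹ (begin
          0ℚ
            ≤⟨ ip-pos (lc 1ℚ v (- t) w) ⟩
          ⟪ lc 1ℚ v (- t) w , lc 1ℚ v (- t) w ⟫
            ≡⟨ norm-comb 1ℚ v (- t) w ⟩
          1ℚ * 1ℚ * ⟪ v , v ⟫ + (1ℚ + 1ℚ) * - t * ⟪ v , w ⟫ + - t * - t * ⟪ w , w ⟫
            ≤⟨ +-mono-≤ (≤-reflexive (cong (λ p → 1ℚ * 1ℚ * ⟪ v , v ⟫ + (1ℚ + 1ℚ) * - t * p) (drift k)))
                 (*-monoˡ (square-nonNeg (- t)) w²≤R) ⟩
          1ℚ * 1ℚ * ⟪ v , v ⟫ + (1ℚ + 1ℚ) * - t * M + - t * - t * R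
            ≡⟨ solve 4 (λ v r m R → let t = r :* m in
                 con (1ℚ * 1ℚ) :* v :+ con (1ℚ + 1ℚ) :* :- t :* m :+ :- t :* :- t :* R
                 := v :- r :* (m :* m) :+ (R :* r :- con 1ℚ) :* (r :* (m :* m))) refl ⟪ v , v ⟫ r M R ⟩
          ⟪ v , v ⟫ - r * (M * M) + (R * r - 1ℚ) * (r * (M * M))
            ≡⟨ cong (λ p → ⟪ v , v ⟫ - r * (M * M) + (p - 1ℚ) * (r * (M * M))) Rr≡1 ⟩
          ⟪ v , v ⟫ - r * (M * M) + 0ℚ * (r * (M * M))
            ≡⟨ trans (cong (λ p → ⟪ v , v ⟫ - r * (M * M) + p) (*-zeroˡ (r * (M * M)))) (+-identityʳ _) ⟩
          ⟪ v , v ⟫ - r * (M * M) ∎)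
          where
          open ≤-Reasoning
          M = ι (suc k)
          t = r * M
          v = ψ k z

      module _ {z} (fz : f z ≡ false) where
        private
          φ = proj₁ (cut fz)
          cut-φ = proj₁ (proj₂ (cut fz))
          flip-φ = proj₁ (proj₂ (proj₂ (cut fz)))
          φ²≤C = proj₂ (proj₂ (proj₂ (cut fz)))
          y = lc 1ℚ e -1ℚ φ

        -- The reflection sends both cuts `e` and `φ` to 2u minus themselves, so it negates their
        -- difference `y`. The flip then changes the sign of `φ`, supported on absent edges, but not
        -- of `e`: the result is -φ - e = y - 2e.
        step-y : step z y ≗ lc 1ℚ y (- 2ℚ) e
        step-y i = begin
          flip z i * ref (lc 1ℚ e -1ℚ φ) i
            ≡⟨ cong (flip z i *_) (R.comb 1ℚ e -1ℚ φ i) ⟩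
          flip z i * (1ℚ * ref e i + -1ℚ * ref φ i)
            ≡⟨ cong₂ (λ p q → flip z i * (1ℚ * p + -1ℚ * q)) (cut-e i) (cut-φ i) ⟩
          flip z i * (1ℚ * (2ℚ * u i + -1ℚ * e i) + -1ℚ * (2ℚ * u i + -1ℚ * φ i))
            ≡⟨ solve 4 (λ a u e p → a :* (con 1ℚ :* (con 2ℚ :* u :+ con -1ℚ :* e) :+ con -1ℚ :* (con 2ℚ :* u :+ con -1ℚ :* p))
                 := a :* p :- a :* e) refl (flip z i) (u i) (e i) (φ i) ⟩
          flip z i * φ i - flip z i * e i
            ≡⟨ cong₂ _-_ (flip-φ i) (flip-e z i) ⟩
          - φ i - e i
            ≡⟨ solve 2 (λ e p → :- p :- e := con 1ℚ :* (con 1ℚ :* e :+ con -1ℚ :* p) :+ :- con 2ℚ :* e) refl (e i) (φ i) ⟩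
          1ℚ * (1ℚ * e i + -1ℚ * φ i) + - 2ℚ * e i ∎
          where open ≡-Reasoning

        -- The partial sums of the orbit of e telescope, as 2e = y - step y.
        telescope : ∀ k → ∃[ v ] lc 1ℚ y (- 2ℚ) (ψ k z) ≗ v × ⟪ v , v ⟫ ≡ ⟪ y , y ⟫
        telescope zero    = step z y , (λ i → sym (step-y i)) , norm-step z y
        telescope (suc k) with telescope k
        ... | v , v≗ , v² = step z v , eq , trans (norm-step z v) v²
          where
          open ≡-Reasoning
          module S = Linear (step-linear z)
          eq : lc 1ℚ y (- 2ℚ) (ψ (suc k) z) ≗ step z v
          eq i = begin
            1ℚ * y i + - 2ℚ * (1ℚ * e i + 1ℚ * step z (ψ k z) i)
              ≡⟨ solve 3 (λ y e p → con 1ℚ :* y :+ :- con 2ℚ :* (con 1ℚ :* e :+ con 1ℚ :* p)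
                   := con 1ℚ :* (con 1ℚ :* y :+ :- con 2ℚ :* e) :+ :- con 2ℚ :* p) refl (y i) (e i) (step z (ψ k z) i) ⟩
            1ℚ * (1ℚ * y i + - 2ℚ * e i) + - 2ℚ * step z (ψ k z) i
              ≡⟨ cong (λ p → 1ℚ * p + - 2ℚ * step z (ψ k z) i) (sym (step-y i)) ⟩
            1ℚ * step z y i + - 2ℚ * step z (ψ k z) i
              ≡⟨ sym (S.comb 1ℚ y (- 2ℚ) (ψ k z) i) ⟩
            step z (lc 1ℚ y (- 2ℚ) (ψ k z)) i
              ≡⟨ S.resp v≗ i ⟩
            step z v i ∎

        -- By `telescope`, y - 2ψ is as long as `y`, which says that ⟪y, ψ⟫ = ⟪ψ, ψ⟫. Hence 0 ≤ ‖y -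
        -- ψ‖² = ‖y‖² - ‖ψ‖², uniformly in the number of steps.
        norm-≤-cut : ∀ k → ⟪ ψ k z , ψ k z ⟫ ≤ 2ℚ + 2ℚ * C
        norm-≤-cut k = ≤-trans (sub-nonNeg⁻¹ (begin
          0ℚ
            ≤⟨ ip-pos (lc 1ℚ y -1ℚ v) ⟩
          ⟪ lc 1ℚ y -1ℚ v , lc 1ℚ y -1ℚ v ⟫
            ≡⟨ norm-comb 1ℚ y -1ℚ v ⟩
          1ℚ * 1ℚ * ⟪ y , y ⟫ + (1ℚ + 1ℚ) * -1ℚ * ⟪ y , v ⟫ + -1ℚ * -1ℚ * ⟪ v , v ⟫
            ≡⟨ solve 3 (λ y x v → con (1ℚ * 1ℚ) :* y :+ con ((1ℚ + 1ℚ) * -1ℚ) :* x :+ con (-1ℚ * -1ℚ) :* v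
                 := con ½ :* (con (1ℚ * 1ℚ) :* y :+ con ((1ℚ + 1ℚ) * - 2ℚ) :* x :+ con (- 2ℚ * - 2ℚ) :* v) :+ con ½ :* y :- v)
                 refl ⟪ y , y ⟫ ⟪ y , v ⟫ ⟪ v , v ⟫ ⟩
          ½ * (1ℚ * 1ℚ * ⟪ y , y ⟫ + (1ℚ + 1ℚ) * - 2ℚ * ⟪ y , v ⟫ + - 2ℚ * - 2ℚ * ⟪ v , v ⟫) + ½ * ⟪ y , y ⟫ - ⟪ v , v ⟫
            ≡⟨ cong (λ p → ½ * p + ½ * ⟪ y , y ⟫ - ⟪ v , v ⟫) (trans (sym (norm-comb 1ℚ y (- 2ℚ) v)) same) ⟩
          ½ * ⟪ y , y ⟫ + ½ * ⟪ y , y ⟫ - ⟪ v , v ⟫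
            ≡⟨ solve 2 (λ y v → con ½ :* y :+ con ½ :* y :- v := y :- v) refl ⟪ y , y ⟫ ⟪ v , v ⟫ ⟩
          ⟪ y , y ⟫ - ⟪ v , v ⟫ ∎)) y²≤
          where
          open ≤-Reasoning
          v = ψ k z
          same : ⟪ lc 1ℚ y (- 2ℚ) v , lc 1ℚ y (- 2ℚ) v ⟫ ≡ ⟪ y , y ⟫
          same = let v′ , v′≗ , v′² = telescope k in trans (ip-resp v′≗ v′≗) v′²
          -- The parallelogram law for `e` and `φ`, with ‖e + φ‖² dropped.
          y²≤ : ⟪ y , y ⟫ ≤ 2ℚ + 2ℚ * C
          y²≤ = begin
            ⟪ y , y ⟫
              ≡⟨ sym (+-identityʳ ⟪ y , y ⟫) ⟩
            ⟪ y , y ⟫ + 0ℚ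
              ≤⟨ +-monoʳ-≤ ⟪ y , y ⟫ (ip-pos (lc 1ℚ e 1ℚ φ)) ⟩
            ⟪ y , y ⟫ + ⟪ lc 1ℚ e 1ℚ φ , lc 1ℚ e 1ℚ φ ⟫
              ≡⟨ cong₂ _+_ (norm-comb 1ℚ e -1ℚ φ) (norm-comb 1ℚ e 1ℚ φ) ⟩
            (1ℚ * 1ℚ * ⟪ e , e ⟫ + (1ℚ + 1ℚ) * -1ℚ * ⟪ e , φ ⟫ + -1ℚ * -1ℚ * ⟪ φ , φ ⟫)
            + (1ℚ * 1ℚ * ⟪ e , e ⟫ + (1ℚ + 1ℚ) * 1ℚ * ⟪ e , φ ⟫ + 1ℚ * 1ℚ * ⟪ φ , φ ⟫)
              ≡⟨ solve 3 (λ e x p → (con (1ℚ * 1ℚ) :* e :+ con ((1ℚ + 1ℚ) * -1ℚ) :* x :+ con (-1ℚ * -1ℚ) :* p)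
                   :+ (con (1ℚ * 1ℚ) :* e :+ con ((1ℚ + 1ℚ) * 1ℚ) :* x :+ con (1ℚ * 1ℚ) :* p)
                   := con 2ℚ :* e :+ con 2ℚ :* p) refl ⟪ e , e ⟫ ⟪ e , φ ⟫ ⟪ φ , φ ⟫ ⟩
            2ℚ * ⟪ e , e ⟫ + 2ℚ * ⟪ φ , φ ⟫
              ≤⟨ +-mono-≤ (≤-reflexive (cong (2ℚ *_) norm-e)) (*-monoˡ (from-yes (0ℚ ≤? 2ℚ)) φ²≤C) ⟩
            2ℚ + 2ℚ * C ∎

      ip-small : ∀ {v w} → ⟪ v , v ⟫ ≤ 1ℚ → ⟪ w , w ⟫ ≤ 1ℚ → ∣ ⟪ v , w ⟫ ∣ ≤ 1ℚ
      ip-small {v} {w} v² w² = ∣p∣≤ {⟪ v , w ⟫} (am-gm -1ℚ refl (solve 1 (λ x → con -1ℚ :* x := :- x) refl ⟪ v , w ⟫))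
          (am-gm 1ℚ refl (solve 1 (λ x → con 1ℚ :* x := :- (:- x)) refl ⟪ v , w ⟫))
        where
        open ≤-Reasoning
        am-gm : ∀ c {x} → c * c ≡ 1ℚ → c * ⟪ v , w ⟫ ≡ - x → x ≤ 1ℚ
        am-gm c {x} c²≡1 eq = sub-nonNeg⁻¹ (begin
          0ℚ
            ≤⟨ *-monoˡ (from-yes (0ℚ ≤? ½)) (ip-pos (lc 1ℚ v c w)) ⟩
          ½ * ⟪ lc 1ℚ v c w , lc 1ℚ v c w ⟫
            ≡⟨ cong (½ *_) (norm-comb 1ℚ v c w) ⟩
          ½ * (1ℚ * 1ℚ * ⟪ v , v ⟫ + (1ℚ + 1ℚ) * c * ⟪ v , w ⟫ + c * c * ⟪ w , w ⟫)
            ≡⟨ cong₂ (λ p q → ½ * (1ℚ * 1ℚ * ⟪ v , v ⟫ + p + q * ⟪ w , w ⟫)) (trans (*-assoc (1ℚ + 1ℚ) c ⟪ v , w ⟫) (cong ((1ℚ + 1ℚ) *_) eq)) c²≡1 ⟩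
          ½ * (1ℚ * 1ℚ * ⟪ v , v ⟫ + (1ℚ + 1ℚ) * - x + 1ℚ * ⟪ w , w ⟫)
            ≤⟨ *-monoˡ (from-yes (0ℚ ≤? ½)) (+-mono-≤ (+-monoˡ-≤ ((1ℚ + 1ℚ) * - x) (*-monoˡ (from-yes (0ℚ ≤? 1ℚ * 1ℚ)) v²)) (*-monoˡ (from-yes (0ℚ ≤? 1ℚ)) w²)) ⟩
          ½ * (1ℚ * 1ℚ * 1ℚ + (1ℚ + 1ℚ) * - x + 1ℚ * 1ℚ)
            ≡⟨ solve 1 (λ x → con ½ :* (con (1ℚ * 1ℚ * 1ℚ) :+ con (1ℚ + 1ℚ) :* :- x :+ con (1ℚ * 1ℚ)) := con 1ℚ :- x) refl x ⟩
          1ℚ - x ∎)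

      -- Both arguments of the inner product are expanded by `ψ-terms`. The coefficients are c⟪v, w⟫
      -- with `v` and `w` in the unit ball, hence at most 1 in absolute value by `ip-small`.
      norm-poly : ∀ k {c} → 0ℚ ≤ c → c ≤ 1ℚ →
        Poly (k ℕ.+ k) (suc T ℕ.^ k ℕ.* suc T ℕ.^ k) (λ z → c * ⟪ ψ k z , ψ k z ⟫)
      norm-poly k {c} 0≤c c≤1 = bind {L = λ z v _ → c * ⟪ v , ψ k z ⟫}
        (λ z → record
          { resp = λ v≗ _ → cong (c *_) (ip-resp v≗ (λ _ → refl))
          ; comb = λ a v b w _ → trans (cong (c *_) (ip-comb a v b w (ψ k z))) (pull a b ⟪ v , ψ k z ⟫ ⟪ w , ψ k z ⟫)
          })
        (λ v v²≤1 → map-terms {L = λ w _ → c * ⟪ v , w ⟫}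
          (record
            { resp = λ w≗ _ → cong (c *_) (ip-resp (λ _ → refl) w≗)
            ; comb = λ a w b x _ → trans (cong (c *_) (ip-combʳ v a w b x)) (pull a b ⟪ v , w ⟫ ⟪ v , x ⟫)
            })
          (λ w w²≤1 → subst (_≤ 1ℚ) (sym (∣p*q∣≡∣p∣*∣q∣ c ⟪ v , w ⟫))
            (≤-trans (*-monoˡ (0≤∣p∣ c) (ip-small v²≤1 w²≤1))
              (subst (_≤ 1ℚ) (sym (trans (*-identityʳ ∣ c ∣) (0≤p⇒∣p∣≡p 0≤c))) c≤1)))
          (ψ-terms k))
        (ψ-terms k)
        where
        pull : ∀ a b p q → c * (a * p + b * q) ≡ a * (c * p) + b * (c * q)
        pull = solve 5 (λ c a b p q → c :* (a :* p :+ b :* q) := a :* (c :* p) :+ b :* (c :* q)) refl c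

    -- Duality turns the bounds (n, 1) into (1, n); multiplying the resistances by n gives (n, 1)
    -- again.
    negate : ∀ {f T} n → 0 ℕ.< n → Network f (ι n) 1ℚ T → Network (λ z → not (f z)) (ι n) 1ℚ T
    negate n 0<n N =
      let g , g>0 , ng≡1 = recip (ι n) (ι-pos 0<n) in
      relax (λ _ → refl) (≤-reflexive (*-identityʳ (ι n))) (≤-reflexive (trans (*-comm g (ι n)) ng≡1)) ℕ.≤-refl
        (rescale (ι-pos 0<n) g>0 ng≡1 (dual N))

    conjoin : ∀ {f g T U} m n → Network f (ι m) 1ℚ T → Network g (ι n) 1ℚ U →
      Network (λ z → f z ∧ g z) (ι (m ℕ.+ n)) 1ℚ (T ℕ.+ U)
    conjoin m n N₁ N₂ = relax (λ _ → refl) (≤-reflexive (sym (ι-+ m n))) ≤-refl ℕ.≤-refl (Series.series N₁ N₂)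

    module _ (literal : ∀ i → Poly 1 3 (λ z → sign (z i))) where

      formulaNetwork : ∀ F → Network (eval F) (ι (size F)) 1ℚ (3 ℕ.* size F)
      formulaNetwork (leaf i)  = edge (λ z → z i) (literal i)
      formulaNetwork (NOT F)   = negate (size F) (size-pos F) (formulaNetwork F)
      formulaNetwork (AND F G) = relax (λ _ → refl) ≤-refl ≤-refl (ℕ.≤-reflexive (sym (ℕ.*-distribˡ-+ 3 (size F) (size G))))
        (conjoin (size F) (size G) (formulaNetwork F) (formulaNetwork G))
      formulaNetwork (OR F G)  = relax (λ z → deMorgan (eval F z) (eval G z)) ≤-refl ≤-refl
        (ℕ.≤-reflexive (sym (ℕ.*-distribˡ-+ 3 (size F) (size G))))
        (negate (size (OR F G)) (size-pos (OR F G)) (conjoin (size F) (size G) (negate (size F) (size-pos F) (formulaNetwork F)) (negate (size G) (size-pos G) (formulaNetwork G))))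
        where
        deMorgan : ∀ a b → not (not a ∧ not b) ≡ a ∨ b
        deMorgan true  _ = refl
        deMorgan false b = not-involutive b

      -- The average of M = k + 1 steps of the walk, started on an extra edge that is
      -- always present and closes the circuit.
      crude-approximation : ∀ F k → 16 ℕ.+ 112 ℕ.* size F ℕ.≤ suc k ℕ.* suc k →
        let W = (2 ℕ.+ 3 ℕ.* size F) ℕ.^ k in
        ∃[ p ] Poly (k ℕ.+ k) (W ℕ.* W) p ×
          (∀ z → 0ℚ ≤ p z) × (∀ z → p z ≤ 1ℚ) ×
          (∀ z → eval F z ≡ true → 7/8 ≤ p z) × (∀ z → eval F z ≡ false → p z ≤ 1/8)
      crude-approximation F k bound =
          (λ z → c * ⟪ ψ k z , ψ k z ⟫)
        , norm-poly k 0≤c c≤1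
        , (λ z → *-nonNeg 0≤c (ip-pos (ψ k z)))
        , (λ z → subst (c * ⟪ ψ k z , ψ k z ⟫ ≤_) cM²≡1 (*-monoˡ 0≤c (norm-≤ k z)))
        , (λ z Fz → begin
            7/8                            ≡⟨ sym (*-identityʳ 7/8) ⟩
            7/8 * 1ℚ                       ≡⟨ cong (7/8 *_) (sym cM²≡1) ⟩
            7/8 * (c * (M * M))            ≡⟨ solve 3 (λ a b c → a :* (b :* c) := b :* (a :* c)) refl 7/8 c (M * M) ⟩
            c * (7/8 * (M * M))            ≤⟨ *-monoˡ 0≤c (norm-≥ Fz refl k) ⟩
            c * ⟪ ψ k z , ψ k z ⟫          ∎)
        , (λ z Fz → begin
            c * ⟪ ψ k z , ψ k z ⟫          ≤⟨ *-monoˡ 0≤c (norm-≤-cut Fz k) ⟩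
            c * (2ℚ + 2ℚ * κ)              ≡⟨ solve 2 (λ c κ → c :* (con 2ℚ :+ con 2ℚ :* κ) := con 1/8 :* (c :* (con (ι 16) :+ con (ι 16) :* κ))) refl c κ ⟩
            1/8 * (c * (ι 16 + ι 16 * κ))  ≤⟨ *-monoˡ (from-yes (0ℚ ≤? 1/8)) (*-monoˡ 0≤c 16+16κ≤M²) ⟩
            1/8 * (c * (M * M))            ≡⟨ cong (1/8 *_) cM²≡1 ⟩
            1/8 * 1ℚ                       ≡⟨ *-identityʳ 1/8 ⟩
            1/8                            ∎)
        where
        open ≤-Reasoning
        n = size F
        n>0 = ι-pos (size-pos F)
        M = ι (suc k)
        M>0 : 0ℚ < M
        M>0 = ι-pos {suc k} (s≤s z≤n)
        q = proj₁ (recip M M>0)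
        q>0 = proj₁ (proj₂ (recip M M>0))
        Mq≡1 = proj₂ (proj₂ (recip M M>0))
        c = q * q
        0≤c : 0ℚ ≤ c
        0≤c = square-nonNeg q
        c≤1 : c ≤ 1ℚ
        c≤1 = ≤-trans (*-monoˡ (<⇒≤ q>0) q≤1) (subst (_≤ 1ℚ) (sym (*-identityʳ q)) q≤1)
          where
          q≤1 : q ≤ 1ℚ
          q≤1 = recip≤1 {M} q>0 Mq≡1 (ι-mono {1} {suc k} (s≤s z≤n))
        cM²≡1 : c * (M * M) ≡ 1ℚ
        cM²≡1 = trans (solve 2 (λ q m → q :* q :* (m :* m) := m :* q :* (m :* q)) refl q M) (cong₂ _*_ Mq≡1 Mq≡1)
        -- The 7 balances the two errors. The load gets resistance n/κ = 1/7, so the circuit has 8/7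
        -- and the average has squared norm at least 7/8. The cut case gives 2 + 2κ = 2 + 14n, and 8
        -- times this is the 16 + 112n required of M².
        κ = ι 7 * ι n
        κ>0 : 0ℚ < κ
        κ>0 = *-pos (positive⁻¹ (ι 7)) n>0
        λ₀ = proj₁ (recip κ κ>0)
        λ₀>0 = proj₁ (proj₂ (recip κ κ>0))
        κλ₀≡1 = proj₂ (proj₂ (recip κ κ>0))
        16+16κ≤M² : ι 16 + ι 16 * κ ≤ M * M
        16+16κ≤M² = subst₂ _≤_ (trans (ι-+ 16 (112 ℕ.* n)) (cong (λ p → ι 16 + p) (trans (ι-* 112 n) (*-assoc (ι 16) (ι 7) (ι n)))))
          (ι-* (suc k) (suc k)) (ι-mono bound)
        1≤κ : 1ℚ ≤ κ
        1≤κ = subst (1ℚ ≤_) (ι-* 7 n) (ι-mono {1} (ℕ.≤-trans (size-pos F) (ℕ.m≤n*m n 7)))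
        resistance : 1ℚ + λ₀ * ι n ≤ 8/7
        resistance = ≤-reflexive (cong (1ℚ +_) (trans
          (solve 2 (λ l n → l :* n := con 1/7 :* (con (ι 7) :* n :* l)) refl λ₀ (ι n)) (cong (1/7 *_) κλ₀≡1)))
        -- The cut bound of this edge is relaxed to `κ` because `Series` takes the same cut bound on
        -- both sides.
        source : Network (λ _ → true) 1ℚ κ 1
        source = relax (λ _ → refl) ≤-refl 1≤κ ℕ.≤-refl (edge (λ _ → true) (term [] (λ _ → 1ℚ) z≤n ≤-refl (λ _ _ → refl)))
        load : Network (eval F) (λ₀ * ι n) κ (3 ℕ.* n)
        load = relax (λ _ → refl) ≤-refl (≤-reflexive (*-identityʳ κ)) ℕ.≤-refl
          (rescale λ₀>0 κ>0 (trans (*-comm λ₀ κ) κλ₀≡1) (formulaNetwork F))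
        module S = Series source load
        circuit : Network (eval F) 8/7 κ (suc (3 ℕ.* n))
        circuit = relax (λ _ → refl) resistance ≤-refl ℕ.≤-refl S.series
        open Network circuit
        e : Vector Edge
        e = S.inˡ (λ _ → 1ℚ)
        flip-e : ∀ z → flip z ⊙ e ≗ e
        flip-e z (inj₁ _) = refl
        flip-e z (inj₂ i) = *-zeroʳ (Network.flip load z i)
        open Walk circuit e (S.cutˡ (λ _ → refl)) flip-e (S.norm-inˡ (λ _ → 1ℚ))

  -- Amplification by repeated tosses.

  ¼ : ℚ
  ¼ = ℤ.+ 1 ℚ./ 4

  ^ℚ-nonNeg : ∀ {p} → 0ℚ ≤ p → ∀ n → 0ℚ ≤ p ^ℚ n
  ^ℚ-nonNeg 0≤p zero    = from-yes (0ℚ ≤? 1ℚ)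
  ^ℚ-nonNeg 0≤p (suc n) = *-nonNeg 0≤p (^ℚ-nonNeg 0≤p n)

  -- The probability that a coin of bias p shows heads a times before it shows tails b times.
  race : ℕ → ℕ → ℚ → ℚ
  race zero    b       p = 1ℚ
  race (suc a) zero    p = 0ℚ
  race (suc a) (suc b) p = p * race a (suc b) p + (1ℚ - p) * race (suc a) b p

  race-nonNeg : ∀ a b {p} → 0ℚ ≤ p → p ≤ 1ℚ → 0ℚ ≤ race a b p
  race-nonNeg zero    b       0≤p p≤1 = from-yes (0ℚ ≤? 1ℚ)
  race-nonNeg (suc a) zero    0≤p p≤1 = ≤-refl
  race-nonNeg (suc a) (suc b) 0≤p p≤1 = +-nonNeg (*-nonNeg 0≤p (race-nonNeg a (suc b) 0≤p p≤1))
    (*-nonNeg (sub-nonNeg p≤1) (race-nonNeg (suc a) b 0≤p p≤1))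

  -- Heads and tails exchange their roles. The positive total excludes a = b = 0, where both races
  -- would count as won.
  race-dual : ∀ a b p → 0 ℕ.< a ℕ.+ b → 1ℚ - race a b p ≡ race b a (1ℚ - p)
  race-dual zero    (suc b) p _ = refl
  race-dual (suc a) zero    p _ = refl
  race-dual (suc a) (suc b) p _ = begin
    1ℚ - (p * x + (1ℚ - p) * y)
      ≡⟨ solve 3 (λ p x y → con 1ℚ :- (p :* x :+ (con 1ℚ :- p) :* y)
           := (con 1ℚ :- p) :* (con 1ℚ :- y) :+ (con 1ℚ :- (con 1ℚ :- p)) :* (con 1ℚ :- x)) refl p x y ⟩
    (1ℚ - p) * (1ℚ - y) + (1ℚ - (1ℚ - p)) * (1ℚ - x)
      ≡⟨ cong₂ (λ s t → (1ℚ - p) * s + (1ℚ - (1ℚ - p)) * t) (race-dual (suc a) b p (s≤s z≤n))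
           (race-dual a (suc b) p (ℕ.<-≤-trans (s≤s z≤n) (ℕ.m≤n+m (suc b) a))) ⟩
    race (suc b) (suc a) (1ℚ - p) ∎
    where
    open ≡-Reasoning
    x = race a (suc b) p
    y = race (suc a) b p

  -- The bound is a supermartingale: heads multiplies it by 4 and tails by ½, and 4p + (1 - p)/2 = ½
  -- + 7p/2 is at most 15/16 for p ≤ 1/8.
  race-≤ : ∀ a b {p} → 0ℚ ≤ p → p ≤ 1/8 → race a b p ≤ ¼ ^ℚ a * 2ℚ ^ℚ b
  race-≤ zero b 0≤p p≤ = subst (1ℚ ≤_) (sym (*-identityˡ (2ℚ ^ℚ b))) (1≤2^ b)
    where
    1≤2^ : ∀ b → 1ℚ ≤ 2ℚ ^ℚ b
    1≤2^ zero    = ≤-refl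
    1≤2^ (suc b) = ≤-trans (from-yes (1ℚ ≤? 2ℚ * 1ℚ)) (*-monoˡ (from-yes (0ℚ ≤? 2ℚ)) (1≤2^ b))
  race-≤ (suc a) zero 0≤p p≤ = *-nonNeg (^ℚ-nonNeg (from-yes (0ℚ ≤? ¼)) (suc a)) (from-yes (0ℚ ≤? 1ℚ))
  race-≤ (suc a) (suc b) {p} 0≤p p≤ = begin
    p * race a (suc b) p + (1ℚ - p) * race (suc a) b p
      ≤⟨ +-mono-≤ (*-monoˡ 0≤p (race-≤ a (suc b) 0≤p p≤))
           (*-monoˡ (sub-nonNeg (≤-trans p≤ (from-yes (1/8 ≤? 1ℚ)))) (race-≤ (suc a) b 0≤p p≤)) ⟩
    p * (x * (2ℚ * y)) + (1ℚ - p) * (¼ * x * y)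
      ≡⟨ solve 3 (λ p x y → p :* (x :* (con 2ℚ :* y)) :+ (con 1ℚ :- p) :* (con ¼ :* x :* y)
           := (con (ℤ.+ 1 ℚ./ 2) :+ con (ℤ.+ 7 ℚ./ 2) :* p) :* (con ¼ :* x :* (con 2ℚ :* y))) refl p x y ⟩
    (½ + ℤ.+ 7 ℚ./ 2 * p) * t
      ≡⟨ *-comm (½ + ℤ.+ 7 ℚ./ 2 * p) t ⟩
    t * (½ + ℤ.+ 7 ℚ./ 2 * p)
      ≤⟨ *-monoˡ (*-nonNeg (*-nonNeg (from-yes (0ℚ ≤? ¼)) (^ℚ-nonNeg (from-yes (0ℚ ≤? ¼)) a))
           (^ℚ-nonNeg (from-yes (0ℚ ≤? 2ℚ)) (suc b)))
           (≤-trans (+-monoʳ-≤ ½ (*-monoˡ (from-yes (0ℚ ≤? ℤ.+ 7 ℚ./ 2)) p≤)) (from-yes (½ + ℤ.+ 7 ℚ./ 2 * 1/8 ≤? 1ℚ))) ⟩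
    t * 1ℚ
      ≡⟨ *-identityʳ t ⟩
    t ∎
    where
    open ≤-Reasoning
    x = ¼ ^ℚ a
    y = 2ℚ ^ℚ b
    t = ¼ * x * (2ℚ * y)

  ¼^*2^ : ∀ m → ¼ ^ℚ m * 2ℚ ^ℚ m ≡ ½ ^ℚ m
  ¼^*2^ zero    = refl
  ¼^*2^ (suc m) = trans (solve 2 (λ x y → con ¼ :* x :* (con 2ℚ :* y) := con ½ :* (x :* y)) refl (¼ ^ℚ m) (2ℚ ^ℚ m))
    (cong (½ *_) (¼^*2^ m))

  race-low : ∀ m {p} → 0ℚ ≤ p → p ≤ 1/8 → race m m p ≤ ½ ^ℚ m
  race-low m {p} 0≤p p≤ = subst (race m m p ≤_) (¼^*2^ m) (race-≤ m m 0≤p p≤)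

  indicator : Bool → ℚ
  indicator b = if b then 1ℚ else 0ℚ

  race-close : ∀ b m {p} → 0 ℕ.< m → 0ℚ ≤ p → p ≤ 1ℚ → (b ≡ true → 7/8 ≤ p) → (b ≡ false → p ≤ 1/8) →
    ∣ indicator b - race m m p ∣ ≤ ½ ^ℚ m
  race-close false m {p} 0<m 0≤p p≤1 high low = subst (_≤ ½ ^ℚ m)
    (sym (trans (cong ∣_∣ (+-identityˡ (- race m m p))) (trans (∣-p∣≡∣p∣ (race m m p))
      (0≤p⇒∣p∣≡p (race-nonNeg m m 0≤p p≤1)))))
    (race-low m 0≤p (low refl))
  race-close true m {p} 0<m 0≤p p≤1 high low = subst (_≤ ½ ^ℚ m)
    (sym (trans (cong ∣_∣ (race-dual m m p (ℕ.<-≤-trans 0<m (ℕ.m≤m+n m m))))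
      (0≤p⇒∣p∣≡p (race-nonNeg m m 0≤1-p (≤-trans 1-p≤ (from-yes (1/8 ≤? 1ℚ)))))))
    (race-low m 0≤1-p 1-p≤)
    where
    0≤1-p : 0ℚ ≤ 1ℚ - p
    0≤1-p = sub-nonNeg p≤1
    1-p≤ : 1ℚ - p ≤ 1/8
    1-p≤ = ≤-trans (+-monoʳ-≤ 1ℚ (neg-antimono-≤ (high refl))) (from-yes (1ℚ - 7/8 ≤? 1/8))

  module Amplification {s : ℕ} (χ : Bool → ℚ) where
    open FormulaNetworks {s} χ
    open Networks {s} χ

    poly-const : ∀ {d k} c → ∣ c ∣ ≤ 1ℚ → Poly d (suc k) (λ _ → c)
    poly-const c c≤1 = term [] (λ _ → c) z≤n c≤1 (λ _ _ → sym (*-identityˡ c))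

    poly-+ : ∀ {d k l f g} → Poly d k f → Poly d l g → Poly d (k ℕ.+ l) (λ z → f z + g z)
    poly-+ f g = sum f g ℕ.≤-refl (λ _ _ → refl)

    poly-* : ∀ {d k d′ l f g} → Poly d k f → Poly d′ l g → Poly (d ℕ.+ d′) (k ℕ.* l) (λ z → f z * g z)
    poly-* {g = g} f-poly g-poly = bind {L = λ z v i → v i * g z}
      (λ z → record
        { resp = λ v≗ i → cong (_* g z) (v≗ i)
        ; comb = λ a v b w i → solve 5 (λ a v b w g → (a :* v :+ b :* w) :* g := a :* (v :* g) :+ b :* (w :* g))
                   refl a (v i) b (w i) (g z)
        })
      (λ v v≤1 → map-terms (⊙-linear v) (λ w w≤1 → subst (_≤ 1ℚ) (sym (∣p*q∣≡∣p∣*∣q∣ (v tt) (w tt)))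
        (≤-trans (*-monoˡ (0≤∣p∣ (v tt)) w≤1) (subst (_≤ 1ℚ) (sym (*-identityʳ ∣ v tt ∣)) v≤1))) g-poly)
      f-poly

    poly-1- : ∀ {d k f} → Poly d k f → Poly d (suc k) (λ z → 1ℚ - f z)
    poly-1- {f = f} f-poly = sum (poly-const {k = 0} 1ℚ ≤-refl)
      (map-terms {L = λ v i → -1ℚ * v i} (⊙-linear (λ _ → -1ℚ))
        (λ v v≤1 → subst (_≤ 1ℚ) (sym (trans (∣p*q∣≡∣p∣*∣q∣ -1ℚ (v tt)) (*-identityˡ ∣ v tt ∣))) v≤1) f-poly)
      ℕ.≤-refl
      (λ z _ → cong (λ x → 1ℚ + x) (solve 1 (λ x → :- x := con -1ℚ :* x) refl (f z)))

    -- A toss contributes the `k` terms of p and the `k` + 1 terms of 1 - p, hence the base 1 + 2k.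
    -- The recursion multiplies out without binomial coefficients, so all coefficients stay at most
    -- 1 in absolute value.
    poly-race : ∀ {d k p} a b → Poly d k p → Poly (d ℕ.* (a ℕ.+ b)) ((1 ℕ.+ 2 ℕ.* k) ℕ.^ (a ℕ.+ b)) (λ z → race a b (p z))
    poly-race {d} {k} zero b p-poly = weaken {d = 0} z≤n (ℕ.m^n>0 (1 ℕ.+ 2 ℕ.* k) b) (poly-const 1ℚ ≤-refl)
    poly-race {d} {k} (suc a) zero p-poly = weaken {d = 0} z≤n (ℕ.m^n>0 (1 ℕ.+ 2 ℕ.* k) (suc a ℕ.+ 0)) (poly-const 0ℚ (from-yes (0ℚ ≤? 1ℚ)))
    poly-race {d} {k} (suc a) (suc b) p-poly = weaken (ℕ.≤-reflexive (sym (ℕ.*-suc d (a ℕ.+ suc b)))) total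
      (poly-+ (poly-* p-poly (poly-race a (suc b) p-poly))
        (weaken (ℕ.≤-reflexive (cong (λ n → d ℕ.+ d ℕ.* n) (sym (ℕ.+-suc a b)))) ℕ.≤-refl
          (poly-* (poly-1- p-poly) (poly-race (suc a) b p-poly))))
      where
      open ℕ.≤-Reasoning
      X = (1 ℕ.+ 2 ℕ.* k) ℕ.^ (a ℕ.+ suc b)
      total : k ℕ.* X ℕ.+ suc k ℕ.* (1 ℕ.+ 2 ℕ.* k) ℕ.^ (suc a ℕ.+ b) ℕ.≤ (1 ℕ.+ 2 ℕ.* k) ℕ.* X
      total = begin
        k ℕ.* X ℕ.+ suc k ℕ.* (1 ℕ.+ 2 ℕ.* k) ℕ.^ (suc a ℕ.+ b)
          ≡⟨ cong (λ n → k ℕ.* X ℕ.+ suc k ℕ.* (1 ℕ.+ 2 ℕ.* k) ℕ.^ n) (sym (ℕ.+-suc a b)) ⟩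
        k ℕ.* X ℕ.+ suc k ℕ.* X
          ≡⟨ sym (ℕ.*-distribʳ-+ X k (suc k)) ⟩
        (k ℕ.+ suc k) ℕ.* X
          ≡⟨ cong (ℕ._* X) (trans (ℕ.+-suc k k) (cong (λ n → suc (k ℕ.+ n)) (sym (ℕ.+-identityʳ k)))) ⟩
        (1 ℕ.+ 2 ℕ.* k) ℕ.* X ∎

    approximation : (∀ i → Poly 1 3 (λ z → sign (z i))) → ∀ F k m → 0 ℕ.< m →
      16 ℕ.+ 112 ℕ.* size F ℕ.≤ suc k ℕ.* suc k →
      let W = (2 ℕ.+ 3 ℕ.* size F) ℕ.^ k in
      ∃[ p ] Poly ((k ℕ.+ k) ℕ.* (m ℕ.+ m)) ((1 ℕ.+ 2 ℕ.* (W ℕ.* W)) ℕ.^ (m ℕ.+ m)) p ×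
        (∀ z → ∣ indicator (eval F z) - p z ∣ ≤ ½ ^ℚ m)
    approximation literal F k m 0<m bound =
      let p , p-poly , 0≤p , p≤1 , high , low = crude-approximation literal F k bound
      in (λ z → race m m (p z)) , poly-race m m p-poly
        , λ z → race-close (eval F z) m 0<m (0≤p z) (p≤1 z) (high z) (low z)

open Approximation
open import Defs

-- Order and arithmetic of the reals.

Eventually : (ℕ → Set) → Set
Eventually P = ∃[ N ] ∀ n → N ≤ℕ n → P n

eventually₂ : ∀ {P Q R : ℕ → Set} → (∀ n → P n → Q n → R n) → Eventually P → Eventually Q → Eventually R
eventually₂ h (M , p) (N , q) = M ℕ.⊔ N , λ n ≤n → h n (p n (ℕ.m⊔n≤o⇒m≤o M N ≤n)) (q n (ℕ.m⊔n≤o⇒n≤o M N ≤n))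

eventually₁ : ∀ {P Q : ℕ → Set} → (∀ n → P n → Q n) → Eventually P → Eventually Q
eventually₁ h (N , p) = N , λ n ≤n → h n (p n ≤n)

≤-seq : ∀ {x y} → (∀ n → seq x n ≡ seq y n) → x ≤ y
≤-seq {x} {y} eq = ≤-pointwise {x} {y} (λ n → ℚ.≤-reflexive (eq n))

≤-trans : ∀ {x y z} → x ≤ y → y ≤ z → x ≤ z
≤-trans {x} {y} {z} x≤y y≤z e e>0 = eventually₂ (λ n p q → begin
    seq x n                                    ≤⟨ p ⟩
    seq y n ℚ.+ ½ ℚ.* e                        ≤⟨ ℚ.+-monoˡ-≤ (½ ℚ.* e) q ⟩
    seq z n ℚ.+ ½ ℚ.* e ℚ.+ ½ ℚ.* e            ≡⟨ solve 2 (λ z e → z :+ con ½ :* e :+ con ½ :* e := z :+ e) refl (seq z n) e ⟩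
    seq z n ℚ.+ e                              ∎)
  (x≤y (½ ℚ.* e) (half-pos e e>0)) (y≤z (½ ℚ.* e) (half-pos e e>0))
  where open ℚ.≤-Reasoning

+-mono-≤ : ∀ {x y x′ y′} → x ≤ y → x′ ≤ y′ → x + x′ ≤ y + y′
+-mono-≤ {x} {y} {x′} {y′} x≤y x′≤y′ e e>0 = eventually₂ (λ n p q → begin
    seq x n ℚ.+ seq x′ n                                   ≤⟨ ℚ.+-mono-≤ p q ⟩
    (seq y n ℚ.+ ½ ℚ.* e) ℚ.+ (seq y′ n ℚ.+ ½ ℚ.* e)       ≡⟨ solve 3 (λ y y′ e → (y :+ con ½ :* e) :+ (y′ :+ con ½ :* e) := y :+ y′ :+ e) refl (seq y n) (seq y′ n) e ⟩
    seq y n ℚ.+ seq y′ n ℚ.+ e                             ∎)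
  (x≤y (½ ℚ.* e) (half-pos e e>0)) (x′≤y′ (½ ℚ.* e) (half-pos e e>0))
  where open ℚ.≤-Reasoning

∣∣-≤ : ∀ {x y} → x ≤ y → - x ≤ y → ∣ x ∣ ≤ y
∣∣-≤ x≤y -x≤y e e>0 = eventually₂ (λ n p q → ∣p∣≤ p q) (x≤y e e>0) (-x≤y e e>0)

*-monoˡ-≤ : ∀ {c x y} → 0ℚ ℚ.≤ c → x ≤ y → fromℚ c * x ≤ fromℚ c * y
*-monoˡ-≤ {c} {x} {y} 0≤c x≤y e e>0 =
  -- As `c` may be zero, the precision is chosen relative to c + 1.
  let c+1>0 = ℚ.+-mono-≤-< 0≤c (ℚ.positive⁻¹ 1ℚ)
      d , d>0 , cd≡e = shrink (c ℚ.+ 1ℚ) e c+1>0 e>0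
  in eventually₁ (λ n p → begin
    c ℚ.* seq x n                                  ≤⟨ *-monoˡ 0≤c p ⟩
    c ℚ.* (seq y n ℚ.+ d)                          ≡⟨ sym (ℚ.+-identityʳ (c ℚ.* (seq y n ℚ.+ d))) ⟩
    c ℚ.* (seq y n ℚ.+ d) ℚ.+ 0ℚ                   ≤⟨ ℚ.+-monoʳ-≤ (c ℚ.* (seq y n ℚ.+ d)) (ℚ.<⇒≤ d>0) ⟩
    c ℚ.* (seq y n ℚ.+ d) ℚ.+ d                    ≡⟨ solve 3 (λ c y d → c :* (y :+ d) :+ d := c :* y :+ (c :+ con 1ℚ) :* d) refl c (seq y n) d ⟩
    c ℚ.* seq y n ℚ.+ (c ℚ.+ 1ℚ) ℚ.* d             ≡⟨ cong (λ t → c ℚ.* seq y n ℚ.+ t) cd≡e ⟩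
    c ℚ.* seq y n ℚ.+ e                            ∎)
    (x≤y d d>0)
  where open ℚ.≤-Reasoning

fromℚ-mono : ∀ {p q} → p ℚ.≤ q → fromℚ p ≤ fromℚ q
fromℚ-mono {p} {q} p≤q = ≤-pointwise {fromℚ p} {fromℚ q} (λ _ → p≤q)

fromℚ-reflects-≤ : ∀ {p q} → fromℚ p ≤ fromℚ q → p ℚ.≤ q
fromℚ-reflects-≤ {p} {q} p≤q = ℚ.≮⇒≥ λ q<p →
  let e>0 = half-pos (p ℚ.- q) (subst (ℚ._< p ℚ.- q) (ℚ.+-inverseʳ q) (ℚ.+-monoˡ-< (ℚ.- q) q<p))
      N , h = p≤q (½ ℚ.* (p ℚ.- q)) e>0
      ½p≤½q = subst₂ ℚ._≤_
        (solve 2 (λ p q → p :- con ½ :* (p :+ q) := con ½ :* (p :- q)) refl p q)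
        (solve 2 (λ p q → (q :+ con ½ :* (p :- q)) :- con ½ :* (p :+ q) := con 0ℚ) refl p q)
        (ℚ.+-monoˡ-≤ (ℚ.- (½ ℚ.* (p ℚ.+ q))) (h N ℕ.≤-refl))
  in ℚ.<-irrefl refl (ℚ.<-≤-trans e>0 ½p≤½q)

*-monoʳ-≤ : ∀ {x p q} → 0ℝ ≤ x → p ℚ.≤ q → x * fromℚ p ≤ x * fromℚ q
*-monoʳ-≤ {x} {p} {q} 0≤x p≤q =
  ≤-trans {x * fromℚ p} {x * fromℚ p + fromℚ (q ℚ.- p) * 0ℝ} {x * fromℚ q}
    (≤-seq {x * fromℚ p} {x * fromℚ p + fromℚ (q ℚ.- p) * 0ℝ} (λ n → solve 3 (λ x p q → x :* p := x :* p :+ (q :- p) :* con 0ℚ) refl (seq x n) p q))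
    (≤-trans {x * fromℚ p + fromℚ (q ℚ.- p) * 0ℝ} {x * fromℚ p + fromℚ (q ℚ.- p) * x} {x * fromℚ q}
      (+-mono-≤ {x * fromℚ p} {x * fromℚ p} {fromℚ (q ℚ.- p) * 0ℝ} {fromℚ (q ℚ.- p) * x}
        (≤-seq {x * fromℚ p} {x * fromℚ p} (λ _ → refl)) (*-monoˡ-≤ {q ℚ.- p} {0ℝ} {x} (sub-nonNeg p≤q) 0≤x))
      (≤-seq {x * fromℚ p + fromℚ (q ℚ.- p) * x} {x * fromℚ q} (λ n → solve 3 (λ x p q → x :* p :+ (q :- p) :* x := x :* q) refl (seq x n) p q)))

-- If x ≥ a - d and y ≥ b - d, the product loses at most (a + b) d against ab. Taking `d` below `a`
-- and `b` as well keeps a - d and b - d nonnegative, so that all products in the expansion are.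
*-mono-lower : ∀ {a b x y} → 0ℚ ℚ.< a → 0ℚ ℚ.< b → fromℚ a ≤ x → fromℚ b ≤ y → fromℚ (a ℚ.* b) ≤ x * y
*-mono-lower {a} {b} {x} {y} a>0 b>0 a≤x b≤y e e>0 =
  let d′ , d′>0 , eq = shrink (a ℚ.+ b) e (+-pos a>0 b>0) e>0
      d = d′ ℚ.⊓ (a ℚ.⊓ b)
      d>0 = ⊓-pos d′>0 (⊓-pos a>0 b>0)
      0≤a-d = sub-nonNeg (ℚ.≤-trans (ℚ.p⊓q≤q d′ (a ℚ.⊓ b)) (ℚ.p⊓q≤p a b))
      0≤b-d = sub-nonNeg (ℚ.≤-trans (ℚ.p⊓q≤q d′ (a ℚ.⊓ b)) (ℚ.p⊓q≤q a b))
  in eventually₂ (λ n p q → sub-nonNeg⁻¹ (begin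
    0ℚ
      ≤⟨ +-nonNeg (+-nonNeg (*-nonNeg 0≤a-d (sub-nonNeg q)) (*-nonNeg 0≤b-d (sub-nonNeg p)))
           (+-nonNeg (*-nonNeg (sub-nonNeg p) (sub-nonNeg q)) (+-nonNeg (square-nonNeg d)
             (*-nonNeg (ℚ.<⇒≤ (+-pos a>0 b>0)) (sub-nonNeg (ℚ.p⊓q≤p d′ (a ℚ.⊓ b)))))) ⟩
    (a ℚ.- d) ℚ.* (seq y n ℚ.+ d ℚ.- b) ℚ.+ (b ℚ.- d) ℚ.* (seq x n ℚ.+ d ℚ.- a)
      ℚ.+ ((seq x n ℚ.+ d ℚ.- a) ℚ.* (seq y n ℚ.+ d ℚ.- b) ℚ.+ (d ℚ.* d ℚ.+ (a ℚ.+ b) ℚ.* (d′ ℚ.- d)))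
      ≡⟨ solve 6 (λ a b d d′ x y →
           (a :- d) :* (y :+ d :- b) :+ (b :- d) :* (x :+ d :- a) :+ ((x :+ d :- a) :* (y :+ d :- b) :+ (d :* d :+ (a :+ b) :* (d′ :- d)))
           := (x :* y :+ (a :+ b) :* d′) :- a :* b) refl a b d d′ (seq x n) (seq y n) ⟩
    (seq x n ℚ.* seq y n ℚ.+ (a ℚ.+ b) ℚ.* d′) ℚ.- a ℚ.* b
      ≡⟨ cong (λ t → (seq x n ℚ.* seq y n ℚ.+ t) ℚ.- a ℚ.* b) eq ⟩
    (seq x n ℚ.* seq y n ℚ.+ e) ℚ.- a ℚ.* b ∎))
    (a≤x d d>0) (b≤y d d>0)
  where
  open ℚ.≤-Reasoning
  ⊓-pos : ∀ {p q} → 0ℚ ℚ.< p → 0ℚ ℚ.< q → 0ℚ ℚ.< p ℚ.⊓ q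
  ⊓-pos {p} {q} p>0 q>0 with ℚ.⊓-sel p q
  ... | inj₁ eq = subst (0ℚ ℚ.<_) (sym eq) p>0
  ... | inj₂ eq = subst (0ℚ ℚ.<_) (sym eq) q>0

<⇒≤ : ∀ {x y} → x < y → x ≤ y
<⇒≤ {x} {y} (d , d>0 , N , h) e e>0 = N , λ n N≤n → begin
  seq x n               ≡⟨ sym (ℚ.+-identityʳ (seq x n)) ⟩
  seq x n ℚ.+ 0ℚ        ≤⟨ ℚ.+-monoʳ-≤ (seq x n) (ℚ.<⇒≤ d>0) ⟩
  seq x n ℚ.+ d         ≤⟨ h n N≤n ⟩
  seq y n               ≡⟨ sym (ℚ.+-identityʳ (seq y n)) ⟩
  seq y n ℚ.+ 0ℚ        ≤⟨ ℚ.+-monoʳ-≤ (seq y n) (ℚ.<⇒≤ e>0) ⟩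
  seq y n ℚ.+ e         ∎
  where open ℚ.≤-Reasoning

-- Order on the reals is not decidable, but one rational comparison at an index after which `y`
-- moves by at most e/4 is: it yields either the bound up to `e`, or a gap of e/4 witnessing y < q.
≮⇒≥ : ∀ {q y} → ¬ (y < fromℚ q) → fromℚ q ≤ y
≮⇒≥ {q} {y} y≮q e e>0 with cauchy y (½ ℚ.* (½ ℚ.* e)) (half-pos (½ ℚ.* e) (half-pos e e>0))
... | N , close with q ℚ.≤? seq y N ℚ.+ ½ ℚ.* e
...   | yes q≤ = N , λ n N≤n → begin
    q                                                              ≤⟨ q≤ ⟩
    seq y N ℚ.+ ½ ℚ.* e                                            ≤⟨ ℚ.+-monoˡ-≤ (½ ℚ.* e) (ℚ.≤-trans (p≤q+∣p-q∣ (seq y N) (seq y n)) (ℚ.+-monoʳ-≤ (seq y n) (close N n ℕ.≤-refl N≤n))) ⟩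
    seq y n ℚ.+ ½ ℚ.* (½ ℚ.* e) ℚ.+ ½ ℚ.* e                        ≡⟨ sym (ℚ.+-identityʳ _) ⟩
    seq y n ℚ.+ ½ ℚ.* (½ ℚ.* e) ℚ.+ ½ ℚ.* e ℚ.+ 0ℚ                 ≤⟨ ℚ.+-monoʳ-≤ (seq y n ℚ.+ ½ ℚ.* (½ ℚ.* e) ℚ.+ ½ ℚ.* e) (ℚ.<⇒≤ (half-pos (½ ℚ.* e) (half-pos e e>0))) ⟩
    seq y n ℚ.+ ½ ℚ.* (½ ℚ.* e) ℚ.+ ½ ℚ.* e ℚ.+ ½ ℚ.* (½ ℚ.* e)    ≡⟨ solve 2 (λ y e → y :+ con ½ :* (con ½ :* e) :+ con ½ :* e :+ con ½ :* (con ½ :* e) := y :+ e) refl (seq y n) e ⟩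
    seq y n ℚ.+ e                                                  ∎
    where open ℚ.≤-Reasoning
...   | no q≰ = ⊥-elim (y≮q (½ ℚ.* (½ ℚ.* e) , half-pos (½ ℚ.* e) (half-pos e e>0) , N , λ n N≤n → begin
    seq y n ℚ.+ ½ ℚ.* (½ ℚ.* e)                          ≤⟨ ℚ.+-monoˡ-≤ (½ ℚ.* (½ ℚ.* e)) (ℚ.≤-trans (p≤q+∣p-q∣ (seq y n) (seq y N)) (ℚ.+-monoʳ-≤ (seq y N) (close n N N≤n ℕ.≤-refl))) ⟩
    seq y N ℚ.+ ½ ℚ.* (½ ℚ.* e) ℚ.+ ½ ℚ.* (½ ℚ.* e)      ≡⟨ solve 2 (λ y e → y :+ con ½ :* (con ½ :* e) :+ con ½ :* (con ½ :* e) := y :+ con ½ :* e) refl (seq y N) e ⟩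
    seq y N ℚ.+ ½ ℚ.* e                                  ≤⟨ ℚ.<⇒≤ (ℚ.≰⇒> q≰) ⟩
    q                                                    ∎))
    where open ℚ.≤-Reasoning

below : ∀ {x x′ y} → (∀ n → seq x n ℚ.≤ seq x′ n) → x′ ≤ y → x ≤ y
below x≤x′ x′≤y e e>0 = eventually₁ (λ n → ℚ.≤-trans (x≤x′ n)) (x′≤y e e>0)

above : ∀ {x y y′} → x ≤ y → (∀ n → seq y n ℚ.≤ seq y′ n) → x ≤ y′
above x≤y y≤y′ e e>0 = eventually₁ (λ n p → ℚ.≤-trans p (ℚ.+-monoˡ-≤ e (y≤y′ n))) (x≤y e e>0)

fromℕ-*-monoˡ : ∀ {j k x} → 0ℝ ≤ x → j ≤ℕ k → fromℕ j * x ≤ fromℕ k * x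
fromℕ-*-monoˡ {j} {k} {x} 0≤x j≤k = below {fromℕ j * x} {x * fromℕ j} {fromℕ k * x} (λ n → ℚ.≤-reflexive (ℚ.*-comm (ι j) (seq x n)))
  (above {x * fromℕ j} {x * fromℕ k} {fromℕ k * x} (*-monoʳ-≤ {x} 0≤x (ι-mono j≤k)) (λ n → ℚ.≤-reflexive (ℚ.*-comm (seq x n) (ι k))))

-- Expectations and distinguishing gaps.

∑ℚ : ∀ n → (Vec Bool n → ℚ) → ℚ
∑ℚ zero    f = f []
∑ℚ (suc n) f = ∑ℚ n (f ∘ (false ∷_)) ℚ.+ ∑ℚ n (f ∘ (true ∷_))

seq-∑ : ∀ n (f : Vec Bool n → ℝ) k → seq (∑ n f) k ≡ ∑ℚ n (λ x → seq (f x) k)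
seq-∑ zero    f k = refl
seq-∑ (suc n) f k = cong₂ ℚ._+_ (seq-∑ n (f ∘ (false ∷_)) k) (seq-∑ n (f ∘ (true ∷_)) k)

∑ℚ-cong : ∀ n {f g : Vec Bool n → ℚ} → f ≗ g → ∑ℚ n f ≡ ∑ℚ n g
∑ℚ-cong zero    h = h []
∑ℚ-cong (suc n) h = cong₂ ℚ._+_ (∑ℚ-cong n (h ∘ (false ∷_))) (∑ℚ-cong n (h ∘ (true ∷_)))

∑ℚ-comb : ∀ n a (f : Vec Bool n → ℚ) b g → ∑ℚ n (λ x → a ℚ.* f x ℚ.+ b ℚ.* g x) ≡ a ℚ.* ∑ℚ n f ℚ.+ b ℚ.* ∑ℚ n g
∑ℚ-comb zero    a f b g = refl
∑ℚ-comb (suc n) a f b g = trans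
  (cong₂ ℚ._+_ (∑ℚ-comb n a (f ∘ (false ∷_)) b (g ∘ (false ∷_))) (∑ℚ-comb n a (f ∘ (true ∷_)) b (g ∘ (true ∷_))))
  (solve 6 (λ a b f g f′ g′ → (a :* f :+ b :* g) :+ (a :* f′ :+ b :* g′) := a :* (f :+ f′) :+ b :* (g :+ g′)) refl a b
    (∑ℚ n (f ∘ (false ∷_))) (∑ℚ n (g ∘ (false ∷_))) (∑ℚ n (f ∘ (true ∷_))) (∑ℚ n (g ∘ (true ∷_))))

∑-mono : ∀ n {f g : Vec Bool n → ℝ} → (∀ x → f x ≤ g x) → ∑ n f ≤ ∑ n g
∑-mono zero    h = h []
∑-mono (suc n) {f} {g} h = +-mono-≤
  {∑ n (f ∘ (false ∷_))} {∑ n (g ∘ (false ∷_))} {∑ n (f ∘ (true ∷_))} {∑ n (g ∘ (true ∷_))}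
  (∑-mono n (λ x → h (false ∷ x))) (∑-mono n (λ x → h (true ∷ x)))

-- Test functions are rational-valued, so at each index of the approximating sequences this is a
-- linear functional over ℚ. Linearity thus holds exactly at every index, without any limit.
𝔼 : ∀ {n} → Distribution n → (Vec Bool n → ℚ) → ℝ
𝔼 {n} D f = ∑ n (λ x → pmf D x * fromℚ (f x))

seq-𝔼 : ∀ {n} (D : Distribution n) f k → seq (𝔼 D f) k ≡ ∑ℚ n (λ x → seq (pmf D x) k ℚ.* f x)
seq-𝔼 {n} D f k = seq-∑ n (λ x → pmf D x * fromℚ (f x)) k

𝔼-cong : ∀ {n} (D : Distribution n) f g → f ≗ g → ∀ k → seq (𝔼 D f) k ≡ seq (𝔼 D g) k
𝔼-cong {n} D f g f≗g k = trans (seq-𝔼 D f k)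
  (trans (∑ℚ-cong n (λ x → cong (seq (pmf D x) k ℚ.*_) (f≗g x))) (sym (seq-𝔼 D g k)))

𝔼-comb : ∀ {n} (D : Distribution n) a f b g k → seq (𝔼 D (λ x → a ℚ.* f x ℚ.+ b ℚ.* g x)) k ≡
  a ℚ.* seq (𝔼 D f) k ℚ.+ b ℚ.* seq (𝔼 D g) k
𝔼-comb {n} D a f b g k = begin
  seq (𝔼 D (λ x → a ℚ.* f x ℚ.+ b ℚ.* g x)) k
    ≡⟨ seq-𝔼 D (λ x → a ℚ.* f x ℚ.+ b ℚ.* g x) k ⟩
  ∑ℚ n (λ x → seq (pmf D x) k ℚ.* (a ℚ.* f x ℚ.+ b ℚ.* g x))
    ≡⟨ ∑ℚ-cong n (λ x → solve 5 (λ p a f b g → p :* (a :* f :+ b :* g) := a :* (p :* f) :+ b :* (p :* g))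
         refl (seq (pmf D x) k) a (f x) b (g x)) ⟩
  ∑ℚ n (λ x → a ℚ.* (seq (pmf D x) k ℚ.* f x) ℚ.+ b ℚ.* (seq (pmf D x) k ℚ.* g x))
    ≡⟨ ∑ℚ-comb n a (λ x → seq (pmf D x) k ℚ.* f x) b (λ x → seq (pmf D x) k ℚ.* g x) ⟩
  a ℚ.* ∑ℚ n (λ x → seq (pmf D x) k ℚ.* f x) ℚ.+ b ℚ.* ∑ℚ n (λ x → seq (pmf D x) k ℚ.* g x)
    ≡⟨ cong₂ (λ p q → a ℚ.* p ℚ.+ b ℚ.* q) (sym (seq-𝔼 D f k)) (sym (seq-𝔼 D g k)) ⟩
  a ℚ.* seq (𝔼 D f) k ℚ.+ b ℚ.* seq (𝔼 D g) k ∎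
  where open ≡-Reasoning

𝔼-scale : ∀ {n} (D : Distribution n) a f k → seq (𝔼 D (λ x → a ℚ.* f x)) k ≡ a ℚ.* seq (𝔼 D f) k
𝔼-scale D a f k = begin
  seq (𝔼 D (λ x → a ℚ.* f x)) k                        ≡⟨ 𝔼-cong D (λ x → a ℚ.* f x) (λ x → a ℚ.* f x ℚ.+ 0ℚ ℚ.* f x) (λ x → solve 2 (λ a f → a :* f := a :* f :+ con 0ℚ :* f) refl a (f x)) k ⟩
  seq (𝔼 D (λ x → a ℚ.* f x ℚ.+ 0ℚ ℚ.* f x)) k         ≡⟨ 𝔼-comb D a f 0ℚ f k ⟩
  a ℚ.* seq (𝔼 D f) k ℚ.+ 0ℚ ℚ.* seq (𝔼 D f) k         ≡⟨ solve 2 (λ a x → a :* x :+ con 0ℚ :* x := a :* x) refl a (seq (𝔼 D f) k) ⟩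
  a ℚ.* seq (𝔼 D f) k                                  ∎
  where open ≡-Reasoning

𝔼-total : ∀ {n} (D : Distribution n) k → seq (𝔼 D (λ _ → 1ℚ)) k ≡ seq (∑ n (pmf D)) k
𝔼-total {n} D k = trans (seq-𝔼 D (λ _ → 1ℚ) k)
  (trans (∑ℚ-cong n (λ x → ℚ.*-identityʳ (seq (pmf D x) k))) (sym (seq-∑ n (pmf D) k)))

Pr-𝔼 : ∀ {n} (D : Distribution n) h k → seq (Pr D h) k ≡ seq (𝔼 D (λ x → indicator (h x))) k
Pr-𝔼 {n} D h k = begin
  seq (Pr D h) k
    ≡⟨ seq-∑ n (λ x → if h x then pmf D x else 0ℝ) k ⟩
  ∑ℚ n (λ x → seq (if h x then pmf D x else 0ℝ) k)
    ≡⟨ ∑ℚ-cong n (λ x → value (h x) (pmf D x)) ⟩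
  ∑ℚ n (λ x → seq (pmf D x) k ℚ.* indicator (h x))
    ≡⟨ sym (seq-𝔼 D (λ x → indicator (h x)) k) ⟩
  seq (𝔼 D (λ x → indicator (h x))) k ∎
  where
  open ≡-Reasoning
  value : ∀ b p → seq (if b then p else 0ℝ) k ≡ seq p k ℚ.* indicator b
  value true  p = sym (ℚ.*-identityʳ (seq p k))
  value false p = sym (ℚ.*-zeroʳ (seq p k))

𝔼-const : ∀ {n} (D : Distribution n) η k → seq (𝔼 D (λ _ → η)) k ≡ η ℚ.* seq (∑ n (pmf D)) k
𝔼-const {n} D η k = begin
  seq (𝔼 D (λ _ → η)) k                 ≡⟨ 𝔼-cong D (λ _ → η) (λ _ → η ℚ.* 1ℚ) (λ _ → sym (ℚ.*-identityʳ η)) k ⟩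
  seq (𝔼 D (λ _ → η ℚ.* 1ℚ)) k          ≡⟨ 𝔼-scale D η (λ _ → 1ℚ) k ⟩
  η ℚ.* seq (𝔼 D (λ _ → 1ℚ)) k          ≡⟨ cong (η ℚ.*_) (𝔼-total D k) ⟩
  η ℚ.* seq (∑ n (pmf D)) k             ∎
  where open ≡-Reasoning

𝔼-≤-const : ∀ {n} (D : Distribution n) f {η} → 0ℚ ℚ.≤ η → (∀ x → f x ℚ.≤ η) → 𝔼 D f ≤ fromℚ η
𝔼-≤-const {n} D f {η} 0≤η f≤η = ≤-trans {𝔼 D f} {𝔼 D (λ _ → η)} {fromℚ η}
  (∑-mono n {λ x → pmf D x * fromℚ (f x)} {λ x → pmf D x * fromℚ η} (λ x → *-monoʳ-≤ {pmf D x} {f x} {η} (nonNeg D x) (f≤η x)))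
  (below {𝔼 D (λ _ → η)} {fromℚ η * ∑ n (pmf D)} {fromℚ η} (λ k → ℚ.≤-reflexive (𝔼-const D η k))
    (above {fromℚ η * ∑ n (pmf D)} {fromℚ η * 1ℝ} {fromℚ η} (*-monoˡ-≤ {η} {∑ n (pmf D)} {1ℝ} 0≤η (proj₁ (total D)))
      (λ _ → ℚ.≤-reflexive (ℚ.*-identityʳ η))))

𝔼-neg : ∀ {n} (D : Distribution n) f k → ℚ.- seq (𝔼 D f) k ≡ seq (𝔼 D (λ x → -1ℚ ℚ.* f x)) k
𝔼-neg D f k = trans (neg≡-1* (seq (𝔼 D f) k)) (sym (𝔼-scale D -1ℚ f k))
  where
  neg≡-1* : ∀ p → ℚ.- p ≡ -1ℚ ℚ.* p
  neg≡-1* = solve 1 (λ x → :- x := con -1ℚ :* x) refl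

∣𝔼∣-≤ : ∀ {n} (D : Distribution n) f {η} → 0ℚ ℚ.≤ η → (∀ x → ℚ.∣ f x ∣ ℚ.≤ η) → ∣ 𝔼 D f ∣ ≤ fromℚ η
∣𝔼∣-≤ D f {η} 0≤η ∣f∣≤η = ∣∣-≤ {𝔼 D f} {fromℚ η}
  (𝔼-≤-const D f 0≤η (λ x → ℚ.≤-trans (p≤∣p∣ (f x)) (∣f∣≤η x)))
  (below {(- 𝔼 D f)} {𝔼 D (λ x → -1ℚ ℚ.* f x)} {fromℚ η} (λ k → ℚ.≤-reflexive (𝔼-neg D f k))
    (𝔼-≤-const D (λ x → -1ℚ ℚ.* f x) 0≤η (λ x → ℚ.≤-trans (p≤∣p∣ (-1ℚ ℚ.* f x))
      (subst (ℚ._≤ η) (sym (trans (ℚ.∣p*q∣≡∣p∣*∣q∣ -1ℚ (f x)) (ℚ.*-identityˡ ℚ.∣ f x ∣))) (∣f∣≤η x)))))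

gap : ∀ {n} → Distribution n → (Vec Bool n → ℚ) → ℝ
gap {n} D f = ∣ 𝔼 D f - 𝔼 (uniform n) f ∣

gap-cong : ∀ {n} (D : Distribution n) f g → f ≗ g → ∀ k → seq (gap D f) k ≡ seq (gap D g) k
gap-cong {n} D f g f≗g k = cong₂ (λ p q → ℚ.∣ p ℚ.- q ∣) (𝔼-cong D f g f≗g k) (𝔼-cong (uniform n) f g f≗g k)

gap-scale : ∀ {n} (D : Distribution n) a f k → seq (gap D (λ x → a ℚ.* f x)) k ≡ ℚ.∣ a ∣ ℚ.* seq (gap D f) k
gap-scale {n} D a f k = begin
  seq (gap D (λ x → a ℚ.* f x)) k   ≡⟨ cong₂ (λ p q → ℚ.∣ p ℚ.- q ∣) (𝔼-scale D a f k) (𝔼-scale (uniform n) a f k) ⟩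
  ℚ.∣ a ℚ.* p ℚ.- a ℚ.* q ∣         ≡⟨ cong ℚ.∣_∣ (solve 3 (λ a p q → a :* p :- a :* q := a :* (p :- q)) refl a p q) ⟩
  ℚ.∣ a ℚ.* (p ℚ.- q) ∣             ≡⟨ ℚ.∣p*q∣≡∣p∣*∣q∣ a (p ℚ.- q) ⟩
  ℚ.∣ a ∣ ℚ.* seq (gap D f) k       ∎
  where
  open ≡-Reasoning
  p = seq (𝔼 D f) k
  q = seq (𝔼 (uniform n) f) k

gap-+ : ∀ {n} (D : Distribution n) f g k → seq (gap D (λ x → f x ℚ.+ g x)) k ℚ.≤ seq (gap D f) k ℚ.+ seq (gap D g) k
gap-+ {n} D f g k = ℚ.≤-trans (ℚ.≤-reflexive (cong₂ (λ p q → ℚ.∣ p ℚ.- q ∣) (split D) (split (uniform n))))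
  (+-lip (seq (𝔼 D f) k) (seq (𝔼 D g) k) (seq (𝔼 (uniform n) f) k) (seq (𝔼 (uniform n) g) k))
  where
  split : ∀ D → seq (𝔼 D (λ x → f x ℚ.+ g x)) k ≡ seq (𝔼 D f) k ℚ.+ seq (𝔼 D g) k
  split D = trans (𝔼-cong D (λ x → f x ℚ.+ g x) (λ x → 1ℚ ℚ.* f x ℚ.+ 1ℚ ℚ.* g x) (λ x → solve 2 (λ f g → f :+ g := con 1ℚ :* f :+ con 1ℚ :* g) refl (f x) (g x)) k)
    (trans (𝔼-comb D 1ℚ f 1ℚ g k)
      (solve 2 (λ f g → con 1ℚ :* f :+ con 1ℚ :* g := f :+ g) refl (seq (𝔼 D f) k) (seq (𝔼 D g) k)))

gap-≤ : ∀ {n} (D : Distribution n) f {η} → 0ℚ ℚ.≤ η → (∀ x → ℚ.∣ f x ∣ ℚ.≤ η) → gap D f ≤ fromℚ η + fromℚ η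
gap-≤ {n} D f {η} 0≤η f≤η = below {gap D f} {∣ 𝔼 D f ∣ + ∣ 𝔼 (uniform n) f ∣} {fromℚ η + fromℚ η}
  (λ k → ℚ.∣p-q∣≤∣p∣+∣q∣ (seq (𝔼 D f) k) (seq (𝔼 (uniform n) f) k))
  (+-mono-≤ {∣ 𝔼 D f ∣} {fromℚ η} {∣ 𝔼 (uniform n) f ∣} {fromℚ η} (∣𝔼∣-≤ D f 0≤η f≤η) (∣𝔼∣-≤ (uniform n) f 0≤η f≤η))

-- The approximations of the two total masses reach 1 only in the limit, so, unlike linearity, this
-- is not an identity at each index.
gap-1 : ∀ {n} (D : Distribution n) → gap D (λ _ → 1ℚ) ≤ 0ℝ
gap-1 {n} D = ∣∣-≤ {𝔼 D (λ _ → 1ℚ) - 𝔼 (uniform n) (λ _ → 1ℚ)} {0ℝ} (side D (uniform n))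
  (below {(- (𝔼 D (λ _ → 1ℚ) - 𝔼 (uniform n) (λ _ → 1ℚ)))} {𝔼 (uniform n) (λ _ → 1ℚ) - 𝔼 D (λ _ → 1ℚ)} {0ℝ}
    (λ k → ℚ.≤-reflexive (neg-sub (seq (𝔼 D (λ _ → 1ℚ)) k) (seq (𝔼 (uniform n) (λ _ → 1ℚ)) k)))
    (side (uniform n) D))
  where
  neg-sub : ∀ p q → ℚ.- (p ℚ.- q) ≡ q ℚ.- p
  neg-sub = solve 2 (λ p q → :- (p :- q) := q :- p) refl
  side : ∀ D D′ → 𝔼 D (λ _ → 1ℚ) - 𝔼 D′ (λ _ → 1ℚ) ≤ 0ℝ
  side D D′ e e>0 = eventually₂ (λ k p q → begin
      seq (𝔼 D (λ _ → 1ℚ)) k ℚ.- seq (𝔼 D′ (λ _ → 1ℚ)) k    ≡⟨ cong₂ ℚ._-_ (𝔼-total D k) (𝔼-total D′ k) ⟩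
      seq (∑ n (pmf D)) k ℚ.- t′ k                          ≤⟨ ℚ.+-monoˡ-≤ (ℚ.- t′ k) (ℚ.≤-trans p (ℚ.+-monoˡ-≤ (½ ℚ.* e) q)) ⟩
      t′ k ℚ.+ ½ ℚ.* e ℚ.+ ½ ℚ.* e ℚ.- t′ k                 ≡⟨ cancel (t′ k) ⟩
      0ℚ ℚ.+ e                                              ∎)
    (proj₁ (total D) (½ ℚ.* e) (half-pos e e>0)) (proj₂ (total D′) (½ ℚ.* e) (half-pos e e>0))
    where
    open ℚ.≤-Reasoning
    t′ : ℕ → ℚ
    t′ k = seq (∑ n (pmf D′)) k
    cancel : ∀ t → t ℚ.+ ½ ℚ.* e ℚ.+ ½ ℚ.* e ℚ.- t ≡ 0ℚ ℚ.+ e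
    cancel t = solve 2 (λ t e → t :+ con ½ :* e :+ con ½ :* e :- t := con 0ℚ :+ e) refl t e

gap-Pr : ∀ {n} (D : Distribution n) h k → seq (gap D (λ x → indicator (h x))) k ≡ seq ∣ Pr D h - Pr (uniform n) h ∣ k
gap-Pr {n} D h k = cong₂ (λ p q → ℚ.∣ p ℚ.- q ∣) (sym (Pr-𝔼 D h k)) (sym (Pr-𝔼 (uniform n) h k))

*-≤1 : ∀ {p q} → 0ℚ ℚ.≤ q → p ℚ.≤ 1ℚ → p ℚ.* q ℚ.≤ q
*-≤1 {p} {q} 0≤q p≤1 = subst₂ ℚ._≤_ (ℚ.*-comm q p) (ℚ.*-identityʳ q) (*-monoˡ 0≤q p≤1)

ι1≡1 : ι 1 ≡ 1ℚ
ι1≡1 = refl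

ι1-* : ∀ p → ι 1 ℚ.* p ≡ p
ι1-* p = trans (cong (ℚ._* p) ι1≡1) (ℚ.*-identityˡ p)

-- Opaque to keep comparisons of types from unfolding the rational arithmetic.
opaque
  GapWithin : ∀ {n} → Distribution n → (Vec Bool n → ℚ) → ℝ → Set
  GapWithin D f r = gap D f ≤ r

module Fooling {s n : ℕ} (χ : Bool → ℚ) (D : Distribution n) (g : Fin s → BoolFun n) {d : ℕ} {Δ : ℝ} (0≤Δ : 0ℝ ≤ Δ) where
  open Polynomials {s} χ

  at : Vec Bool n → Cube
  at x i = g i x

  opaque
    unfolding GapWithin

    -- `Δ` is the gap granted to one monomial and k the number of terms, so that the bookkeeping
    -- follows `Terms`.
    Fooled : ℕ → (Vec Bool n → ℚ) → Set
    Fooled k f = GapWithin D f (fromℕ k * Δ)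

    fooled⁺ : ∀ {f} → GapWithin D f Δ → Fooled 1 f
    fooled⁺ {f} h = above {gap D f} {Δ} {fromℕ 1 * Δ} h (λ j → ℚ.≤-reflexive (sym (ι1-* (seq Δ j))))

    fooled-multiple : ∀ k {f m : Vec Bool n → ℚ} {c} → ℚ.∣ c ∣ ℚ.≤ 1ℚ → (∀ x → f x ≡ m x ℚ.* c) → Fooled 1 m → Fooled (suc k) f
    fooled-multiple k {f} {m} {c} c≤1 f≗ h =
      below {gap D f} {gap D m} {fromℕ (suc k) * Δ} shrinks
        (≤-trans {gap D m} {fromℕ 1 * Δ} {fromℕ (suc k) * Δ} h (fromℕ-*-monoˡ {1} {suc k} {Δ} 0≤Δ (s≤s z≤n)))
      where
      open ℚ.≤-Reasoning
      shrinks : ∀ j → seq (gap D f) j ℚ.≤ seq (gap D m) j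
      shrinks j = begin
        seq (gap D f) j                       ≡⟨ gap-cong D f (λ x → c ℚ.* m x) (λ x → trans (f≗ x) (ℚ.*-comm (m x) c)) j ⟩
        seq (gap D (λ x → c ℚ.* m x)) j       ≡⟨ gap-scale D c m j ⟩
        ℚ.∣ c ∣ ℚ.* seq (gap D m) j           ≤⟨ *-≤1 {ℚ.∣ c ∣} {seq (gap D m) j} (ℚ.0≤∣p∣ (seq (𝔼 D m) j ℚ.- seq (𝔼 (uniform n) m) j)) c≤1 ⟩
        seq (gap D m) j                       ∎

    fooled-sum : ∀ {j k l} {f f₁ f₂ : Vec Bool n → ℚ} → (∀ x → f x ≡ f₁ x ℚ.+ f₂ x) → j ℕ.+ k ≤ℕ l →
      Fooled j f₁ → Fooled k f₂ → Fooled l f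
    fooled-sum {j} {k} {l} {f} {f₁} {f₂} f≗ le h₁ h₂ =
      below {gap D f} {gap D f₁ + gap D f₂} {fromℕ l * Δ} split
        (≤-trans {gap D f₁ + gap D f₂} {fromℕ j * Δ + fromℕ k * Δ} {fromℕ l * Δ}
          (+-mono-≤ {gap D f₁} {fromℕ j * Δ} {gap D f₂} {fromℕ k * Δ} h₁ h₂)
          (below {fromℕ j * Δ + fromℕ k * Δ} {fromℕ (j ℕ.+ k) * Δ} {fromℕ l * Δ} (λ i → ℚ.≤-reflexive (collect (seq Δ i)))
            (fromℕ-*-monoˡ {j ℕ.+ k} {l} {Δ} 0≤Δ le)))
      where
      split : ∀ i → seq (gap D f) i ℚ.≤ seq (gap D f₁) i ℚ.+ seq (gap D f₂) i
      split i = ℚ.≤-trans (ℚ.≤-reflexive (gap-cong D f (λ x → f₁ x ℚ.+ f₂ x) f≗ i)) (gap-+ D f₁ f₂ i)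
      collect : ∀ p → ι j ℚ.* p ℚ.+ ι k ℚ.* p ≡ ι (j ℕ.+ k) ℚ.* p
      collect p = trans (sym (ℚ.*-distribʳ-+ p (ι j) (ι k))) (cong (ℚ._* p) (sym (ι-+ j k)))

    -- The remainder, of absolute value at most `η`, contributes one `η` under `D` and one under the
    -- uniform distribution.
    fooled-close : ∀ {k} {h : BoolFun n} {p η} → Fooled k p → 0ℚ ℚ.≤ η → (∀ x → ℚ.∣ indicator (h x) ℚ.- p x ∣ ℚ.≤ η) →
      ∣ Pr D h - Pr (uniform n) h ∣ ≤ fromℕ k * Δ + (fromℚ η + fromℚ η)
    fooled-close {k} {h} {p} {η} fooled-p 0≤η close =
      below {∣ Pr D h - Pr (uniform n) h ∣} {gap D p + gap D rest} {fromℕ k * Δ + (fromℚ η + fromℚ η)} split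
        (+-mono-≤ {gap D p} {fromℕ k * Δ} {gap D rest} {fromℚ η + fromℚ η} fooled-p (gap-≤ D rest 0≤η close))
      where
      rest : Vec Bool n → ℚ
      rest x = indicator (h x) ℚ.- p x
      h≗ : ∀ x → indicator (h x) ≡ p x ℚ.+ rest x
      h≗ x = solve 2 (λ a b → a := b :+ (a :- b)) refl (indicator (h x)) (p x)
      split : ∀ i → seq ∣ Pr D h - Pr (uniform n) h ∣ i ℚ.≤ seq (gap D p) i ℚ.+ seq (gap D rest) i
      split i = begin
        seq ∣ Pr D h - Pr (uniform n) h ∣ i         ≡⟨ sym (gap-Pr D h i) ⟩
        seq (gap D (λ x → indicator (h x))) i       ≡⟨ gap-cong D (λ x → indicator (h x)) (λ x → p x ℚ.+ rest x) h≗ i ⟩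
        seq (gap D (λ x → p x ℚ.+ rest x)) i        ≤⟨ gap-+ D p rest i ⟩
        seq (gap D p) i ℚ.+ seq (gap D rest) i      ∎
        where open ℚ.≤-Reasoning

  module _ (fooled : ∀ S → length S ≤ℕ d → Fooled 1 (λ x → mono S (at x))) where

    fooled-terms : ∀ {k f} → Terms Small d k f → Fooled k (λ x → f (at x) tt)
    fooled-terms {suc k} (term S v S≤ v≤1 eq) = fooled-multiple k v≤1 (λ x → eq (at x) tt) (fooled S S≤)
    fooled-terms (sum ts us le eq) = fooled-sum (λ x → eq (at x) tt) le (fooled-terms ts) (fooled-terms us)

-- Integer bounds on powers of two, logarithms and square roots.

neg-mono : ∀ {x y} → x ≤ y → - y ≤ - x
neg-mono {x} {y} x≤y e e>0 = eventually₁ (λ n h → begin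
    ℚ.- seq y n                                   ≡⟨ solve 2 (λ y e → :- y := :- (y :+ e) :+ e) refl (seq y n) e ⟩
    ℚ.- (seq y n ℚ.+ e) ℚ.+ e                     ≤⟨ ℚ.+-monoˡ-≤ e (ℚ.neg-antimono-≤ h) ⟩
    ℚ.- seq x n ℚ.+ e                             ∎)
  (x≤y e e>0)
  where open ℚ.≤-Reasoning

-- The comparison is with the rational exponent -(k + 1)/1, whose numerator is `ℤ.-[1+ k ]`; hence
-- the successor here and in `≤-2^-`.
2^-≤ : ∀ {ε ℓ} k → ε ≃2^ (- ℓ) → ℓ ≤ fromℕ (suc k) → fromℚ (½ ^ℚ suc k) ≤ ε
2^-≤ {ε} {ℓ} k (_ , power) ℓ≤ = above {fromℚ (½ ^ℚ suc k)} {ε ^ 1} {ε}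
  (proj₁ (power ℤ.-[1+ k ] 1) (neg-mono {ℓ} {fromℕ (suc k)} ℓ≤))
  (λ n → ℚ.≤-reflexive (ℚ.*-identityʳ (seq ε n)))

≤-2^- : ∀ {δ y} k → δ ≃2^ (- y) → fromℕ (suc k) ≤ y → δ ≤ fromℚ (½ ^ℚ suc k)
≤-2^- {δ} {y} k (_ , power) ≤y = below {δ} {δ ^ 1} {fromℚ (½ ^ℚ suc k)}
  (λ n → ℚ.≤-reflexive (sym (ℚ.*-identityʳ (seq δ n))))
  (proj₂ (power ℤ.-[1+ k ] 1) (neg-mono {fromℕ (suc k)} {y} ≤y))

ι-2^ : ∀ k → ι (2 ℕ.^ k) ≡ 2ℚ ^ℚ k
ι-2^ zero    = refl
ι-2^ (suc k) = trans (ι-* 2 (2 ℕ.^ k)) (cong (2ℚ ℚ.*_) (ι-2^ k))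

ι-cancel-≤ : ∀ {m n} → ι m ℚ.≤ ι n → m ≤ℕ n
ι-cancel-≤ {m} {n} ιm≤ιn = ℕ.≮⇒≥ λ n<m →
  let 1+ιn≤ιn = ℚ.≤-trans (ℚ.≤-reflexive (sym (ι-+ 1 n))) (ℚ.≤-trans (ι-mono n<m) ιm≤ιn)
  in ℚ.<-irrefl refl (ℚ.<-≤-trans (ℚ.positive⁻¹ 1ℚ) (subst₂ ℚ._≤_
       (solve 1 (λ n → con 1ℚ :+ n :- n := con 1ℚ) refl (ι n)) (ℚ.+-inverseʳ (ι n)) (ℚ.+-monoˡ-≤ (ℚ.- ι n) 1+ιn≤ιn)))

half-ι : ∀ n → ℤ.+ n ℚ./ 2 ≡ ½ ℚ.* ι n
half-ι n = ℚ.toℚᵘ-injective (begin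
  ℚ.toℚᵘ (ℤ.+ n ℚ./ 2)                              ≈⟨ ℚ.toℚᵘ-fromℚᵘ (ℚᵘ.mkℚᵘ (ℤ.+ n) 1) ⟩
  ℚᵘ.mkℚᵘ (ℤ.+ n) 1                                 ≈⟨ ℚᵘ.*≡* (sym (cong (ℤ._* ℤ.+ 2) (ℤ.*-identityˡ (ℤ.+ n)))) ⟩
  ℚᵘ.mkℚᵘ (ℤ.+ 1) 1 ℚᵘ.* ℚᵘ.mkℚᵘ (ℤ.+ n) 0          ≈⟨ ℚᵘ.*-congˡ {ℚᵘ.mkℚᵘ (ℤ.+ 1) 1} (toℚᵘ-ι n) ⟨
  ℚ.toℚᵘ ½ ℚᵘ.* ℚ.toℚᵘ (ι n)                        ≈⟨ ℚ.toℚᵘ-homo-* ½ (ι n) ⟨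
  ℚ.toℚᵘ (½ ℚ.* ι n)                                ∎)
  where open ℚᵘ.≃-Reasoning

-- Comparing s² with 2^(2b-1) avoids the equality case and gives log₂ s ≥ b - 1/2.
log-≥ : ∀ {s b y} → fromℕ s ≃2^ y → 2 ℕ.^ suc b ≤ℕ s → fromℚ (½ ℚ.* ι (suc b)) ≤ y
log-≥ {s} {b} {y} (_ , power) 2^b≤s = ≤-trans {fromℚ (½ ℚ.* ι (suc b))} {fromℚ (ℤ.+ p ℚ./ 2)} {y}
    (fromℚ-mono (subst (½ ℚ.* ι (suc b) ℚ.≤_) (sym (half-ι p)) (*-monoˡ (ℚ.<⇒≤ (ℚ.positive⁻¹ ½)) (ι-mono (s≤s (ℕ.m≤m+n b b))))))
    (≮⇒≥ {ℤ.+ p ℚ./ 2} {y} (λ y<p/2 → ℕ.<⇒≱ 2^p<s² (s²≤2^p (<⇒≤ {y} {fromℚ (ℤ.+ p ℚ./ 2)} y<p/2))))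
  where
  p = suc (b ℕ.+ b)
  s²≤2^p : y ≤ fromℚ (ℤ.+ p ℚ./ 2) → s ℕ.* s ≤ℕ 2 ℕ.^ p
  s²≤2^p h = ι-cancel-≤ (begin
    ι (s ℕ.* s)            ≡⟨ ι-* s s ⟩
    ι s ℚ.* ι s            ≡⟨ cong (ι s ℚ.*_) (sym (ℚ.*-identityʳ (ι s))) ⟩
    ι s ℚ.* (ι s ℚ.* 1ℚ)   ≤⟨ fromℚ-reflects-≤ (proj₂ (power (ℤ.+ p) 2) h) ⟩
    2ℚ ^ℚ p                ≡⟨ sym (ι-2^ p) ⟩
    ι (2 ℕ.^ p)            ∎)
    where open ℚ.≤-Reasoning
  2^p<s² : 2 ℕ.^ p ℕ.< s ℕ.* s
  2^p<s² = begin-strict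
    2 ℕ.^ p                          <⟨ ℕ.^-monoʳ-< 2 (s≤s (s≤s z≤n)) (ℕ.n<1+n p) ⟩
    2 ℕ.^ suc p                      ≡⟨ cong (2 ℕ.^_) (cong suc (sym (ℕ.+-suc b b))) ⟩
    2 ℕ.^ (suc b ℕ.+ suc b)          ≡⟨ ℕ.^-distribˡ-+-* 2 (suc b) (suc b) ⟩
    2 ℕ.^ suc b ℕ.* 2 ℕ.^ suc b      ≤⟨ ℕ.*-mono-≤ 2^b≤s 2^b≤s ⟩
    s ℕ.* s                          ∎
    where open ℕ.≤-Reasoning

-- If y ≤ j - e, then, `y` being nearly nonnegative, y² falls short of j² by at least ej/2, whereas
-- j² ≤ s ≤ y² + ej/4 at late indices.
sqrt-≥ : ∀ {s j y} → y IsSqrtOf fromℕ s → 0 ℕ.< j → j ℕ.* j ≤ℕ s → fromℕ j ≤ y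
sqrt-≥ {s} {j} {y} (0≤y , _ , s≤y²) 0<j j²≤s = ≮⇒≥ {q} {y} λ where
    (e , e>0 , y+e≤q) →
      let ½q>0 = half-pos q q>0
          d>0 = half-pos (½ ℚ.* (e ℚ.* q)) (half-pos (e ℚ.* q) (*-pos e>0 q>0))
          N , h = eventually₂ (λ n → _,_) (eventually₂ (λ n → _,_) y+e≤q (0≤y (½ ℚ.* q) ½q>0)) (s≤y² (½ ℚ.* (½ ℚ.* (e ℚ.* q))) d>0)
          (a , c) , d = h N ℕ.≤-refl
      in ℚ.<-irrefl refl (ℚ.<-≤-trans d>0 (contra (seq y N) e (ℚ.<⇒≤ e>0) a c d))
  where
  q = ι j
  q>0 : 0ℚ ℚ.< q
  q>0 = ι-pos 0<j
  q²≤s : q ℚ.* q ℚ.≤ ι s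
  q²≤s = subst (ℚ._≤ ι s) (ι-* j j) (ι-mono j²≤s)
  contra : ∀ v e → 0ℚ ℚ.≤ e → v ℚ.+ e ℚ.≤ q → 0ℚ ℚ.≤ v ℚ.+ ½ ℚ.* q → ι s ℚ.≤ v ℚ.* v ℚ.+ ½ ℚ.* (½ ℚ.* (e ℚ.* q)) →
    ½ ℚ.* (½ ℚ.* (e ℚ.* q)) ℚ.≤ 0ℚ
  contra v e 0≤e v+e≤q 0≤v+½q s≤ = sub-nonNeg⁻¹ (begin
    0ℚ
      ≤⟨ +-nonNeg (+-nonNeg (sub-nonNeg q²≤s) (sub-nonNeg s≤)) (+-nonNeg
           (*-nonNeg (sub-nonNeg v+e≤q) (+-nonNeg 0≤v+½q (*-nonNeg (ℚ.<⇒≤ (ℚ.positive⁻¹ ½)) (ℚ.<⇒≤ q>0))))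
           (*-nonNeg 0≤e 0≤v+½q)) ⟩
    (ι s ℚ.- q ℚ.* q ℚ.+ (v ℚ.* v ℚ.+ ½ ℚ.* (½ ℚ.* (e ℚ.* q)) ℚ.- ι s))
      ℚ.+ ((q ℚ.- (v ℚ.+ e)) ℚ.* (v ℚ.+ ½ ℚ.* q ℚ.+ ½ ℚ.* q) ℚ.+ e ℚ.* (v ℚ.+ ½ ℚ.* q))
      ≡⟨ solve 4 (λ s q v e →
           (s :- q :* q :+ (v :* v :+ con ½ :* (con ½ :* (e :* q)) :- s))
           :+ ((q :- (v :+ e)) :* (v :+ con ½ :* q :+ con ½ :* q) :+ e :* (v :+ con ½ :* q))
           := con 0ℚ :- con ½ :* (con ½ :* (e :* q))) refl (ι s) q v e ⟩
    0ℚ ℚ.- ½ ℚ.* (½ ℚ.* (e ℚ.* q)) ∎)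
    where open ℚ.≤-Reasoning

last-below : ∀ (f : ℕ → ℕ) s N → f 0 ≤ℕ s → s ℕ.< f N → ∃[ i ] f i ≤ℕ s × s ℕ.< f (suc i)
last-below f s zero    f0≤s s<f0 = ⊥-elim (ℕ.<⇒≱ s<f0 f0≤s)
last-below f s (suc N) f0≤s s<fN with f N ℕ.≤? s
... | yes fN≤s = N , fN≤s , s<fN
... | no  fN≰s = last-below f s N f0≤s (ℕ.≰⇒> fN≰s)

archimedean : ∀ p → ∃[ N ] p ℚ.≤ ι N
archimedean p@(ℚ.mkℚ (ℤ.+ n) d _) = n , ℚ.toℚᵘ-cancel-≤ (ℚᵘ.≤-respʳ-≃ (ℚᵘ.≃-sym (toℚᵘ-ι n))
  (ℚᵘ.*≤* (subst₂ ℤ._≤_ (ℤ.pos-* n 1) (ℤ.pos-* n (suc d)) (ℤ.+≤+ (ℕ.*-monoʳ-≤ n (s≤s z≤n))))))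
archimedean p@(ℚ.mkℚ ℤ.-[1+ n ] d _) = 0 , ℚ.nonPositive⁻¹ p

ceiling : ∀ p → ∃[ k ] p ℚ.≤ ι k × ι k ℚ.≤ 0ℚ ℚ.⊔ (p ℚ.+ 1ℚ)
ceiling p = search (proj₁ (archimedean p)) (proj₂ (archimedean p))
  where
  search : ∀ N → p ℚ.≤ ι N → ∃[ k ] p ℚ.≤ ι k × ι k ℚ.≤ 0ℚ ℚ.⊔ (p ℚ.+ 1ℚ)
  search zero    p≤ = 0 , p≤ , ℚ.p≤p⊔q 0ℚ (p ℚ.+ 1ℚ)
  search (suc N) p≤ with p ℚ.≤? ι N
  ... | yes p≤N = search N p≤N
  ... | no  p≰N = suc N , p≤ , ℚ.≤-trans
    (ℚ.≤-trans (ℚ.≤-reflexive (trans (ι-+ 1 N) (ℚ.+-comm 1ℚ (ι N)))) (ℚ.+-monoˡ-≤ 1ℚ (ℚ.<⇒≤ (ℚ.≰⇒> p≰N))))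
    (ℚ.p≤q⊔p 0ℚ (p ℚ.+ 1ℚ))

1/6 : ℚ
1/6 = ℤ.+ 1 ℚ./ 6

-- An approximation of `ℓ` up to 1 is rounded up to k. With X = max(1, ℓ) one has k ≤ X + 2 ≤ 3X and
-- 3 ≤ 3X, hence 3 + k ≤ 6X; both use X ≥ 1, which is where the truncation in `log⁺` enters.
log-bound : ∀ ℓ → ∃[ k ] ℓ ≤ fromℕ (suc k) × fromℚ (1/6 ℚ.* ι (3 ℕ.+ k)) ≤ log⁺ ℓ
log-bound ℓ with cauchy ℓ 1ℚ (ℚ.positive⁻¹ 1ℚ)
... | N , near with ceiling (seq ℓ N)
...   | k , r≤k , k≤ = k , upper , lower
  where
  open ℚ.≤-Reasoning
  r = seq ℓ N
  upper : ℓ ≤ fromℕ (suc k)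
  upper e e>0 = N , λ n N≤n → begin
    seq ℓ n               ≤⟨ ℚ.≤-trans (p≤q+∣p-q∣ (seq ℓ n) r) (ℚ.+-mono-≤ r≤k (near n N N≤n ℕ.≤-refl)) ⟩
    ι k ℚ.+ 1ℚ            ≡⟨ trans (ℚ.+-comm (ι k) 1ℚ) (sym (ι-+ 1 k)) ⟩
    ι (suc k)             ≡⟨ sym (ℚ.+-identityʳ (ι (suc k))) ⟩
    ι (suc k) ℚ.+ 0ℚ      ≤⟨ ℚ.+-monoʳ-≤ (ι (suc k)) (ℚ.<⇒≤ e>0) ⟩
    ι (suc k) ℚ.+ e       ∎
  lower : fromℚ (1/6 ℚ.* ι (3 ℕ.+ k)) ≤ log⁺ ℓ
  lower e e>0 = N , λ n N≤n →
    let X = 1ℚ ℚ.⊔ seq ℓ n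
        1≤X = ℚ.p≤p⊔q 1ℚ (seq ℓ n)
        ℓ≤X = ℚ.p≤q⊔p 1ℚ (seq ℓ n)
    in begin
    1/6 ℚ.* ι (3 ℕ.+ k)
      ≡⟨ cong (1/6 ℚ.*_) (ι-+ 3 k) ⟩
    1/6 ℚ.* (ι 3 ℚ.+ ι k)
      ≤⟨ *-monoˡ (from-yes (0ℚ ℚ.≤? 1/6)) (ℚ.+-mono-≤ (ι3≤ X 1≤X) (ℚ.≤-trans k≤ (ℚ.⊔-lub (ℚ.≤-trans (from-yes (0ℚ ℚ.≤? 1ℚ)) (≤3X X 1≤X))
           (r+1≤ X 1≤X (ℚ.≤-trans (p≤q+∣p-q∣ r (seq ℓ n)) (ℚ.+-mono-≤ ℓ≤X (near N n ℕ.≤-refl N≤n))))))) ⟩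
    1/6 ℚ.* (ι 3 ℚ.* X ℚ.+ ι 3 ℚ.* X)
      ≡⟨ solve 1 (λ x → con 1/6 :* (con (ι 3) :* x :+ con (ι 3) :* x) := x :+ con 0ℚ) refl X ⟩
    X ℚ.+ 0ℚ
      ≤⟨ ℚ.+-monoʳ-≤ X (ℚ.<⇒≤ e>0) ⟩
    X ℚ.+ e ∎
    where
    ι3≤ : ∀ X → 1ℚ ℚ.≤ X → ι 3 ℚ.≤ ι 3 ℚ.* X
    ι3≤ X 1≤X = *-monoˡ {1ℚ} {X} {ι 3} (from-yes (0ℚ ℚ.≤? ι 3)) 1≤X
    ≤3X : ∀ X → 1ℚ ℚ.≤ X → 1ℚ ℚ.≤ ι 3 ℚ.* X
    ≤3X X 1≤X = ℚ.≤-trans (from-yes (1ℚ ℚ.≤? ι 3)) (ι3≤ X 1≤X)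
    r+1≤ : ∀ X → 1ℚ ℚ.≤ X → r ℚ.≤ X ℚ.+ 1ℚ → r ℚ.+ 1ℚ ℚ.≤ ι 3 ℚ.* X
    r+1≤ X 1≤X r≤ = begin
      r ℚ.+ 1ℚ              ≤⟨ ℚ.+-monoˡ-≤ 1ℚ r≤ ⟩
      X ℚ.+ 1ℚ ℚ.+ 1ℚ       ≤⟨ ℚ.+-mono-≤ (ℚ.+-monoʳ-≤ X 1≤X) 1≤X ⟩
      X ℚ.+ X ℚ.+ X         ≡⟨ solve 1 (λ x → x :+ x :+ x := con (ι 3) :* x) refl X ⟩
      ι 3 ℚ.* X             ∎

-- Parities and conjunctions as monomials.

opaque
  unfolding GapWithin

  gap-within-cong : ∀ {n} (D : Distribution n) {f g r} → f ≗ g → GapWithin D g r → GapWithin D f r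
  gap-within-cong D {f} {g} {r} f≗g h = below {gap D f} {gap D g} {r} (λ k → ℚ.≤-reflexive (gap-cong D f g f≗g k)) h

  -- The factor 2 gives conjunctions the same bound per monomial as parities.
  gap-indicator : ∀ {n} (D : Distribution n) h {δ} → 0ℝ ≤ δ → ∣ Pr D h - Pr (uniform n) h ∣ ≤ δ →
    GapWithin D (λ x → indicator (h x)) (fromℚ 2ℚ * δ)
  gap-indicator {n} D h {δ} 0≤δ fooled =
    below {gap D (λ x → indicator (h x))} {∣ Pr D h - Pr (uniform n) h ∣} {fromℚ 2ℚ * δ} (λ k → ℚ.≤-reflexive (gap-Pr D h k))
      (≤-trans {∣ Pr D h - Pr (uniform n) h ∣} {δ} {fromℚ 2ℚ * δ} fooled
        (below {δ} {δ + 0ℝ} {fromℚ 2ℚ * δ} (λ k → ℚ.≤-reflexive (sym (ℚ.+-identityʳ (seq δ k))))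
          (above {δ + 0ℝ} {δ + δ} {fromℚ 2ℚ * δ} (+-mono-≤ {δ} {δ} {0ℝ} {δ} (≤-seq {δ} {δ} (λ _ → refl)) 0≤δ)
            (λ k → ℚ.≤-reflexive (double (seq δ k))))))
    where
    double : ∀ p → p ℚ.+ p ≡ 2ℚ ℚ.* p
    double = solve 1 (λ p → p :+ p := con 2ℚ :* p) refl

  -- The constant 1 has gap 0, and passing from values 0, 1 to signs doubles the gap.
  gap-character : ∀ {n} (D : Distribution n) h {δ} → ∣ Pr D h - Pr (uniform n) h ∣ ≤ δ →
    GapWithin D (λ x → 1ℚ ℚ.+ ℚ.- 2ℚ ℚ.* indicator (h x)) (fromℚ 2ℚ * δ)
  gap-character {n} D h {δ} fooled =
    below {gap D (λ x → 1ℚ ℚ.+ ℚ.- 2ℚ ℚ.* indicator (h x))} {gap D (λ _ → 1ℚ) + fromℚ 2ℚ * ∣ Pr D h - Pr (uniform n) h ∣} {fromℚ 2ℚ * δ} split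
      (above {gap D (λ _ → 1ℚ) + fromℚ 2ℚ * ∣ Pr D h - Pr (uniform n) h ∣} {0ℝ + fromℚ 2ℚ * δ} {fromℚ 2ℚ * δ}
        (+-mono-≤ {gap D (λ _ → 1ℚ)} {0ℝ} {fromℚ 2ℚ * ∣ Pr D h - Pr (uniform n) h ∣} {fromℚ 2ℚ * δ} (gap-1 D)
          (*-monoˡ-≤ {2ℚ} {∣ Pr D h - Pr (uniform n) h ∣} {δ} (from-yes (0ℚ ℚ.≤? 2ℚ)) fooled))
        (λ k → ℚ.≤-reflexive (ℚ.+-identityˡ (2ℚ ℚ.* seq δ k))))
    where
    open ℚ.≤-Reasoning
    split : ∀ k → seq (gap D (λ x → 1ℚ ℚ.+ ℚ.- 2ℚ ℚ.* indicator (h x))) k ℚ.≤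
      seq (gap D (λ _ → 1ℚ)) k ℚ.+ 2ℚ ℚ.* seq ∣ Pr D h - Pr (uniform n) h ∣ k
    split k = begin
      seq (gap D (λ x → 1ℚ ℚ.+ ℚ.- 2ℚ ℚ.* indicator (h x))) k
        ≤⟨ gap-+ D (λ _ → 1ℚ) (λ x → ℚ.- 2ℚ ℚ.* indicator (h x)) k ⟩
      seq (gap D (λ _ → 1ℚ)) k ℚ.+ seq (gap D (λ x → ℚ.- 2ℚ ℚ.* indicator (h x))) k
        ≡⟨ cong (λ p → seq (gap D (λ _ → 1ℚ)) k ℚ.+ p) (gap-scale D (ℚ.- 2ℚ) (λ x → indicator (h x)) k) ⟩
      seq (gap D (λ _ → 1ℚ)) k ℚ.+ 2ℚ ℚ.* seq (gap D (λ x → indicator (h x))) k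
        ≡⟨ cong (λ p → seq (gap D (λ _ → 1ℚ)) k ℚ.+ 2ℚ ℚ.* p) (gap-Pr D h k) ⟩
      seq (gap D (λ _ → 1ℚ)) k ℚ.+ 2ℚ ℚ.* seq ∣ Pr D h - Pr (uniform n) h ∣ k ∎

parity-sign : Bool → ℚ
parity-sign b = if b then -1ℚ else 1ℚ

module Parity {s : ℕ} where
  open Networks {s} parity-sign

  literal : ∀ i → Poly 1 3 (λ z → sign (z i))
  literal i = term (i ∷ []) (λ _ → -1ℚ) (s≤s z≤n) ℚ.≤-refl (λ z _ → value (z i))
    where
    value : ∀ b → sign b ≡ parity-sign b ℚ.* 1ℚ ℚ.* -1ℚ
    value true  = refl
    value false = refl

  mono-xor : ∀ {n} (g : Fin s → BoolFun n) S x →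
    mono S (λ i → g i x) ≡ 1ℚ ℚ.+ ℚ.- 2ℚ ℚ.* indicator (foldr _xor_ false (map (λ h → h x) (map g S)))
  mono-xor g []      x = refl
  mono-xor g (i ∷ S) x = trans (cong (parity-sign (g i x) ℚ.*_) (mono-xor g S x)) (value (g i x) _)
    where
    value : ∀ a b → parity-sign a ℚ.* (1ℚ ℚ.+ ℚ.- 2ℚ ℚ.* indicator b) ≡ 1ℚ ℚ.+ ℚ.- 2ℚ ℚ.* indicator (a xor b)
    value true  true  = refl
    value true  false = refl
    value false true  = refl
    value false false = refl

module Conjunction {s : ℕ} where
  open Networks {s} indicator
  open Amplification {s} indicator using (poly-const; poly-+)

  -- The sign is 2x - 1, with 2x written as x + x to keep the coefficients at most 1 in absolute
  -- value. This is the origin of the 3 terms per literal.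
  literal : ∀ i → Poly 1 3 (λ z → sign (z i))
  literal i = terms-resp (λ z _ → value (z i)) (poly-+ (poly-const {k = 0} -1ℚ ℚ.≤-refl) (poly-+ input input))
    where
    input : Poly 1 1 (λ z → indicator (z i))
    input = term (i ∷ []) (λ _ → 1ℚ) (s≤s z≤n) ℚ.≤-refl (λ z _ → unit (z i))
      where
      unit : ∀ b → indicator b ≡ indicator b ℚ.* 1ℚ ℚ.* 1ℚ
      unit true  = refl
      unit false = refl
    value : ∀ b → -1ℚ ℚ.+ (indicator b ℚ.+ indicator b) ≡ sign b
    value true  = refl
    value false = refl

  mono-and : ∀ {n} (g : Fin s → BoolFun n) S x →
    mono S (λ i → g i x) ≡ indicator (foldr _∧_ true (map (λ h → h x) (map g S)))
  mono-and g []      x = refl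
  mono-and g (i ∷ S) x = trans (cong (indicator (g i x) ℚ.*_) (mono-and g S x)) (value (g i x) _)
    where
    value : ∀ a b → indicator a ℚ.* indicator b ≡ indicator (a ∧ b)
    value true  true  = refl
    value true  false = refl
    value false true  = refl
    value false false = refl

-- Choice of the parameters.

-- suc (steps j) is 16 (j + 1), where j is the integer part of √s.
steps : ℕ → ℕ
steps j = j ℕ.+ 15 ℕ.* suc j

-- Binary logarithm of the bound on the number of terms: 4b for the base 2 + 3n, twice the number of
-- steps for the squared norm, and 2m for the tosses.
exponent : ℕ → ℕ → ℕ → ℕ
exponent j b m = 4 ℕ.* b ℕ.* ((16 ℕ.* suc j ℕ.+ 16 ℕ.* suc j) ℕ.* (m ℕ.+ m))

-- The hypothesis reads s + 1 ≤ (j + 1)², and 112 ≤ 256 = 16².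
steps-enough : ∀ {n s j} → n ≤ℕ s → s ℕ.< suc j ℕ.* suc j →
  16 ℕ.+ 112 ℕ.* n ≤ℕ suc (steps j) ℕ.* suc (steps j)
steps-enough {n} {s} {j} n≤s s< = begin
  16 ℕ.+ 112 ℕ.* n                          ≤⟨ ℕ.+-mono-≤ (ℕ.m≤m+n 16 96) (ℕ.*-monoʳ-≤ 112 n≤s) ⟩
  112 ℕ.+ 112 ℕ.* s                         ≡⟨ sym (ℕ.*-suc 112 s) ⟩
  112 ℕ.* suc s                             ≤⟨ ℕ.*-mono-≤ (ℕ.m≤m+n 112 144) s< ⟩
  256 ℕ.* (suc j ℕ.* suc j)                 ≡⟨ solveℕ 1 (λ j → conℕ 256 ⊗ (j ⊗ j) ⊜ conℕ 16 ⊗ j ⊗ (conℕ 16 ⊗ j)) refl (suc j) ⟩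
  16 ℕ.* suc j ℕ.* (16 ℕ.* suc j)           ∎
  where
  open ℕ.≤-Reasoning

weight-≤ : ∀ {n s b} j m → 0 ℕ.< n → n ≤ℕ s → 2 ≤ℕ s → s ℕ.< 2 ℕ.^ suc b → 0 ℕ.< b →
  let W = (2 ℕ.+ 3 ℕ.* n) ℕ.^ steps j in
  (1 ℕ.+ 2 ℕ.* (W ℕ.* W)) ℕ.^ (m ℕ.+ m) ≤ℕ 2 ℕ.^ exponent j b m
weight-≤ {n} {s} {b} j m 0<n n≤s 2≤s s<2^ 0<b = begin
  (1 ℕ.+ 2 ℕ.* (W ℕ.* W)) ℕ.^ (m ℕ.+ m)
    ≤⟨ ℕ.^-monoˡ-≤ (m ℕ.+ m) base ⟩
  (Q ℕ.^ (M ℕ.+ M)) ℕ.^ (m ℕ.+ m)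
    ≡⟨ ℕ.^-*-assoc Q (M ℕ.+ M) (m ℕ.+ m) ⟩
  Q ℕ.^ ((M ℕ.+ M) ℕ.* (m ℕ.+ m))
    ≡⟨ ℕ.^-*-assoc 2 (4 ℕ.* b) ((M ℕ.+ M) ℕ.* (m ℕ.+ m)) ⟩
  2 ℕ.^ exponent j b m ∎
  where
  open ℕ.≤-Reasoning
  k = steps j
  M = 16 ℕ.* suc j
  W = (2 ℕ.+ 3 ℕ.* n) ℕ.^ k
  Q = 2 ℕ.^ (4 ℕ.* b)
  2+3n≤Q : 2 ℕ.+ 3 ℕ.* n ≤ℕ Q
  2+3n≤Q = begin
    2 ℕ.+ 3 ℕ.* n             ≤⟨ ℕ.+-mono-≤ 2≤s (ℕ.*-monoʳ-≤ 3 n≤s) ⟩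
    4 ℕ.* s                   ≤⟨ ℕ.*-monoʳ-≤ 4 (ℕ.<⇒≤ s<2^) ⟩
    4 ℕ.* 2 ℕ.^ suc b         ≡⟨ sym (ℕ.^-distribˡ-+-* 2 2 (suc b)) ⟩
    2 ℕ.^ (3 ℕ.+ b)           ≤⟨ ℕ.^-monoʳ-≤ 2 (ℕ.≤-trans (ℕ.≤-reflexive (ℕ.+-comm 3 b)) (ℕ.+-monoʳ-≤ b (ℕ.*-monoʳ-≤ 3 0<b))) ⟩
    Q                         ∎
  3≤Q : 3 ≤ℕ Q
  3≤Q = ℕ.≤-trans (ℕ.+-monoʳ-≤ 2 (ℕ.≤-trans 0<n (ℕ.m≤n*m n 3))) 2+3n≤Q
  Y = Q ℕ.^ k ℕ.* Q ℕ.^ k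
  instance
    Q-nonZero : ℕ.NonZero Q
    Q-nonZero = ℕ.>-nonZero (ℕ.≤-trans (s≤s z≤n) 3≤Q)
  Q^k>0 : 0 ℕ.< Q ℕ.^ k
  Q^k>0 = ℕ.m^n>0 Q k
  W≤ : W ≤ℕ Q ℕ.^ k
  W≤ = ℕ.^-monoˡ-≤ k 2+3n≤Q
  -- There are k = M - 1 steps, so the exponent M + M leaves two spare factors `Q`, one of which
  -- absorbs the 3.
  base : 1 ℕ.+ 2 ℕ.* (W ℕ.* W) ≤ℕ Q ℕ.^ (M ℕ.+ M)
  base = begin
    1 ℕ.+ 2 ℕ.* (W ℕ.* W)           ≤⟨ ℕ.+-mono-≤ (ℕ.*-mono-≤ Q^k>0 Q^k>0) (ℕ.*-monoʳ-≤ 2 (ℕ.*-mono-≤ W≤ W≤)) ⟩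
    3 ℕ.* Y                         ≤⟨ ℕ.*-monoˡ-≤ Y 3≤Q ⟩
    Q ℕ.* (Q ℕ.^ k ℕ.* Q ℕ.^ k)     ≡⟨ sym (ℕ.*-assoc Q (Q ℕ.^ k) (Q ℕ.^ k)) ⟩
    Q ℕ.^ suc k ℕ.* Q ℕ.^ k         ≤⟨ ℕ.*-monoʳ-≤ (Q ℕ.^ suc k) (ℕ.m≤n*m (Q ℕ.^ k) Q) ⟩
    Q ℕ.^ suc k ℕ.* Q ℕ.^ suc k     ≡⟨ sym (ℕ.^-distribˡ-+-* Q (suc k) (suc k)) ⟩
    Q ℕ.^ (M ℕ.+ M)                 ∎

16*suc≤32* : ∀ {j} → 0 ℕ.< j → 16 ℕ.* suc j ≤ℕ 32 ℕ.* j
16*suc≤32* {j} 0<j = begin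
  16 ℕ.* suc j        ≤⟨ ℕ.*-monoʳ-≤ 16 (ℕ.+-monoˡ-≤ j 0<j) ⟩
  16 ℕ.* (j ℕ.+ j)    ≡⟨ solveℕ 1 (λ j → conℕ 16 ⊗ (j ⊕ j) ⊜ conℕ 32 ⊗ j) refl j ⟩
  32 ℕ.* j            ∎
  where
  open ℕ.≤-Reasoning

-- Here 16(j + 1) ≤ 32j gives 4 · 64 · 2 = 512, and the added m, which is the accuracy beyond
-- cancelling the number of terms, makes it 513.
exponent-≤ : ∀ {j b} m → 0 ℕ.< j → 0 ℕ.< b → exponent j b m ℕ.+ m ≤ℕ 513 ℕ.* (j ℕ.* b ℕ.* m)
exponent-≤ {j} {b} m 0<j 0<b = begin
  exponent j b m ℕ.+ m
    ≤⟨ ℕ.+-mono-≤ (ℕ.*-monoʳ-≤ (4 ℕ.* b) (ℕ.*-monoˡ-≤ (m ℕ.+ m) (ℕ.+-mono-≤ (16*suc≤32* 0<j) (16*suc≤32* 0<j))))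
         (ℕ.m≤n*m m (j ℕ.* b) {{ℕ.>-nonZero (ℕ.*-mono-≤ 0<j 0<b)}}) ⟩
  4 ℕ.* b ℕ.* ((32 ℕ.* j ℕ.+ 32 ℕ.* j) ℕ.* (m ℕ.+ m)) ℕ.+ j ℕ.* b ℕ.* m
    ≡⟨ solveℕ 3 (λ j b m → conℕ 4 ⊗ b ⊗ ((conℕ 32 ⊗ j ⊕ conℕ 32 ⊗ j) ⊗ (m ⊕ m)) ⊕ j ⊗ b ⊗ m ⊜ conℕ 513 ⊗ (j ⊗ b ⊗ m)) refl j b m ⟩
  513 ℕ.* (j ℕ.* b ℕ.* m) ∎
  where
  open ℕ.≤-Reasoning

degree-≤ : ∀ {j} m → 0 ℕ.< j → (steps j ℕ.+ steps j) ℕ.* (m ℕ.+ m) ≤ℕ 128 ℕ.* (j ℕ.* m)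
degree-≤ {j} m 0<j = begin
  (steps j ℕ.+ steps j) ℕ.* (m ℕ.+ m)
    ≤⟨ ℕ.*-monoˡ-≤ (m ℕ.+ m) (ℕ.+-mono-≤ k≤ k≤) ⟩
  (32 ℕ.* j ℕ.+ 32 ℕ.* j) ℕ.* (m ℕ.+ m)
    ≡⟨ solveℕ 2 (λ j m → (conℕ 32 ⊗ j ⊕ conℕ 32 ⊗ j) ⊗ (m ⊕ m) ⊜ conℕ 128 ⊗ (j ⊗ m)) refl j m ⟩
  128 ℕ.* (j ℕ.* m) ∎
  where
  open ℕ.≤-Reasoning
  k≤ : steps j ≤ℕ 32 ℕ.* j
  k≤ = ℕ.≤-trans (ℕ.n≤1+n (steps j)) (16*suc≤32* 0<j)

2^*½^ : ∀ x m → 2ℚ ^ℚ x ℚ.* ½ ^ℚ (x ℕ.+ m) ≡ ½ ^ℚ m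
2^*½^ zero    m = ℚ.*-identityˡ (½ ^ℚ m)
2^*½^ (suc x) m = trans
  (solve 2 (λ p q → con 2ℚ :* p :* (con ½ :* q) := p :* q) refl (2ℚ ^ℚ x) (½ ^ℚ (x ℕ.+ m)))
  (2^*½^ x m)

½^-≥0 : ∀ m → 0ℚ ℚ.≤ ½ ^ℚ m
½^-≥0 = ^ℚ-nonNeg (ℚ.<⇒≤ (ℚ.positive⁻¹ ½))

0≤2* : ∀ {δ} → 0ℝ ≤ δ → 0ℝ ≤ fromℚ 2ℚ * δ
0≤2* {δ} 0≤δ = below {0ℝ} {fromℚ 2ℚ * 0ℝ} {fromℚ 2ℚ * δ} (λ _ → ℚ.≤-refl) (*-monoˡ-≤ {2ℚ} {0ℝ} {δ} (from-yes (0ℚ ℚ.≤? 2ℚ)) 0≤δ)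

-- With η = ½^(3 + l), the monomials contribute at most 2η and the approximation error another 2η.
-- Together this is 4η = ½^(l + 1), which explains the 3.
error-≤ : ∀ {Λ X l δ ε} → 0ℝ ≤ δ → Λ ≤ℕ 2 ℕ.^ X → δ ≤ fromℚ (½ ^ℚ (X ℕ.+ (3 ℕ.+ l))) → fromℚ (½ ^ℚ suc l) ≤ ε →
  fromℕ Λ * (fromℚ 2ℚ * δ) + (fromℚ (½ ^ℚ (3 ℕ.+ l)) + fromℚ (½ ^ℚ (3 ℕ.+ l))) ≤ ε
error-≤ {Λ} {X} {l} {δ} {ε} 0≤δ Λ≤ δ≤ ≤ε =
  ≤-trans {fromℕ Λ * (fromℚ 2ℚ * δ) + (fromℚ η + fromℚ η)} {fromℚ (c ℚ.* β) + (fromℚ η + fromℚ η)} {ε}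
    (+-mono-≤ {fromℕ Λ * (fromℚ 2ℚ * δ)} {fromℚ (c ℚ.* β)} {fromℚ η + fromℚ η} {fromℚ η + fromℚ η} first (≤-seq {fromℚ η + fromℚ η} {fromℚ η + fromℚ η} (λ _ → refl)))
    (below {fromℚ (c ℚ.* β) + (fromℚ η + fromℚ η)} {fromℚ (½ ^ℚ suc l)} {ε} (λ _ → ℚ.≤-reflexive total≡) ≤ε)
  where
  c = ι (2 ℕ.^ X) ℚ.* 2ℚ
  β = ½ ^ℚ (X ℕ.+ (3 ℕ.+ l))
  η = ½ ^ℚ (3 ℕ.+ l)
  first : fromℕ Λ * (fromℚ 2ℚ * δ) ≤ fromℚ (c ℚ.* β)
  first = ≤-trans {fromℕ Λ * (fromℚ 2ℚ * δ)} {fromℕ (2 ℕ.^ X) * (fromℚ 2ℚ * δ)} {fromℚ (c ℚ.* β)}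
    (fromℕ-*-monoˡ {Λ} {2 ℕ.^ X} {fromℚ 2ℚ * δ} (0≤2* {δ} 0≤δ) Λ≤)
    (below {fromℕ (2 ℕ.^ X) * (fromℚ 2ℚ * δ)} {fromℚ c * δ} {fromℚ (c ℚ.* β)}
      (λ n → ℚ.≤-reflexive (sym (ℚ.*-assoc (ι (2 ℕ.^ X)) 2ℚ (seq δ n))))
      (*-monoˡ-≤ {c} {δ} {fromℚ β} (*-nonNeg (ι-nonNeg (2 ℕ.^ X)) (from-yes (0ℚ ℚ.≤? 2ℚ))) δ≤))
  total≡ : c ℚ.* β ℚ.+ (η ℚ.+ η) ≡ ½ ^ℚ suc l
  total≡ = begin
    c ℚ.* β ℚ.+ (η ℚ.+ η)
      ≡⟨ cong (λ p → p ℚ.* 2ℚ ℚ.* β ℚ.+ (η ℚ.+ η)) (ι-2^ X) ⟩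
    2ℚ ^ℚ X ℚ.* 2ℚ ℚ.* β ℚ.+ (η ℚ.+ η)
      ≡⟨ solve 3 (λ p b e → p :* con 2ℚ :* b :+ (e :+ e) := con 2ℚ :* (p :* b) :+ (e :+ e)) refl (2ℚ ^ℚ X) β η ⟩
    2ℚ ℚ.* (2ℚ ^ℚ X ℚ.* β) ℚ.+ (η ℚ.+ η)
      ≡⟨ cong (λ p → 2ℚ ℚ.* p ℚ.+ (η ℚ.+ η)) (2^*½^ X (3 ℕ.+ l)) ⟩
    2ℚ ℚ.* η ℚ.+ (η ℚ.+ η)
      ≡⟨ solve 1 (λ p → con 2ℚ :* (con ½ :* (con ½ :* p)) :+ (con ½ :* (con ½ :* p) :+ con ½ :* (con ½ :* p)) := p) refl (½ ^ℚ suc l) ⟩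
    ½ ^ℚ suc l ∎
    where open ≡-Reasoning

-- 513 comes from exponent-≤, and 12 makes up for the factors ½ in log-≥ and 1/6 in log-bound.
constant : ℕ
constant = 513 ℕ.* 12

degree-within : ∀ {j m x y} → 0 ℕ.< j → 0 ℕ.< m → fromℕ j ≤ x → fromℚ (1/6 ℚ.* ι m) ≤ y → ∀ {d} → d ≤ℕ 128 ℕ.* (j ℕ.* m) →
  fromℕ d ≤ fromℕ constant * x * y
degree-within {j} {m} {x} {y} 0<j 0<m j≤x m≤y {d} d≤ =
  ≤-trans {fromℕ d} {fromℚ (ι constant ℚ.* ι j ℚ.* (1/6 ℚ.* ι m))} {fromℕ constant * x * y}
    (fromℚ-mono (begin
      ι d                                         ≤⟨ ι-mono (ℕ.≤-trans d≤ (ℕ.*-monoˡ-≤ (j ℕ.* m) (ℕ.m≤m+n 128 898))) ⟩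
      -- 1026 is `constant` times the factor 1/6 lost in `log-bound`.
      ι (1026 ℕ.* (j ℕ.* m))                      ≡⟨ trans (ι-* 1026 (j ℕ.* m)) (cong (ι 1026 ℚ.*_) (ι-* j m)) ⟩
      ι 1026 ℚ.* (ι j ℚ.* ι m)                    ≡⟨ solve 2 (λ j m → con (ι 1026) :* (j :* m) := con (ι constant) :* j :* (con 1/6 :* m)) refl (ι j) (ι m) ⟩
      ι constant ℚ.* ι j ℚ.* (1/6 ℚ.* ι m)        ∎))
    (*-mono-lower {ι constant ℚ.* ι j} {1/6 ℚ.* ι m} {fromℕ constant * x} {y}
      (*-pos (ι-pos {constant} (s≤s z≤n)) (ι-pos 0<j)) (*-pos (ℚ.positive⁻¹ 1/6) (ι-pos 0<m))
      (*-mono-lower {ι constant} {ι j} {fromℕ constant} {x} (ι-pos {constant} (s≤s z≤n)) (ι-pos 0<j) (fromℚ-mono {ι constant} ℚ.≤-refl) j≤x)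
      m≤y)
  where open ℚ.≤-Reasoning

exponent-within : ∀ {j b m x y z} → 0 ℕ.< j → 0 ℕ.< b → 0 ℕ.< m →
  fromℕ j ≤ x → fromℚ (½ ℚ.* ι b) ≤ y → fromℚ (1/6 ℚ.* ι m) ≤ z → ∀ {K} → K ≤ℕ 513 ℕ.* (j ℕ.* b ℕ.* m) →
  fromℕ K ≤ fromℕ constant * x * y * z
exponent-within {j} {b} {m} {x} {y} {z} 0<j 0<b 0<m j≤x b≤y m≤z {K} K≤ =
  ≤-trans {fromℕ K} {fromℚ (ι constant ℚ.* ι j ℚ.* (½ ℚ.* ι b) ℚ.* (1/6 ℚ.* ι m))} {fromℕ constant * x * y * z}
    (fromℚ-mono (begin
      ι K                                         ≤⟨ ι-mono K≤ ⟩
      ι (513 ℕ.* (j ℕ.* b ℕ.* m))                 ≡⟨ trans (ι-* 513 (j ℕ.* b ℕ.* m)) (cong (ι 513 ℚ.*_) (trans (ι-* (j ℕ.* b) m) (cong (ℚ._* ι m) (ι-* j b)))) ⟩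
      ι 513 ℚ.* (ι j ℚ.* ι b ℚ.* ι m)             ≡⟨ solve 3 (λ j b m → con (ι 513) :* (j :* b :* m)
                                                       := con (ι constant) :* j :* (con ½ :* b) :* (con 1/6 :* m)) refl (ι j) (ι b) (ι m) ⟩
      ι constant ℚ.* ι j ℚ.* (½ ℚ.* ι b) ℚ.* (1/6 ℚ.* ι m) ∎))
    (*-mono-lower {ι constant ℚ.* ι j ℚ.* (½ ℚ.* ι b)} {1/6 ℚ.* ι m} {fromℕ constant * x * y} {z}
      (*-pos cj>0 ½b>0) (*-pos (ℚ.positive⁻¹ 1/6) (ι-pos 0<m))
      (*-mono-lower {ι constant ℚ.* ι j} {½ ℚ.* ι b} {fromℕ constant * x} {y} cj>0 ½b>0
        (*-mono-lower {ι constant} {ι j} {fromℕ constant} {x} (ι-pos {constant} (s≤s z≤n)) (ι-pos 0<j) (fromℚ-mono {ι constant} ℚ.≤-refl) j≤x)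
        b≤y)
      m≤z)
  where
  open ℚ.≤-Reasoning
  cj>0 : 0ℚ ℚ.< ι constant ℚ.* ι j
  cj>0 = *-pos (ι-pos {constant} (s≤s z≤n)) (ι-pos 0<j)
  ½b>0 : 0ℚ ℚ.< ½ ℚ.* ι b
  ½b>0 = *-pos (ℚ.positive⁻¹ ½) (ι-pos 0<b)

-- From fooling monomials to fooling formulas.

module _ {s n : ℕ} (χ : Bool → ℚ) (D : Distribution n) (g : Fin s → BoolFun n) where
  open Networks {s} χ

  formula-close : (∀ i → Poly 1 3 (λ z → sign (z i))) →
    ∀ {j b l δ ε} → 0ℝ ≤ δ → 2 ≤ℕ s → s ℕ.< suc j ℕ.* suc j → 0 ℕ.< b → s ℕ.< 2 ℕ.^ suc b →
    δ ≤ fromℚ (½ ^ℚ (exponent j b (3 ℕ.+ l) ℕ.+ (3 ℕ.+ l))) → fromℚ (½ ^ℚ suc l) ≤ ε →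
    (∀ S → length S ≤ℕ (steps j ℕ.+ steps j) ℕ.* (3 ℕ.+ l ℕ.+ (3 ℕ.+ l)) → GapWithin D (λ x → mono S (λ i → g i x)) (fromℚ 2ℚ * δ)) →
    ∀ F → size F ≤ℕ s → ∀ h → h ≗ (λ x → eval F (λ i → g i x)) → ∣ Pr D h - Pr (uniform n) h ∣ ≤ ε
  formula-close literal {j} {b} {l} {δ} {ε} 0≤δ 2≤s s<j² 0<b s<2^b δ≤ ≤ε fooled F F≤s h h≗ =
    close (Amplification.approximation χ literal F (steps j) m (s≤s z≤n) (steps-enough {j = j} F≤s s<j²))
    where
    open Fooling {s} {n} χ D g {(steps j ℕ.+ steps j) ℕ.* (3 ℕ.+ l ℕ.+ (3 ℕ.+ l))} {fromℚ 2ℚ * δ} (0≤2* {δ} 0≤δ)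
    m = 3 ℕ.+ l
    W = (2 ℕ.+ 3 ℕ.* size F) ℕ.^ steps j
    Λ = (1 ℕ.+ 2 ℕ.* (W ℕ.* W)) ℕ.^ (m ℕ.+ m)
    close : (∃[ p ] Poly ((steps j ℕ.+ steps j) ℕ.* (m ℕ.+ m)) Λ p × (∀ z → ℚ.∣ indicator (eval F z) ℚ.- p z ∣ ℚ.≤ ½ ^ℚ m)) →
      ∣ Pr D h - Pr (uniform n) h ∣ ≤ ε
    close (p , p-poly , p≈F) = ≤-trans
      {∣ Pr D h - Pr (uniform n) h ∣} {fromℕ Λ * (fromℚ 2ℚ * δ) + (fromℚ (½ ^ℚ m) + fromℚ (½ ^ℚ m))} {ε}
      (fooled-close (fooled-terms (λ S S≤ → fooled⁺ (fooled S S≤)) p-poly) (½^-≥0 m)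
        (λ x → subst (λ v → ℚ.∣ indicator v ℚ.- p (at x) ∣ ℚ.≤ ½ ^ℚ m) (sym (h≗ x)) (p≈F (at x))))
      (error-≤ {Λ} {exponent j b m} {l} {δ} {ε} 0≤δ
        (weight-≤ {size F} {s} {b} j m (size-pos F) F≤s 2≤s s<2^b 0<b) δ≤ ≤ε)

length-map-≤ : ∀ {A : Set} {s d} (g : Fin s → A) S → length S ≤ℕ d → length (map g S) ≤ℕ d
length-map-≤ g S S≤ = ℕ.≤-trans (ℕ.≤-reflexive (List.length-map g S)) S≤

all-map : ∀ {n s} {𝒢 : Class n} {g : Fin s → BoolFun n} → (∀ i → 𝒢 (g i)) → ∀ S → All 𝒢 (map g S)
all-map h []      = []
all-map h (i ∷ S) = h i ∷ all-map h S

module _ {n s : ℕ} {𝒢 : Class n} (D : Distribution n) (2≤s : 2 ≤ℕ s) {ε δ t : ℝ} (0≤δ : 0ℝ ≤ δ)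
  {j b l : ℕ} (s<[j+1]² : s ℕ.< suc j ℕ.* suc j) (0<b : 0 ℕ.< b) (s<2^[b+1] : s ℕ.< 2 ℕ.^ suc b)
  (degree : ∀ {d} → d ≤ℕ (steps j ℕ.+ steps j) ℕ.* (3 ℕ.+ l ℕ.+ (3 ℕ.+ l)) → fromℕ d ≤ t)
  (δ≤ : δ ≤ fromℚ (½ ^ℚ (exponent j b (3 ℕ.+ l) ℕ.+ (3 ℕ.+ l)))) (≤ε : fromℚ (½ ^ℚ suc l) ≤ ε) where

  parities-fool-formulas : D Fools[ δ ] (XOR≤[ t ]∘ 𝒢) → D Fools[ ε ] (FORMULA[ s ]∘ 𝒢)
  parities-fool-formulas fools h (F , F≤s , g , g∈𝒢 , h≗) =
    formula-close parity-sign D g Parity.literal {j} {b} {l} {δ} {ε} 0≤δ 2≤s s<[j+1]² 0<b s<2^[b+1] δ≤ ≤ε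
      (λ S S≤ → gap-within-cong D (Parity.mono-xor g S) (gap-character D (parity S) {δ}
        (fools (parity S) (map g S , all-map g∈𝒢 S , degree (length-map-≤ g S S≤) , λ _ → refl))))
      F F≤s h h≗
    where
    parity : List (Fin s) → BoolFun n
    parity S x = foldr _xor_ false (map (λ f → f x) (map g S))

  conjunctions-fool-formulas : D Fools[ δ ] (AND≤[ t ]∘ 𝒢) → D Fools[ ε ] (FORMULA[ s ]∘ 𝒢)
  conjunctions-fool-formulas fools h (F , F≤s , g , g∈𝒢 , h≗) =
    formula-close indicator D g Conjunction.literal {j} {b} {l} {δ} {ε} 0≤δ 2≤s s<[j+1]² 0<b s<2^[b+1] δ≤ ≤ε
      (λ S S≤ → gap-within-cong D (Conjunction.mono-and g S) (gap-indicator D (conjunction S) {δ} 0≤δ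
        (fools (conjunction S) (map g S , all-map g∈𝒢 S , degree (length-map-≤ g S S≤) , λ _ → refl))))
      F F≤s h h≗
    where
    conjunction : List (Fin s) → BoolFun n
    conjunction S x = foldr _∧_ true (map (λ f → f x) (map g S))

n<2^n : ∀ n → n ℕ.< 2 ℕ.^ n
n<2^n zero    = s≤s z≤n
n<2^n (suc n) = ℕ.+-mono-≤ (ℕ.m^n>0 2 n) (ℕ.≤-trans (n<2^n n) (ℕ.m≤m+n (2 ℕ.^ n) 0))

theorem4p1 : ∃[ c ] 0ℝ < c × (∀ (n : ℕ) (𝒢 : Class n) (s : ℕ) → 2 ≤ℕ s →
    ∀ (ε : ℝ) → 0ℝ < ε → ε < 1ℝ →
    ∀ (√s log-s log-1/ε δ : ℝ) →
    √s IsSqrtOf fromℕ s →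
    fromℕ s ≃2^ log-s →
    ε ≃2^ (- log-1/ε) →
    let t = c * √s * log⁺ log-1/ε in
    δ ≃2^ (- (c * √s * log-s * log⁺ log-1/ε)) →
    ∀ (D : Distribution n) →
    (D Fools[ δ ] (XOR≤[ t ]∘ 𝒢) → D Fools[ ε ] (FORMULA[ s ]∘ 𝒢)) ×
    (D Fools[ δ ] (AND≤[ t ]∘ 𝒢) → D Fools[ ε ] (FORMULA[ s ]∘ 𝒢)))
theorem4p1 = fromℕ constant , (1ℚ , ℚ.positive⁻¹ 1ℚ , 0 , λ _ _ → from-yes (0ℚ ℚ.+ 1ℚ ℚ.≤? ι constant)) ,
  λ n 𝒢 s 2≤s ε _ _ √s log-s log-1/ε δ √s-sqrt s-log ε-log δ-log D →
    -- The integer part of √s is j = `suc i`; indexing from 1 records that j is positive.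
    let i , i²≤s , s<i² = last-below (λ i → suc i ℕ.* suc i) s s (ℕ.<⇒≤ 2≤s) (ℕ.m≤m+n (suc s) (s ℕ.* suc s))
        -- The integer part of log₂ s is b = `suc a`, positive because s ≥ 2.
        a , 2^a≤s , s<2^a = last-below (λ i → 2 ℕ.^ suc i) s s 2≤s (ℕ.<-trans (ℕ.n<1+n s) (n<2^n (suc s)))
        l , ℓ≤ , m≤ = log-bound log-1/ε
        m = 3 ℕ.+ l
        X = exponent (suc i) (suc a) m
        y = fromℕ constant * √s * log-s * log⁺ log-1/ε
        t = fromℕ constant * √s * log⁺ log-1/ε
        -- Exposes the successor in the exponent X + m, the form that `≤-2^-` expects.
        X+m≡ = ℕ.+-suc X (2 ℕ.+ l)
        j≤√s = sqrt-≥ {s} {suc i} {√s} √s-sqrt (s≤s z≤n) i²≤s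
        0≤δ = <⇒≤ {0ℝ} {δ} (proj₁ δ-log)
        degree = λ {d} d≤ → degree-within {suc i} {m} {√s} {log⁺ log-1/ε} (s≤s z≤n) (s≤s z≤n) j≤√s m≤ {d}
          (ℕ.≤-trans d≤ (degree-≤ {suc i} m (s≤s z≤n)))
        K≤y = exponent-within {suc i} {suc a} {m} {√s} {log-s} {log⁺ log-1/ε} (s≤s z≤n) (s≤s z≤n) (s≤s z≤n)
          j≤√s (log-≥ {s} {a} {log-s} s-log 2^a≤s) m≤ {suc (X ℕ.+ (2 ℕ.+ l))}
          (ℕ.≤-trans (ℕ.≤-reflexive (sym X+m≡)) (exponent-≤ {suc i} {suc a} m (s≤s z≤n) (s≤s z≤n)))
        δ≤ = subst (λ K → δ ≤ fromℚ (½ ^ℚ K)) (sym X+m≡) (≤-2^- {δ} {y} (X ℕ.+ (2 ℕ.+ l)) δ-log K≤y)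
        ≤ε = 2^-≤ {ε} {log-1/ε} l ε-log ℓ≤
    in parities-fool-formulas {𝒢 = 𝒢} D 2≤s {ε} {δ} {t} 0≤δ {suc i} {suc a} {l} s<i² (s≤s z≤n) s<2^a degree δ≤ ≤ε
     , conjunctions-fool-formulas {𝒢 = 𝒢} D 2≤s {ε} {δ} {t} 0≤δ {suc i} {suc a} {l} s<i² (s≤s z≤n) s<2^a degree δ≤ ≤ε
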